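{- Let $k\ge2$ be an integer. There exist positive constants $c_k,C_k,K_k,\kappa_k,\theta_k$ depending only on $k$ such that the following holds. Let $\delta\in(0,1]$ and $X_1,\dots,X_k,L\in[1,\infty)$, and put $$M:=\left\lceil c_k\,\delta^{ -1/(k-1)}\right\rceil,\qquad Q:=C_k\left(\frac{\prod_{i=1}^kX_i}{L}\right)^{1/(k-1)}.$$ Assume that $$K_k\,M\log(2M)\le Q\le\kappa_k\min_{1\le i\le k}X_i.$$ Then there exist sets of integers $A_i\subset[X_i,2X_i]$ ($1\le i\le k$) such that $$\#\Bigl\{(a_1,\dots,a_k)\in\prod_{i=1}^kA_i:\ \operatorname{lcm}(a_1,\dots,a_k)\le L\Bigr\}\ge\delta\prod_{i=1}^k|A_i|$$ and $$\prod_{i=1}^k|A_i|\ge\theta_k\,\delta^{ -\frac{k}{k-1}}\,\frac{L^{\frac{k}{k-1}}}{\bigl(\prod_{i=1}^kX_i\bigr)^{1/(k-1)}}.$$ -}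

module Defs where

-- The real numbers used here are the (two-sided, located) Dedekind reals over
-- the library's ℚ, built constructively; nothing about them is assumed.

open import Data.Nat.Base as ℕ using (ℕ; zero; suc; NonTrivial)
import Data.Nat.Properties as ℕ
open import Data.Integer.Base as ℤ using (ℤ; +_; -[1+_])
import Data.Integer.Properties as ℤ
import Data.Integer.LCM as ℤ
open import Data.Rational.Base hiding (_≥_; _>_)
open import Data.Rational.Properties
import Data.Rational.Unnormalised.Base as ℚᵘ
import Data.Rational.Unnormalised.Properties as ℚᵘ
open import Data.Rational.Solver using (module +-*-Solver)
open import Data.List.Base using (List; length)
open import Data.List.Membership.Propositional using (_∈_)
open import Data.List.Relation.Unary.Unique.Propositional using (Unique)
open import Data.Vec.Base using (Vec; foldr′)
open import Data.Vec.Functional using (Vector; foldr; head; tail)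
open import Data.Product.Base using (∃; ∃-syntax; Σ-syntax; _×_; _,_)
open import Data.Sum.Base using (_⊎_; inj₁; inj₂; [_,_]′)
open import Data.Empty using (⊥; ⊥-elim)
open import Function.Base using (_$_)
open import Relation.Nullary using (yes; no)
open import Relation.Binary.PropositionalEquality
  using (_≡_; refl; sym; trans; cong; subst; subst₂)
open import Algebra.Definitions.RawSemiring +-*-rawSemiring using (_^_)
open import Algebra.Bundles using (CommutativeRing)
open import Algebra.Properties.Semiring.Exp
  (CommutativeRing.semiring +-*-commutativeRing) using (^-assocʳ)
open import Algebra.Properties.CommutativeSemiring.Exp
  (CommutativeRing.commutativeSemiring +-*-commutativeRing) using (^-distrib-*)

open +-*-Solver

module ℚ-Lemmas where

  variable
    p q r a b c d : ℚ

  ≤-by : ∀ e → 0ℚ ≤ e → q ≡ p + e → p ≤ q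
  ≤-by {p = p} e 0≤e refl = subst (_≤ p + e) (+-identityʳ p) (+-monoʳ-≤ p 0≤e)

  <-by : ∀ e → 0ℚ < e → q ≡ p + e → p < q
  <-by {p = p} e 0<e refl = subst (_< p + e) (+-identityʳ p) (+-monoʳ-< p 0<e)

  diff-≤ : p ≤ q → 0ℚ ≤ q - p
  diff-≤ {p} {q} p≤q = subst (_≤ q - p) (+-inverseʳ p) (+-monoˡ-≤ (- p) p≤q)

  diff-< : p < q → 0ℚ < q - p
  diff-< {p} {q} p<q = subst (_< q - p) (+-inverseʳ p) (+-monoˡ-< (- p) p<q)

  ≤-or-> : ∀ p q → p ≤ q ⊎ q < p
  ≤-or-> p q with p ≤? q
  ... | yes p≤q = inj₁ p≤q
  ... | no  p≰q = inj₂ (≰⇒> p≰q)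

  0≤+ : 0ℚ ≤ p → 0ℚ ≤ q → 0ℚ ≤ p + q
  0≤+ = +-mono-≤

  0<+≤ : 0ℚ < p → 0ℚ ≤ q → 0ℚ < p + q
  0<+≤ = +-mono-<-≤

  *-monoˡ : 0ℚ ≤ r → p ≤ q → r * p ≤ r * q
  *-monoˡ {r} 0≤r = *-monoˡ-≤-nonNeg r {{nonNegative 0≤r}}

  *-monoʳ : 0ℚ ≤ r → p ≤ q → p * r ≤ q * r
  *-monoʳ {r} 0≤r = *-monoʳ-≤-nonNeg r {{nonNegative 0≤r}}

  *-antiˡ : r ≤ 0ℚ → p ≤ q → r * q ≤ r * p
  *-antiˡ {r} r≤0 = *-monoˡ-≤-nonPos r {{nonPositive r≤0}}

  *-antiʳ : r ≤ 0ℚ → p ≤ q → q * r ≤ p * r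
  *-antiʳ {r} r≤0 = *-monoʳ-≤-nonPos r {{nonPositive r≤0}}

  *-monoˡ-< : 0ℚ < r → p < q → r * p < r * q
  *-monoˡ-< {r} 0<r = *-monoʳ-<-pos r {{positive 0<r}}

  *-monoʳ-< : 0ℚ < r → p < q → p * r < q * r
  *-monoʳ-< {r} 0<r = *-monoˡ-<-pos r {{positive 0<r}}

  *-mono : 0ℚ ≤ p → 0ℚ ≤ d → p ≤ q → c ≤ d → p * c ≤ q * d
  *-mono 0≤p 0≤d p≤q c≤d = ≤-trans (*-monoˡ 0≤p c≤d) (*-monoʳ 0≤d p≤q)

  0≤* : 0ℚ ≤ p → 0ℚ ≤ q → 0ℚ ≤ p * q
  0≤* {p} {q} 0≤p 0≤q = subst (_≤ p * q) (*-zeroʳ p) (*-monoˡ 0≤p 0≤q)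

  0<* : 0ℚ < p → 0ℚ < q → 0ℚ < p * q
  0<* {p} {q} 0<p 0<q = subst (_< p * q) (*-zeroʳ p) (*-monoˡ-< 0<p 0<q)

  0<1 : 0ℚ < 1ℚ
  0<1 = positive⁻¹ 1ℚ

  0≤1 : 0ℚ ≤ 1ℚ
  0≤1 = <⇒≤ 0<1

  p<p+1 : ∀ p → p < p + 1ℚ
  p<p+1 p = <-by 1ℚ 0<1 refl

  p-1<p : ∀ p → p - 1ℚ < p
  p-1<p p = <-by 1ℚ 0<1 (solve 1 (λ x → x := x :- con 1ℚ :+ con 1ℚ) refl p)

  abstract

    inv : 0ℚ < p → ∃[ i ] 0ℚ < i × p * i ≡ 1ℚ
    inv {p} 0<p = (1/ p) {{p≢0}} , positive⁻¹ ((1/ p) {{p≢0}}) {{1/pos⇒pos p {{p>0}}}} ,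
                  *-inverseʳ p {{p≢0}}
      where
      p>0 : Positive p
      p>0 = positive 0<p
      p≢0 : NonZero p
      p≢0 = pos⇒nonZero p {{p>0}}

  square-≥0 : ∀ p → 0ℚ ≤ p * p
  square-≥0 p with ≤-total 0ℚ p
  ... | inj₁ 0≤p = 0≤* 0≤p 0≤p
  ... | inj₂ p≤0 = subst (_≤ p * p) (*-zeroʳ p) (*-antiˡ p≤0 p≤0)

  ∣-∣-upper : ∀ p → p ≤ ∣ p ∣
  ∣-∣-upper p with ≤-total 0ℚ p
  ... | inj₁ 0≤p = ≤-reflexive (sym (0≤p⇒∣p∣≡p 0≤p))
  ... | inj₂ p≤0 = ≤-trans p≤0 (0≤∣p∣ p)

  ∣-∣-lower : ∀ p → - ∣ p ∣ ≤ p
  ∣-∣-lower p = subst (- ∣ p ∣ ≤_) (neg-involutive p)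
    (neg-antimono-≤ (subst (- p ≤_) (∣-p∣≡∣p∣ p) (∣-∣-upper (- p))))
    where
    neg-involutive : ∀ p → - (- p) ≡ p
    neg-involutive = solve 1 (λ x → :- (:- x) := x) refl

  fromℕℚ : ℕ → ℚ
  fromℕℚ n = + n / 1

  fromℕℚ-suc : ∀ n → fromℕℚ (suc n) ≡ 1ℚ + fromℕℚ n
  fromℕℚ-suc n = toℚᵘ-injective $ begin
    toℚᵘ (fromℕℚ (suc n))            ≈⟨ toℚᵘ-fromℚᵘ (ℚᵘ.mkℚᵘ (+ suc n) 0) ⟩
    ℚᵘ.mkℚᵘ (+ suc n) 0              ≈⟨ ℚᵘ.*≡* eq ⟩
    ℚᵘ.1ℚᵘ ℚᵘ.+ ℚᵘ.mkℚᵘ (+ n) 0      ≈⟨ ℚᵘ.+-congʳ ℚᵘ.1ℚᵘ (toℚᵘ-fromℚᵘ (ℚᵘ.mkℚᵘ (+ n) 0)) ⟨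
    ℚᵘ.1ℚᵘ ℚᵘ.+ toℚᵘ (fromℕℚ n)      ≈⟨ toℚᵘ-homo-+ 1ℚ (fromℕℚ n) ⟨
    toℚᵘ (1ℚ + fromℕℚ n)             ∎
    where
    open ℚᵘ.≃-Reasoning
    eq : + suc n ℤ.* + 1 ≡ (+ 1 ℤ.* + 1 ℤ.+ + n ℤ.* + 1) ℤ.* + 1
    eq = cong (ℤ._* + 1) (cong (ℤ._+_ (+ 1)) (sym (ℤ.*-identityʳ (+ n))))

  0≤fromℕℚ : ∀ n → 0ℚ ≤ fromℕℚ n
  0≤fromℕℚ n = nonNegative⁻¹ (fromℕℚ n) {{normalize-nonNeg n 1}}

  0<fromℕℚ : ∀ n .{{_ : ℕ.NonZero n}} → 0ℚ < fromℕℚ n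
  0<fromℕℚ n = positive⁻¹ (fromℕℚ n) {{normalize-pos n 1}}

  0<1/suc : ∀ n → 0ℚ < + 1 / suc n
  0<1/suc n = positive⁻¹ (+ 1 / suc n) {{normalize-pos 1 (suc n)}}

  suc*1/suc : ∀ n → fromℕℚ (suc n) * (+ 1 / suc n) ≡ 1ℚ
  suc*1/suc n = toℚᵘ-injective $ begin
    toℚᵘ (fromℕℚ (suc n) * (+ 1 / suc n))           ≈⟨ toℚᵘ-homo-* (fromℕℚ (suc n)) (+ 1 / suc n) ⟩
    toℚᵘ (fromℕℚ (suc n)) ℚᵘ.* toℚᵘ (+ 1 / suc n)   ≈⟨ ℚᵘ.*-cong (toℚᵘ-fromℚᵘ (ℚᵘ.mkℚᵘ (+ suc n) 0)) (toℚᵘ-fromℚᵘ (ℚᵘ.mkℚᵘ (+ 1) n)) ⟩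
    ℚᵘ.mkℚᵘ (+ suc n) 0 ℚᵘ.* ℚᵘ.mkℚᵘ (+ 1) n        ≈⟨ ℚᵘ.*≡* (eq n) ⟩
    ℚᵘ.1ℚᵘ                                           ∎
    where
    open ℚᵘ.≃-Reasoning
    eq : ∀ n → (+ suc n ℤ.* + 1) ℤ.* + 1 ≡ + 1 ℤ.* (+ 1 ℤ.* + suc n)
    eq n = trans (ℤ.*-identityʳ (+ suc n ℤ.* + 1)) (trans (ℤ.*-comm (+ suc n) (+ 1))
             (sym (ℤ.*-identityˡ (+ 1 ℤ.* + suc n))))

  archimedean : ∀ p → ∃[ n ] p < fromℕℚ (suc n)
  archimedean p@(mkℚ _ d _) = ℤ.∣ ↥ p ∣ , ≤-<-trans (≤-trans (∣-∣-upper p) le) lt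
    where
    n = ℤ.∣ ↥ p ∣
    lt : fromℕℚ n < fromℕℚ (suc n)
    lt = <-by 1ℚ 0<1 (trans (fromℕℚ-suc n) (+-comm 1ℚ (fromℕℚ n)))
    le : ∣ p ∣ ≤ fromℕℚ n
    le = toℚᵘ-cancel-≤ (ℚᵘ.≤-trans
           (ℚᵘ.*≤* {q = ℚᵘ.mkℚᵘ (+ n) 0}
             (ℤ.*-monoˡ-≤-nonNeg (+ n) (ℤ.+≤+ (ℕ.s≤s (ℕ.z≤n {d})))))
           (ℚᵘ.≤-reflexive (ℚᵘ.≃-sym (toℚᵘ-fromℚᵘ (ℚᵘ.mkℚᵘ (+ n) 0)))))

  ^-≥0 : ∀ n → 0ℚ ≤ p → 0ℚ ≤ p ^ n
  ^-≥0 zero    0≤p = 0≤1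
  ^-≥0 (suc n) 0≤p = 0≤* 0≤p (^-≥0 n 0≤p)

  ^-mono-≤ : ∀ n → 0ℚ ≤ p → p ≤ q → p ^ n ≤ q ^ n
  ^-mono-≤ zero    0≤p p≤q = ≤-refl
  ^-mono-≤ (suc n) 0≤p p≤q =
    *-mono 0≤p (^-≥0 n (≤-trans 0≤p p≤q)) p≤q (^-mono-≤ n 0≤p p≤q)

  ^-mono-< : ∀ n → 0ℚ ≤ p → p < q → p ^ suc n < q ^ suc n
  ^-mono-< {p} {q} zero    0≤p p<q = *-monoʳ-< 0<1 p<q
  ^-mono-< {p} {q} (suc n) 0≤p p<q = ≤-<-trans
    (*-monoˡ 0≤p (<⇒≤ rec)) (*-monoʳ-< (≤-<-trans (^-≥0 (suc n) 0≤p) rec) p<q)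
    where rec = ^-mono-< n 0≤p p<q

  1^ : ∀ n → 1ℚ ^ n ≡ 1ℚ
  1^ zero    = refl
  1^ (suc n) = trans (*-identityˡ (1ℚ ^ n)) (1^ n)

  ^-≤1 : ∀ n → 0ℚ ≤ p → p ≤ 1ℚ → p ^ n ≤ 1ℚ
  ^-≤1 {p} n 0≤p p≤1 = subst (p ^ n ≤_) (1^ n) (^-mono-≤ n 0≤p p≤1)

  ^-suc-≤ : ∀ n → 0ℚ ≤ p → p ≤ 1ℚ → p ^ suc n ≤ p
  ^-suc-≤ {p} n 0≤p p≤1 =
    subst (p ^ suc n ≤_) (*-identityʳ p) (*-monoˡ 0≤p (^-≤1 n 0≤p p≤1))

  ^-suc-≥ : ∀ n → 1ℚ ≤ p → p ≤ p ^ suc n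
  ^-suc-≥ {p} n 1≤p = subst (_≤ p ^ suc n) (*-identityʳ p)
    (*-monoˡ (≤-trans 0≤1 1≤p) (subst (_≤ p ^ n) (1^ n) (^-mono-≤ n 0≤1 1≤p)))

  bernoulli : ∀ n w → 0ℚ ≤ 1ℚ + w → 1ℚ + fromℕℚ n * w ≤ (1ℚ + w) ^ n
  bernoulli zero    w _ = ≤-reflexive (solve 1 (λ w → con 1ℚ :+ con 0ℚ :* w := con 1ℚ) refl w)
  bernoulli (suc n) w 0≤1+w = ≤-trans
    (≤-by (fromℕℚ n * (w * w)) (0≤* (0≤fromℕℚ n) (square-≥0 w)) eq)
    (*-monoˡ 0≤1+w (bernoulli n w 0≤1+w))
    where
    eq : (1ℚ + w) * (1ℚ + fromℕℚ n * w) ≡ 1ℚ + fromℕℚ (suc n) * w + fromℕℚ n * (w * w)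
    eq = trans
      (solve 2 (λ n w → (con 1ℚ :+ w) :* (con 1ℚ :+ n :* w) :=
                 con 1ℚ :+ (con 1ℚ :+ n) :* w :+ n :* (w :* w)) refl (fromℕℚ n) w)
      (cong (λ m → 1ℚ + m * w + fromℕℚ n * (w * w)) (sym (fromℕℚ-suc n)))

  between-lower : ∀ {s t} → a ≤ s → s ≤ b → c ≤ t → t ≤ d →
    q ≤ a * c → q ≤ a * d → q ≤ b * c → q ≤ b * d → q ≤ s * t
  between-lower {a} {b} {c} {d} {q} {s} {t} as sb ct td ac ad bc bd with ≤-total 0ℚ t
  ... | inj₁ 0≤t = ≤-trans q≤at (*-monoʳ 0≤t as)
    where
    q≤at : q ≤ a * t
    q≤at with ≤-total 0ℚ a
    ... | inj₁ 0≤a = ≤-trans ac (*-monoˡ 0≤a ct)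
    ... | inj₂ a≤0 = ≤-trans ad (*-antiˡ a≤0 td)
  ... | inj₂ t≤0 = ≤-trans q≤bt (*-antiʳ t≤0 sb)
    where
    q≤bt : q ≤ b * t
    q≤bt with ≤-total 0ℚ b
    ... | inj₁ 0≤b = ≤-trans bc (*-monoˡ 0≤b ct)
    ... | inj₂ b≤0 = ≤-trans bd (*-antiˡ b≤0 td)

  between-upper : ∀ {s t} → a ≤ s → s ≤ b → c ≤ t → t ≤ d →
    a * c ≤ q → a * d ≤ q → b * c ≤ q → b * d ≤ q → s * t ≤ q
  between-upper {a} {b} {c} {d} {q} {s} {t} as sb ct td ac ad bc bd with ≤-total 0ℚ t
  ... | inj₁ 0≤t = ≤-trans (*-monoʳ 0≤t sb) bt≤q
    where
    bt≤q : b * t ≤ q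
    bt≤q with ≤-total 0ℚ b
    ... | inj₁ 0≤b = ≤-trans (*-monoˡ 0≤b td) bd
    ... | inj₂ b≤0 = ≤-trans (*-antiˡ b≤0 ct) bc
  ... | inj₂ t≤0 = ≤-trans (*-antiʳ t≤0 as) at≤q
    where
    at≤q : a * t ≤ q
    at≤q with ≤-total 0ℚ a
    ... | inj₁ 0≤a = ≤-trans (*-monoˡ 0≤a td) ad
    ... | inj₂ a≤0 = ≤-trans (*-antiˡ a≤0 ct) ac

open ℚ-Lemmas hiding (a; b; c; d)

record ℝ : Set₁ where
  field
    L U         : ℚ → Set
    L-inhabited : ∃[ q ] L q
    U-inhabited : ∃[ q ] U q
    L-closed    : ∀ {p q} → p < q → L q → L p
    L-open      : ∀ {p} → L p → ∃[ q ] p < q × L q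
    U-closed    : ∀ {p q} → p < q → U p → U q
    U-open      : ∀ {q} → U q → ∃[ p ] p < q × U p
    disjoint    : ∀ {q} → L q → U q → ⊥
    located     : ∀ {p q} → p < q → L p ⊎ U q

open ℝ public using (L; U)

infix 4 _≤ʳ_ _<ʳ_

_≤ʳ_ : ℝ → ℝ → Set
x ≤ʳ y = ∀ q → L x q → L y q

_<ʳ_ : ℝ → ℝ → Set
x <ʳ y = ∃[ q ] U x q × L y q

module Cut-Lemmas where

  L-closed-≤ : ∀ x → p ≤ q → L x q → L x p
  L-closed-≤ {p} {q} x p≤q Lq with q ≤? p
  ... | yes q≤p = subst (L x) (≤-antisym q≤p p≤q) Lq
  ... | no  q≰p = ℝ.L-closed x (≰⇒> q≰p) Lq

  U-closed-≤ : ∀ x → p ≤ q → U x p → U x q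
  U-closed-≤ {p} {q} x p≤q Up with q ≤? p
  ... | yes q≤p = subst (U x) (≤-antisym p≤q q≤p) Up
  ... | no  q≰p = ℝ.U-closed x (≰⇒> q≰p) Up

  L<U : ∀ x → L x p → U x q → p < q
  L<U {p} {q} x Lp Uq with q ≤? p
  ... | yes q≤p = ⊥-elim (ℝ.disjoint x (L-closed-≤ x q≤p Lp) Uq)
  ... | no  q≰p = ≰⇒> q≰p

open Cut-Lemmas

fromℚ : ℚ → ℝ
fromℚ p = record
  { L           = _< p
  ; U           = p <_
  ; L-inhabited = p - 1ℚ , p-1<p p
  ; U-inhabited = p + 1ℚ , p<p+1 p
  ; L-closed    = <-trans
  ; L-open      = λ q<p → let m , q<m , m<p = <-dense q<p in m , q<m , m<p
  ; U-closed    = λ q<r p<q → <-trans p<q q<r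
  ; U-open      = λ p<q → let m , p<m , m<q = <-dense p<q in m , m<q , p<m
  ; disjoint    = <-asym
  ; located     = loc
  }
  where
  loc : ∀ {q r} → q < r → q < p ⊎ p < r
  loc {q} {r} q<r with q <? p
  ... | yes q<p = inj₁ q<p
  ... | no  q≮p = inj₂ (≤-<-trans (≮⇒≥ q≮p) q<r)

fromℤ : ℤ → ℝ
fromℤ z = fromℚ (z / 1)

fromℕ : ℕ → ℝ
fromℕ n = fromℤ (+ n)

0ʳ 1ʳ : ℝ
0ʳ = fromℕ 0
1ʳ = fromℕ 1

-- A pair of rational predicates meant to say "q ≤ x" and "x ≤ q" on
-- sufficiently many rationals q; `fromPreCut` turns it into the cut
-- ("q < x", "x < q") of the unique real x it determines.

record PreCut : Set₁ where
  field
    L′ U′        : ℚ → Set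
    L′-inhabited : ∃[ q ] L′ q
    U′-inhabited : ∃[ q ] U′ q
    L′≤U′        : ∀ {p q} → L′ p → U′ q → p ≤ q
    located′     : ∀ {p q} → p < q → L′ p ⊎ U′ q

fromPreCut : PreCut → ℝ
fromPreCut x = record
  { L           = λ q → ∃[ r ] q < r × L′ r
  ; U           = λ q → ∃[ r ] r < q × U′ r
  ; L-inhabited = let l , L′l = L′-inhabited in l - 1ℚ , l , p-1<p l , L′l
  ; U-inhabited = let u , U′u = U′-inhabited in u + 1ℚ , u , p<p+1 u , U′u
  ; L-closed    = λ p<q (r , q<r , L′r) → r , <-trans p<q q<r , L′r
  ; L-open      = λ (r , p<r , L′r) →
                    let m , p<m , m<r = <-dense p<r in m , p<m , r , m<r , L′r
  ; U-closed    = λ p<q (r , r<p , U′r) → r , <-trans r<p p<q , U′r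
  ; U-open      = λ (r , r<q , U′r) →
                    let m , r<m , m<q = <-dense r<q in m , m<q , r , r<m , U′r
  ; disjoint    = λ (r , q<r , L′r) (s , s<q , U′s) →
                    <-irrefl refl (<-≤-trans (<-trans s<q q<r) (L′≤U′ L′r U′s))
  ; located     = loc
  }
  where
  open PreCut x
  loc : ∀ {p q} → p < q → (∃[ r ] p < r × L′ r) ⊎ (∃[ r ] r < q × U′ r)
  loc p<q with <-dense p<q
  ... | m , p<m , m<q with <-dense m<q
  ... | n , m<n , n<q with located′ m<n
  ... | inj₁ L′m = inj₁ (m , p<m , L′m)
  ... | inj₂ U′n = inj₂ (n , n<q , U′n)

module Approximation where

  open Cut-Lemmas

  abstract

    walk : ∀ x {h} → 0ℚ < h → ∀ n a → L x a → U x (a + fromℕℚ n * h) →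
      ∃[ a ] L x a × U x (a + (h + h))
    walk x {h} 0<h zero a La Ua = ⊥-elim (ℝ.disjoint x La (subst (U x) (eq a h) Ua))
      where
      eq : ∀ a h → a + 0ℚ * h ≡ a
      eq = solve 2 (λ a h → a :+ con 0ℚ :* h := a) refl
    walk x {h} 0<h (suc n) a La Ua =
      [ (λ L₁ → walk x 0<h n (a + h) L₁ (subst (U x) (step a h n) Ua))
      , (λ U₁ → a , La , U₁)
      ]′ (ℝ.located x (<-by h 0<h (double a h)))
      where
      double : ∀ a h → a + (h + h) ≡ a + h + h
      double = solve 2 (λ a h → a :+ (h :+ h) := a :+ h :+ h) refl
      regroup : ∀ a m h → a + (1ℚ + m) * h ≡ a + h + m * h
      regroup = solve 3 (λ a m h → a :+ (con 1ℚ :+ m) :* h := a :+ h :+ m :* h) refl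
      step : ∀ a h n → a + fromℕℚ (suc n) * h ≡ a + h + fromℕℚ n * h
      step a h n = trans (cong (λ m → a + m * h) (fromℕℚ-suc n)) (regroup a (fromℕℚ n) h)

    reach : ∀ {h} → 0ℚ < h → ∀ a b → ∃[ n ] b ≤ a + fromℕℚ n * h
    reach {h} 0<h a b with inv 0<h
    ... | i , 0<i , hi≡1 with archimedean ((b - a) * i)
    ... | n , lt = suc n , subst (_≤ a + fromℕℚ (suc n) * h) eq
                     (+-monoʳ-≤ a (*-monoʳ (<⇒≤ 0<h) (<⇒≤ lt)))
      where
      eq₁ : ∀ a b i h → a + (b - a) * i * h ≡ a + (b - a) * (h * i)
      eq₁ = solve 4 (λ a b i h → a :+ (b :- a) :* i :* h := a :+ (b :- a) :* (h :* i)) refl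
      eq₂ : ∀ a b → a + (b - a) * 1ℚ ≡ b
      eq₂ = solve 2 (λ a b → a :+ (b :- a) :* con 1ℚ := b) refl
      eq : a + (b - a) * i * h ≡ b
      eq = trans (eq₁ a b i h) (trans (cong (λ t → a + (b - a) * t) hi≡1) (eq₂ a b))

    approx : ∀ x {ε} → 0ℚ < ε → ∃[ a ] L x a × U x (a + ε)
    approx x {ε} 0<ε =
      let a , La = ℝ.L-inhabited x
          b , Ub = ℝ.U-inhabited x
          0<h = 0<* 0<ε (positive⁻¹ ½)
          n , b≤ = reach 0<h a b
          c , Lc , Uc = walk x 0<h n a La (U-closed-≤ x b≤ Ub)
      in c , Lc , subst (λ t → U x (c + t)) (halves ε) Uc
      where
      halves : ∀ e → e * ½ + e * ½ ≡ e
      halves = solve 1 (λ e → e :* con ½ :+ e :* con ½ := e) refl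

    bounded : ∀ x → ∃[ B ] 0ℚ ≤ B ×
      (∀ {a ε} → ε ≤ 1ℚ → L x a → U x (a + ε) → 0ℚ ≤ a + B × 0ℚ ≤ B - a)
    bounded x with ℝ.L-inhabited x | ℝ.U-inhabited x
    ... | a₀ , La₀ | b₀ , Ub₀ =
      ∣ a₀ ∣ + ∣ b₀ ∣ + 1ℚ , 0≤+ (0≤+ (0≤∣p∣ a₀) (0≤∣p∣ b₀)) 0≤1 , λ {a} {ε} ε≤1 La Ua →
          subst (0ℚ ≤_) (eq₁ a ε a₀ ∣ a₀ ∣ ∣ b₀ ∣)
            (0≤+ (0≤+ (0≤+ (diff-≤ (<⇒≤ (L<U x La₀ Ua))) (diff-≤ ε≤1)) (diff-≤ (∣-∣-lower a₀))) (0≤∣p∣ b₀))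
        , subst (0ℚ ≤_) (eq₂ a b₀ ∣ a₀ ∣ ∣ b₀ ∣)
            (0≤+ (0≤+ (diff-≤ (<⇒≤ (L<U x La Ub₀))) (diff-≤ (∣-∣-upper b₀))) (0≤+ (0≤∣p∣ a₀) 0≤1))
      where
      eq₁ : ∀ a e a₀ A B → (a + e - a₀) + (1ℚ - e) + (a₀ - - A) + B ≡ a + (A + B + 1ℚ)
      eq₁ = solve 5 (λ a e a₀ A B → (a :+ e :- a₀) :+ (con 1ℚ :- e) :+ (a₀ :- (:- A)) :+ B
                       := a :+ (A :+ B :+ con 1ℚ)) refl
      eq₂ : ∀ a b₀ A B → (b₀ - a) + (B - b₀) + (A + 1ℚ) ≡ (A + B + 1ℚ) - a
      eq₂ = solve 4 (λ a b₀ A B → (b₀ :- a) :+ (B :- b₀) :+ (A :+ con 1ℚ)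
                       := (A :+ B :+ con 1ℚ) :- a) refl

open Approximation

record Box (x y : ℝ) : Set where
  constructor box
  field
    {a b c d} : ℚ
    La : L x a
    Ub : U x b
    Lc : L y c
    Ud : U y d

infix 4 _≤-corners_ _≥-corners_

_≤-corners_ _≥-corners_ : ∀ {x y} → ℚ → Box x y → Set
q ≤-corners box {a} {b} {c} {d} _ _ _ _ = (q ≤ a * c × q ≤ a * d) × (q ≤ b * c × q ≤ b * d)
q ≥-corners box {a} {b} {c} {d} _ _ _ _ = (a * c ≤ q × a * d ≤ q) × (b * c ≤ q × b * d ≤ q)

module Corner-Lemmas where

  -- |a| ≤ A, |c| ≤ C, 0 ≤ η ≤ 1 and (A + C + 1) η ≤ δ imply that the products
  -- of {a , a + η} and {c , c + η} all lie within δ of a c.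
  module _ {a c A C η δ : ℚ} (0≤A : 0ℚ ≤ A) (0≤C : 0ℚ ≤ C) (0≤η : 0ℚ ≤ η)
    (a+A : 0ℚ ≤ a + A) (A-a : 0ℚ ≤ A - a) (c+C : 0ℚ ≤ c + C) (C-c : 0ℚ ≤ C - c)
    (1-η : 0ℚ ≤ 1ℚ - η) (0≤δ : 0ℚ ≤ δ) (slack : 0ℚ ≤ δ - (A + C + 1ℚ) * η)
    where

    ac-lower : a * c - δ ≤ a * c
    ac-lower = ≤-by δ 0≤δ (eq a c δ)
      where
      eq : ∀ a c e → a * c ≡ a * c - e + e
      eq = solve 3 (λ a c e → a :* c := a :* c :- e :+ e) refl

    ad-lower : a * c - δ ≤ a * (c + η)
    ad-lower = ≤-by ((a + A) * η + (δ - (A + C + 1ℚ) * η) + (C + 1ℚ) * η)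
      (0≤+ (0≤+ (0≤* a+A 0≤η) slack) (0≤* (0≤+ 0≤C 0≤1) 0≤η)) (eq a c A C η δ)
      where
      eq : ∀ a c A C h e → a * (c + h) ≡
        a * c - e + ((a + A) * h + (e - (A + C + 1ℚ) * h) + (C + 1ℚ) * h)
      eq = solve 6 (λ a c A C h e → a :* (c :+ h) := a :* c :- e :+
        ((a :+ A) :* h :+ (e :- (A :+ C :+ con 1ℚ) :* h) :+ (C :+ con 1ℚ) :* h)) refl

    bc-lower : a * c - δ ≤ (a + η) * c
    bc-lower = ≤-by ((c + C) * η + (δ - (A + C + 1ℚ) * η) + (A + 1ℚ) * η)
      (0≤+ (0≤+ (0≤* c+C 0≤η) slack) (0≤* (0≤+ 0≤A 0≤1) 0≤η)) (eq a c A C η δ)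
      where
      eq : ∀ a c A C h e → (a + h) * c ≡
        a * c - e + ((c + C) * h + (e - (A + C + 1ℚ) * h) + (A + 1ℚ) * h)
      eq = solve 6 (λ a c A C h e → (a :+ h) :* c := a :* c :- e :+
        ((c :+ C) :* h :+ (e :- (A :+ C :+ con 1ℚ) :* h) :+ (A :+ con 1ℚ) :* h)) refl

    bd-lower : a * c - δ ≤ (a + η) * (c + η)
    bd-lower = ≤-by ((a + A) * η + (c + C) * η + η * η + (δ - (A + C + 1ℚ) * η) + η)
      (0≤+ (0≤+ (0≤+ (0≤+ (0≤* a+A 0≤η) (0≤* c+C 0≤η)) (square-≥0 η)) slack) 0≤η)
      (eq a c A C η δ)
      where
      eq : ∀ a c A C h e → (a + h) * (c + h) ≡
        a * c - e + ((a + A) * h + (c + C) * h + h * h + (e - (A + C + 1ℚ) * h) + h)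
      eq = solve 6 (λ a c A C h e → (a :+ h) :* (c :+ h) := a :* c :- e :+
        ((a :+ A) :* h :+ (c :+ C) :* h :+ h :* h :+ (e :- (A :+ C :+ con 1ℚ) :* h) :+ h)) refl

    ac-upper : a * c ≤ a * c + δ
    ac-upper = ≤-by δ 0≤δ refl

    ad-upper : a * (c + η) ≤ a * c + δ
    ad-upper = ≤-by ((A - a) * η + (δ - (A + C + 1ℚ) * η) + (C + 1ℚ) * η)
      (0≤+ (0≤+ (0≤* A-a 0≤η) slack) (0≤* (0≤+ 0≤C 0≤1) 0≤η)) (eq a c A C η δ)
      where
      eq : ∀ a c A C h e → a * c + e ≡
        a * (c + h) + ((A - a) * h + (e - (A + C + 1ℚ) * h) + (C + 1ℚ) * h)
      eq = solve 6 (λ a c A C h e → a :* c :+ e := a :* (c :+ h) :+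
        ((A :- a) :* h :+ (e :- (A :+ C :+ con 1ℚ) :* h) :+ (C :+ con 1ℚ) :* h)) refl

    bc-upper : (a + η) * c ≤ a * c + δ
    bc-upper = ≤-by ((C - c) * η + (δ - (A + C + 1ℚ) * η) + (A + 1ℚ) * η)
      (0≤+ (0≤+ (0≤* C-c 0≤η) slack) (0≤* (0≤+ 0≤A 0≤1) 0≤η)) (eq a c A C η δ)
      where
      eq : ∀ a c A C h e → a * c + e ≡
        (a + h) * c + ((C - c) * h + (e - (A + C + 1ℚ) * h) + (A + 1ℚ) * h)
      eq = solve 6 (λ a c A C h e → a :* c :+ e := (a :+ h) :* c :+
        ((C :- c) :* h :+ (e :- (A :+ C :+ con 1ℚ) :* h) :+ (A :+ con 1ℚ) :* h)) refl

    bd-upper : (a + η) * (c + η) ≤ a * c + δ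
    bd-upper = ≤-by ((A - a) * η + (C - c) * η + η * (1ℚ - η) + (δ - (A + C + 1ℚ) * η))
      (0≤+ (0≤+ (0≤+ (0≤* A-a 0≤η) (0≤* C-c 0≤η)) (0≤* 0≤η 1-η)) slack)
      (eq a c A C η δ)
      where
      eq : ∀ a c A C h e → a * c + e ≡
        (a + h) * (c + h) + ((A - a) * h + (C - c) * h + h * (1ℚ - h) + (e - (A + C + 1ℚ) * h))
      eq = solve 6 (λ a c A C h e → a :* c :+ e := (a :+ h) :* (c :+ h) :+
        ((A :- a) :* h :+ (C :- c) :* h :+ h :* (con 1ℚ :- h) :+ (e :- (A :+ C :+ con 1ℚ) :* h))) refl

  abstract

    mesh : ∀ {E δ} → 0ℚ ≤ E → 0ℚ < δ → ∃[ η ] 0ℚ < η × 0ℚ ≤ 1ℚ - η × 0ℚ ≤ δ - E * η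
    mesh {E} {δ} 0≤E 0<δ =
      let i , 0<i , δi≡1 = inv 0<δ
          0≤Ei = 0≤* 0≤E (<⇒≤ 0<i)
          η , 0<η , eη≡1 = inv (0<+≤ 0<1 0≤Ei)
          0≤η = <⇒≤ 0<η
      in η , 0<η
       , subst (0ℚ ≤_) (eq₁ (E * i) η eη≡1) (0≤* 0≤Ei 0≤η)
       , subst (0ℚ ≤_) (eq₂ E δ i η δi≡1 eη≡1) (0≤* (<⇒≤ 0<δ) 0≤η)
      where
      eq₁ : ∀ k h → (1ℚ + k) * h ≡ 1ℚ → k * h ≡ 1ℚ - h
      eq₁ k h e = trans (regroup k h) (cong (_- h) e)
        where
        regroup : ∀ k h → k * h ≡ (1ℚ + k) * h - h
        regroup = solve 2 (λ k h → k :* h := (con 1ℚ :+ k) :* h :- h) refl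
      eq₂ : ∀ E δ i h → δ * i ≡ 1ℚ → (1ℚ + E * i) * h ≡ 1ℚ → δ * h ≡ δ - E * h
      eq₂ E δ i h e₁ e₂ = trans (r₁ δ E i h)
        (trans (cong (λ t → δ * t - E * h * (δ * i)) e₂)
        (trans (cong (λ t → δ * 1ℚ - E * h * t) e₁) (r₂ δ E h)))
        where
        r₁ : ∀ e E i h → e * h ≡ e * ((1ℚ + E * i) * h) - E * h * (e * i)
        r₁ = solve 4 (λ e E i h → e :* h := e :* ((con 1ℚ :+ E :* i) :* h) :- E :* h :* (e :* i)) refl
        r₂ : ∀ e E h → e * 1ℚ - E * h * 1ℚ ≡ e - E * h
        r₂ = solve 3 (λ e E h → e :* con 1ℚ :- E :* h :* con 1ℚ := e :- E :* h) refl

  half-gap : ∀ {p q m} → m - (q - p) * ½ < p → m + (q - p) * ½ ≤ q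
  half-gap {p} {q} {m} lt = ≤-by (p - (m - (q - p) * ½)) (diff-≤ (<⇒≤ lt)) (eq p q m)
    where
    eq : ∀ p q m → q ≡ m + (q - p) * ½ + (p - (m - (q - p) * ½))
    eq = solve 3 (λ p q m → q := m :+ (q :- p) :* con ½ :+ (p :- (m :- (q :- p) :* con ½))) refl

module Multiplication (x y : ℝ) where

  open Corner-Lemmas

  abstract

    small-box : ∀ {δ} → 0ℚ < δ →
      Σ[ B ∈ Box x y ] ∃[ m ] (m - δ ≤-corners B) × (m + δ ≥-corners B)
    small-box {δ} 0<δ =
      let A , 0≤A , x-bounds = bounded x
          C , 0≤C , y-bounds = bounded y
          η , 0<η , 1-η , slack = mesh (0≤+ (0≤+ 0≤A 0≤C) 0≤1) 0<δ
          η≤1 = ≤-by (1ℚ - η) 1-η (eq η)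
          0≤η = <⇒≤ 0<η
          0≤δ = <⇒≤ 0<δ
          a , La , Ua = approx x 0<η
          c , Lc , Uc = approx y 0<η
          a+A , A-a = x-bounds η≤1 La Ua
          c+C , C-c = y-bounds η≤1 Lc Uc
      in box La Ua Lc Uc , a * c
       , ( ( ac-lower 0≤A 0≤C 0≤η a+A A-a c+C C-c 1-η 0≤δ slack
           , ad-lower 0≤A 0≤C 0≤η a+A A-a c+C C-c 1-η 0≤δ slack )
         , ( bc-lower 0≤A 0≤C 0≤η a+A A-a c+C C-c 1-η 0≤δ slack
           , bd-lower 0≤A 0≤C 0≤η a+A A-a c+C C-c 1-η 0≤δ slack ) )
       , ( ( ac-upper 0≤A 0≤C 0≤η a+A A-a c+C C-c 1-η 0≤δ slack
           , ad-upper 0≤A 0≤C 0≤η a+A A-a c+C C-c 1-η 0≤δ slack )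
         , ( bc-upper 0≤A 0≤C 0≤η a+A A-a c+C C-c 1-η 0≤δ slack
           , bd-upper 0≤A 0≤C 0≤η a+A A-a c+C C-c 1-η 0≤δ slack ) )
      where
      eq : ∀ h → 1ℚ ≡ h + (1ℚ - h)
      eq = solve 1 (λ h → con 1ℚ := h :+ (con 1ℚ :- h)) refl

    lower-trans : ∀ {p q} (B : Box x y) → p ≤ q → q ≤-corners B → p ≤-corners B
    lower-trans {p} {q} (box {a} {b} {c} {d} _ _ _ _) p≤q ((ac , ad) , (bc , bd)) =
      (≤-trans {p} {q} {a * c} p≤q ac , ≤-trans {p} {q} {a * d} p≤q ad) ,
      (≤-trans {p} {q} {b * c} p≤q bc , ≤-trans {p} {q} {b * d} p≤q bd)

    upper-trans : ∀ {p q} (B : Box x y) → p ≤ q → p ≥-corners B → q ≥-corners B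
    upper-trans {p} {q} (box {a} {b} {c} {d} _ _ _ _) p≤q ((ac , ad) , (bc , bd)) =
      (≤-trans {a * c} {p} {q} ac p≤q , ≤-trans {a * d} {p} {q} ad p≤q) ,
      (≤-trans {b * c} {p} {q} bc p≤q , ≤-trans {b * d} {p} {q} bd p≤q)

    common : ∀ {z a a′} → L z a → L z a′ → ∃[ s ] L z s × a ≤ s × a′ ≤ s
    common {z} {a} {a′} La La′ with ≤-total a a′
    ... | inj₁ a≤a′ = a′ , La′ , a≤a′ , ≤-refl
    ... | inj₂ a′≤a = a , La , ≤-refl , a′≤a

  Lower Upper : ℚ → Set
  Lower q = Σ[ B ∈ Box x y ] q ≤-corners B
  Upper q = Σ[ B ∈ Box x y ] q ≥-corners B

  preproduct : PreCut
  preproduct = record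
    { L′           = Lower
    ; U′           = Upper
    ; L′-inhabited = let B , m , lo , hi = small-box 0<1 in m - 1ℚ , B , lo
    ; U′-inhabited = let B , m , lo , hi = small-box 0<1 in m + 1ℚ , B , hi
    ; L′≤U′        = L≤U
    ; located′     = loc
    }
    where
    abstract

      L≤U : ∀ {p q} → Lower p → Upper q → p ≤ q
      L≤U {p} {q} (box {a} {b} {c} {d} La Ub Lc Ud , (ac , ad) , (bc , bd))
          (box {a′} {b′} {c′} {d′} La′ Ub′ Lc′ Ud′ , (ac′ , ad′) , (bc′ , bd′)) =
        let s , Ls , a≤s , a′≤s = common {x} La La′
            t , Lt , c≤t , c′≤t = common {y} Lc Lc′
        in ≤-trans {p} {s * t} {q}
             (between-lower {a} {b} {c} {d} {p} {s} {t} a≤s (<⇒≤ (L<U x Ls Ub)) c≤t (<⇒≤ (L<U y Lt Ud)) ac ad bc bd)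
             (between-upper {a′} {b′} {c′} {d′} {q} {s} {t} a′≤s (<⇒≤ (L<U x Ls Ub′)) c′≤t (<⇒≤ (L<U y Lt Ud′)) ac′ ad′ bc′ bd′)

      loc : ∀ {p q} → p < q →
        Lower p ⊎ Upper q
      loc {p} {q} p<q = decide (small-box {(q - p) * ½} (0<* (diff-< p<q) (positive⁻¹ ½)))
        where
        decide : (Σ[ B ∈ Box x y ] ∃[ m ] (m - (q - p) * ½ ≤-corners B) × (m + (q - p) * ½ ≥-corners B)) →
          Lower p ⊎ Upper q
        decide (B , m , lo , hi) = [ below , above ]′ (≤-or-> p (m - (q - p) * ½))
          where
          below : p ≤ m - (q - p) * ½ → Lower p ⊎ Upper q
          below p≤ = inj₁ (B , lower-trans B p≤ lo)
          above : m - (q - p) * ½ < p → Lower p ⊎ Upper q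
          above lt = inj₂ (B , upper-trans B (half-gap {p} {q} {m} lt) hi)

infixl 7 _*ʳ_ _⊓ʳ_

_*ʳ_ : ℝ → ℝ → ℝ
x *ʳ y = fromPreCut (Multiplication.preproduct x y)

_⊓ʳ_ : ℝ → ℝ → ℝ
x ⊓ʳ y = record
  { L           = λ q → L x q × L y q
  ; U           = λ q → U x q ⊎ U y q
  ; L-inhabited = inhabited
  ; U-inhabited = let b , Ub = ℝ.U-inhabited x in b , inj₁ Ub
  ; L-closed    = λ p<q (Lx , Ly) → ℝ.L-closed x p<q Lx , ℝ.L-closed y p<q Ly
  ; L-open      = opened
  ; U-closed    = λ where
      p<q (inj₁ Ux) → inj₁ (ℝ.U-closed x p<q Ux)
      p<q (inj₂ Uy) → inj₂ (ℝ.U-closed y p<q Uy)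
  ; U-open      = λ where
      (inj₁ Ux) → let p , p<q , Up = ℝ.U-open x Ux in p , p<q , inj₁ Up
      (inj₂ Uy) → let p , p<q , Up = ℝ.U-open y Uy in p , p<q , inj₂ Up
  ; disjoint    = λ where
      (Lx , Ly) (inj₁ Ux) → ℝ.disjoint x Lx Ux
      (Lx , Ly) (inj₂ Uy) → ℝ.disjoint y Ly Uy
  ; located     = loc
  }
  where
  inhabited : ∃[ q ] L x q × L y q
  inhabited with ℝ.L-inhabited x | ℝ.L-inhabited y
  ... | a , La | c , Lc with ≤-total a c
  ... | inj₁ a≤c = a , La , L-closed-≤ y a≤c Lc
  ... | inj₂ c≤a = c , L-closed-≤ x c≤a La , Lc

  opened : ∀ {p} → L x p × L y p → ∃[ q ] p < q × L x q × L y q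
  opened (Lx , Ly) with ℝ.L-open x Lx | ℝ.L-open y Ly
  ... | a , p<a , La | c , p<c , Lc with ≤-total a c
  ... | inj₁ a≤c = a , p<a , La , L-closed-≤ y a≤c Lc
  ... | inj₂ c≤a = c , p<c , L-closed-≤ x c≤a La , Lc

  loc : ∀ {p q} → p < q → (L x p × L y p) ⊎ (U x q ⊎ U y q)
  loc p<q with ℝ.located x p<q | ℝ.located y p<q
  ... | inj₁ Lx | inj₁ Ly = inj₁ (Lx , Ly)
  ... | inj₂ Ux | _       = inj₂ (inj₁ Ux)
  ... | _       | inj₂ Uy = inj₂ (inj₂ Uy)

record ℝ⁺ : Set₁ where
  constructor _,⁺_
  infix 9 ↑_
  field
    ↑_  : ℝ
    0<↑ : L ↑_ 0ℚ

open ℝ⁺ public using (↑_)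

module Positive-Lemmas (x : ℝ⁺) where

  0<U : U (↑ x) q → 0ℚ < q
  0<U = L<U (↑ x) (ℝ⁺.0<↑ x)

  positive-L : ∃[ a ] 0ℚ < a × L (↑ x) a
  positive-L = ℝ.L-open (↑ x) (ℝ⁺.0<↑ x)

infixl 7 _*⁺_ _/⁺_ _⊓⁺_
infixr 8 _^ℕ_ _^ℤ_
infix 9 _⁻¹

_*⁺_ : ℝ⁺ → ℝ⁺ → ℝ⁺
x *⁺ y = (↑ x *ʳ ↑ y) ,⁺ positive-product
  where
  corners : ∀ {a b c d} (La : L (↑ x) a) (Ub : U (↑ x) b) (Lc : L (↑ y) c) (Ud : U (↑ y) d) →
    0ℚ < a → 0ℚ < c → a < b → c < d →
    _≤-corners_ {↑ x} {↑ y} (a * c) (box {a = a} {b} {c} {d} La Ub Lc Ud)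
  corners {a} {b} {c} {d} _ _ _ _ 0<a 0<c a<b c<d =
    (≤-refl {a * c} , *-monoˡ {a} {c} {d} (<⇒≤ 0<a) (<⇒≤ c<d)) ,
    (*-monoʳ {c} {a} {b} (<⇒≤ 0<c) (<⇒≤ a<b) ,
     *-mono {a} {d} {b} {c} (<⇒≤ 0<a) (<⇒≤ (<-trans 0<c c<d)) (<⇒≤ a<b) (<⇒≤ c<d))

  abstract
    positive-product : L (↑ x *ʳ ↑ y) 0ℚ
    positive-product =
      let a , 0<a , La = Positive-Lemmas.positive-L x
          c , 0<c , Lc = Positive-Lemmas.positive-L y
          b , Ub = ℝ.U-inhabited (↑ x)
          d , Ud = ℝ.U-inhabited (↑ y)
      in a * c , 0<* {a} {c} 0<a 0<c , box {a = a} {b} {c} {d} La Ub Lc Ud ,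
         corners {a} {b} {c} {d} La Ub Lc Ud 0<a 0<c (L<U (↑ x) La Ub) (L<U (↑ y) Lc Ud)

_⊓⁺_ : ℝ⁺ → ℝ⁺ → ℝ⁺
x ⊓⁺ y = (↑ x ⊓ʳ ↑ y) ,⁺ (ℝ⁺.0<↑ x , ℝ⁺.0<↑ y)

fromℕ⁺ : (n : ℕ) .{{_ : ℕ.NonZero n}} → ℝ⁺
fromℕ⁺ n = fromℕ n ,⁺ 0<fromℕℚ n

1⁺ : ℝ⁺
1⁺ = fromℕ⁺ 1

module Inverse-Lemmas where abstract

  inverse-≤ : ∀ {p q l u} → 0ℚ < l → l < u → p * u ≤ 1ℚ → 1ℚ ≤ q * l → p ≤ q
  inverse-≤ {p} {q} {l} {u} 0<l l<u pu≤1 1≤ql = [ (λ p≤q → p≤q) , absurd ]′ (≤-or-> p q)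
    where
    0<q : 0ℚ < q
    0<q = [ (λ q≤0 → ⊥-elim (<-irrefl {1ℚ} refl (≤-<-trans {1ℚ} {0ℚ} {1ℚ}
              (≤-trans {1ℚ} {q * l} {0ℚ} 1≤ql (subst (q * l ≤_) (*-zeroˡ l)
                (*-monoʳ {l} {q} {0ℚ} (<⇒≤ 0<l) q≤0))) 0<1)))
          , (λ lt → lt) ]′ (≤-or-> q 0ℚ)
    absurd : q < p → p ≤ q
    absurd q<p = ⊥-elim (<-irrefl {1ℚ} refl (≤-<-trans {1ℚ} {q * l} {1ℚ} 1≤ql
      (<-≤-trans {q * l} {p * l} {1ℚ} (*-monoʳ-< {l} {q} {p} 0<l q<p)
        (≤-trans {p * l} {p * u} {1ℚ}
          (*-monoˡ {p} {l} {u} (<⇒≤ (<-trans 0<q q<p)) (<⇒≤ l<u)) pu≤1))))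

  inverse-< : ∀ {p q} → 0ℚ < p → p < q →
    ∃[ i ] ∃[ j ] 0ℚ < j × j < i × p * i ≡ 1ℚ × q * j ≡ 1ℚ
  inverse-< {p} {q} 0<p p<q =
    let i , 0<i , pi≡1 = inv 0<p
        j , 0<j , qj≡1 = inv (<-trans 0<p p<q)
    in i , j , 0<j
     , subst₂ _<_ (eq p i j pi≡1) (trans (regroup q i j) (eq q j i qj≡1))
         (*-monoʳ-< {j} {p * i} {q * i} 0<j (*-monoʳ-< {i} {p} {q} 0<i p<q))
     , pi≡1 , qj≡1
    where
    eq : ∀ p i j → p * i ≡ 1ℚ → p * i * j ≡ j
    eq p i j e = trans (cong (_* j) e) (*-identityˡ j)
    regroup : ∀ q i j → q * i * j ≡ q * j * i
    regroup = solve 3 (λ q i j → q :* i :* j := q :* j :* i) refl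

  nonPositive-≤1 : ∀ {p u} → p ≤ 0ℚ → 0ℚ < u → p * u ≤ 1ℚ
  nonPositive-≤1 {p} {u} p≤0 0<u = ≤-trans {p * u} {0ℚ} {1ℚ}
    (subst (p * u ≤_) (*-zeroˡ u) (*-monoʳ {u} {p} {0ℚ} (<⇒≤ 0<u) p≤0)) 0≤1

  left-inv : ∀ {p} → 0ℚ < p → ∃[ i ] 0ℚ < i × i * p ≡ 1ℚ
  left-inv {p} 0<p = let i , 0<i , pi≡1 = inv 0<p in i , 0<i , trans (*-comm i p) pi≡1

_⁻¹ : ℝ⁺ → ℝ⁺
x ⁻¹ = fromPreCut precut ,⁺ positive-inverse
  where
  open Positive-Lemmas x
  open Inverse-Lemmas

  L′ U′ : ℚ → Set
  L′ q = ∃[ u ] U (↑ x) u × q * u ≤ 1ℚ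
  U′ q = ∃[ l ] 0ℚ < l × L (↑ x) l × 1ℚ ≤ q * l

  abstract

    L′-inhabited : ∃[ q ] 0ℚ < q × L′ q
    L′-inhabited =
      let u , Uu = ℝ.U-inhabited (↑ x)
          i , 0<i , iu≡1 = left-inv (0<U Uu)
      in i , 0<i , u , Uu , ≤-reflexive iu≡1

    U′-inhabited : ∃[ q ] U′ q
    U′-inhabited =
      let l , 0<l , Ll = positive-L
          i , _ , il≡1 = left-inv 0<l
      in i , l , 0<l , Ll , ≤-reflexive (sym il≡1)

    loc : ∀ {p q} → p < q → L′ p ⊎ U′ q
    loc {p} {q} p<q = [ nonpositive , positive-case ]′ (≤-or-> p 0ℚ)
      where
      nonpositive : p ≤ 0ℚ → L′ p ⊎ U′ q
      nonpositive p≤0 = let u , Uu = ℝ.U-inhabited (↑ x) in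
        inj₁ (u , Uu , nonPositive-≤1 p≤0 (0<U Uu))
      positive-case : 0ℚ < p → L′ p ⊎ U′ q
      positive-case 0<p =
        let i , j , 0<j , j<i , pi≡1 , qj≡1 = inverse-< 0<p p<q in
        [ (λ Lj → inj₂ (j , 0<j , Lj , ≤-reflexive (sym qj≡1)))
        , (λ Ui → inj₁ (i , Ui , ≤-reflexive pi≡1))
        ]′ (ℝ.located (↑ x) j<i)

  precut : PreCut
  precut = record
    { L′           = L′
    ; U′           = U′
    ; L′-inhabited = let i , _ , L′i = L′-inhabited in i , L′i
    ; U′-inhabited = U′-inhabited
    ; L′≤U′        = λ (u , Uu , pu≤1) (l , 0<l , Ll , 1≤ql) →
                       inverse-≤ 0<l (L<U (↑ x) Ll Uu) pu≤1 1≤ql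
    ; located′     = loc
    }

  positive-inverse : L (fromPreCut precut) 0ℚ
  positive-inverse = L′-inhabited

_/⁺_ : ℝ⁺ → ℝ⁺ → ℝ⁺
x /⁺ y = x *⁺ y ⁻¹

_^ℕ_ : ℝ⁺ → ℕ → ℝ⁺
x ^ℕ zero  = 1⁺
x ^ℕ suc n = x *⁺ x ^ℕ n

_^ℤ_ : ℝ⁺ → ℤ → ℝ⁺
x ^ℤ (+ n)    = x ^ℕ n
x ^ℤ -[1+ n ] = (x ^ℕ suc n) ⁻¹

root : (n : ℕ) .{{_ : ℕ.NonZero n}} → ℝ⁺ → ℝ⁺
root (suc n) x = fromPreCut precut ,⁺ positive-root
  where
  open Positive-Lemmas x

  L′ U′ : ℚ → Set
  L′ q = q < 0ℚ ⊎ (0ℚ ≤ q × L (↑ x) (q ^ suc n))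
  U′ q = 0ℚ ≤ q × U (↑ x) (q ^ suc n)

  L≤U : ∀ {p q} → L′ p → U′ q → p ≤ q
  L≤U (inj₁ p<0) (0≤q , _) = ≤-trans (<⇒≤ p<0) 0≤q
  L≤U {p} {q} (inj₂ (0≤p , Lp)) (0≤q , Uq) with p ≤? q
  ... | yes p≤q = p≤q
  ... | no  p≰q = ⊥-elim (<-asym (L<U (↑ x) Lp Uq) (^-mono-< n 0≤q (≰⇒> p≰q)))

  loc : ∀ {p q} → p < q → L′ p ⊎ U′ q
  loc {p} p<q with p <? 0ℚ
  ... | yes p<0 = inj₁ (inj₁ p<0)
  ... | no  p≮0 with ℝ.located (↑ x) (^-mono-< n (≮⇒≥ p≮0) p<q)
  ... | inj₁ Lp = inj₁ (inj₂ (≮⇒≥ p≮0 , Lp))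
  ... | inj₂ Uq = inj₂ (≤-trans (≮⇒≥ p≮0) (<⇒≤ p<q) , Uq)

  precut : PreCut
  precut = record
    { L′           = L′
    ; U′           = U′
    ; L′-inhabited = - 1ℚ , inj₁ (negative⁻¹ (- 1ℚ))
    ; U′-inhabited =
        let b , Ub = ℝ.U-inhabited (↑ x)
            0≤b = <⇒≤ (0<U Ub)
            1≤1+b = ≤-by b 0≤b refl
            b≤1+b = ≤-by 1ℚ 0≤1 (+-comm 1ℚ b)
        in 1ℚ + b , ≤-trans 0≤1 1≤1+b ,
           U-closed-≤ (↑ x) (≤-trans b≤1+b (^-suc-≥ n 1≤1+b)) Ub
    ; L′≤U′        = L≤U
    ; located′     = loc
    }

  positive-root : L (fromPreCut precut) 0ℚ
  positive-root with positive-L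
  ... | a , 0<a , La with ≤-total a 1ℚ
  ... | inj₁ a≤1 = a , 0<a , inj₂ (<⇒≤ 0<a , L-closed-≤ (↑ x) (^-suc-≤ n (<⇒≤ 0<a) a≤1) La)
  ... | inj₂ 1≤a = 1ℚ , 0<1 , inj₂ (0≤1 ,
          L-closed-≤ (↑ x) (≤-trans (^-suc-≤ n 0≤1 ≤-refl) 1≤a) La)

-- x^(z/n); the value depends only on the fraction z/n.

infixr 8 _^[_/_]

_^[_/_] : ℝ⁺ → ℤ → (n : ℕ) .{{_ : ℕ.NonZero n}} → ℝ⁺
x ^[ z / n ] = root n (x ^ℤ z)

module Log-Lemmas where abstract

  1/suc≤1 : ∀ n → 0ℚ ≤ 1ℚ - + 1 / suc n
  1/suc≤1 n = subst (0ℚ ≤_)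
    (eq (fromℕℚ n) (fromℕℚ (suc n)) (+ 1 / suc n) (fromℕℚ-suc n) (suc*1/suc n))
    (0≤* {fromℕℚ n} {+ 1 / suc n} (0≤fromℕℚ n) (<⇒≤ (0<1/suc n)))
    where
    regroup : ∀ n i → n * i ≡ (1ℚ + n) * i - i
    regroup = solve 2 (λ n i → n :* i := (con 1ℚ :+ n) :* i :- i) refl
    eq : ∀ n m i → m ≡ 1ℚ + n → m * i ≡ 1ℚ → n * i ≡ 1ℚ - i
    eq n m i m≡ mi≡1 = trans (regroup n i)
      (cong (_- i) (trans (cong (_* i) (sym m≡)) mi≡1))

  root-nonNeg : ∀ n u → 0ℚ < 1ℚ + u → 0ℚ ≤ 1ℚ + u * (+ 1 / suc n)
  root-nonNeg n u 0<1+u = subst (0ℚ ≤_) (eq u (+ 1 / suc n))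
    (0≤+ {(1ℚ + u) * (+ 1 / suc n)} {1ℚ - + 1 / suc n}
      (0≤* {1ℚ + u} {+ 1 / suc n} (<⇒≤ 0<1+u) (<⇒≤ (0<1/suc n))) (1/suc≤1 n))
    where
    eq : ∀ u i → (1ℚ + u) * i + (1ℚ - i) ≡ 1ℚ + u * i
    eq = solve 2 (λ u i → (con 1ℚ :+ u) :* i :+ (con 1ℚ :- i) := con 1ℚ :+ u :* i) refl

  root-bound : ∀ n u → 0ℚ < 1ℚ + u → 1ℚ + u ≤ (1ℚ + u * (+ 1 / suc n)) ^ suc n
  root-bound n u 0<1+u = subst (_≤ (1ℚ + u * (+ 1 / suc n)) ^ suc n)
    (eq (fromℕℚ (suc n)) u (+ 1 / suc n) (suc*1/suc n))
    (bernoulli (suc n) (u * (+ 1 / suc n)) (root-nonNeg n u 0<1+u))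
    where
    regroup : ∀ m u i → 1ℚ + m * (u * i) ≡ 1ℚ + u * (m * i)
    regroup = solve 3 (λ m u i → con 1ℚ :+ m :* (u :* i) := con 1ℚ :+ u :* (m :* i)) refl
    eq : ∀ m u i → m * i ≡ 1ℚ → 1ℚ + m * (u * i) ≡ 1ℚ + u
    eq m u i mi≡1 = trans (regroup m u i)
      (trans (cong (λ t → 1ℚ + u * t) mi≡1) (cong (λ t → 1ℚ + t) (*-identityʳ u)))

  product≤1 : ∀ K w w′ → w′ ≡ - w → 0ℚ ≤ 1ℚ + w → 0ℚ ≤ 1ℚ + w′ →
    (1ℚ + w) ^ K * (1ℚ + w′) ^ K ≤ 1ℚ
  product≤1 K w w′ w′≡ 0≤1+w 0≤1+w′ = subst (_≤ 1ℚ) (^-distrib-* (1ℚ + w) (1ℚ + w′) K)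
    (^-≤1 {(1ℚ + w) * (1ℚ + w′)} K (0≤* {1ℚ + w} {1ℚ + w′} 0≤1+w 0≤1+w′)
      (≤-by {1ℚ} {(1ℚ + w) * (1ℚ + w′)} (w * w) (square-≥0 w)
        (trans (eq w) (cong (λ t → (1ℚ + w) * (1ℚ + t) + w * w) (sym w′≡)))))
    where
    eq : ∀ w → 1ℚ ≡ (1ℚ + w) * (1ℚ + - w) + w * w
    eq = solve 1 (λ w → con 1ℚ := (con 1ℚ :+ w) :* (con 1ℚ :+ :- w) :+ w :* w) refl

  pow-root : ∀ m n u → 0ℚ < 1ℚ + u →
    (1ℚ + u) ^ m ≤ (1ℚ + u * (+ 1 / suc n)) ^ (suc n ℕ.* m)
  pow-root m n u 0<1+u = subst ((1ℚ + u) ^ m ≤_)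
    (^-assocʳ (1ℚ + u * (+ 1 / suc n)) (suc n) m)
    (^-mono-≤ {1ℚ + u} {(1ℚ + u * (+ 1 / suc n)) ^ suc n} m (<⇒≤ 0<1+u) (root-bound n u 0<1+u))

  -- (1 + q/m)^m (1 - q/n)^n ≤ 1
  exp-bounds : ∀ m n q → 0ℚ < 1ℚ + q * (+ 1 / suc m) → 0ℚ < 1ℚ - q * (+ 1 / suc n) →
    (1ℚ + q * (+ 1 / suc m)) ^ suc m * (1ℚ - q * (+ 1 / suc n)) ^ suc n ≤ 1ℚ
  exp-bounds m n q 0<1+u 0<1-v = ≤-trans
    {(1ℚ + u) ^ suc m * (1ℚ + v) ^ suc n} {(1ℚ + u * j) ^ K * (1ℚ + v * i) ^ K} {1ℚ}
    (*-mono {(1ℚ + u) ^ suc m} {(1ℚ + v * i) ^ K} {(1ℚ + u * j) ^ K} {(1ℚ + v) ^ suc n}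
      (^-≥0 (suc m) (<⇒≤ 0<1+u))
      (^-≥0 K (root-nonNeg m v 0<1-v))
      (pow-root (suc m) n u 0<1+u)
      (subst (λ k → (1ℚ + v) ^ suc n ≤ (1ℚ + v * i) ^ k) (ℕ.*-comm (suc m) (suc n))
        (pow-root (suc n) m v 0<1-v)))
    (product≤1 K (u * j) (v * i) (eq q i j) (root-nonNeg n u 0<1+u) (root-nonNeg m v 0<1-v))
    where
    i j u v : ℚ
    i = + 1 / suc m
    j = + 1 / suc n
    u = q * i
    v = - (q * j)
    K : ℕ
    K = suc n ℕ.* suc m
    eq : ∀ q i j → - (q * j) * i ≡ - (q * i * j)
    eq = solve 3 (λ q i j → :- (q :* j) :* i := :- (q :* i :* j)) refl

  ^->0 : ∀ {p} n → 0ℚ < p → 0ℚ < p ^ n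
  ^->0 zero    0<p = 0<1
  ^->0 {p} (suc n) 0<p = 0<* {p} {p ^ n} 0<p (^->0 n 0<p)

  log-consistent : ∀ {a b} p q m n → a < b →
    0ℚ < 1ℚ - p * (+ 1 / suc n) → 1ℚ ≤ a * (1ℚ - p * (+ 1 / suc n)) ^ suc n →
    0ℚ < 1ℚ + q * (+ 1 / suc m) → b ≤ (1ℚ + q * (+ 1 / suc m)) ^ suc m → p ≤ q
  log-consistent {a} {b} p q m n a<b 0<P 1≤aP 0<Q b≤Q = [ (λ p≤q → p≤q) , absurd ]′ (≤-or-> p q)
    where
    i P Q R : ℚ
    i = + 1 / suc m
    P = (1ℚ - p * (+ 1 / suc n)) ^ suc n
    Q = (1ℚ + q * i) ^ suc m
    R = (1ℚ + p * i) ^ suc m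
    absurd : q < p → p ≤ q
    absurd q<p = ⊥-elim (<-irrefl {1ℚ} refl
      (≤-<-trans {1ℚ} {a * P} {1ℚ} 1≤aP
      (<-≤-trans {a * P} {b * P} {1ℚ} (*-monoʳ-< {P} {a} {b} (^->0 (suc n) 0<P) a<b)
      (≤-trans {b * P} {R * P} {1ℚ}
        (*-monoʳ {P} {b} {R} (<⇒≤ (^->0 (suc n) 0<P))
          (≤-trans {b} {Q} {R} b≤Q (^-mono-≤ {1ℚ + q * i} {1ℚ + p * i} (suc m) (<⇒≤ 0<Q) (<⇒≤ lt))))
        (exp-bounds m n p (<-trans 0<Q lt) 0<P)))))
      where
      lt : 1ℚ + q * i < 1ℚ + p * i
      lt = +-monoʳ-< 1ℚ (*-monoʳ-< {i} {q} {p} (0<1/suc m) q<p)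

  fine-step : ∀ {p q} → p < q → ∃[ n ]
    0ℚ < 1ℚ - p * (+ 1 / suc n) × 0ℚ < 1ℚ + q * (+ 1 / suc n) ×
    1ℚ < (1ℚ - p * (+ 1 / suc n)) * (1ℚ + q * (+ 1 / suc n))
  fine-step {p} {q} p<q = go (inv (diff-< p<q))
    where
    module _ (j : ℚ) (0<j : 0ℚ < j) (gj≡1 : (q - p) * j ≡ 1ℚ) (n : ℕ)
      (T<N : ∣ p ∣ + ∣ q ∣ + ∣ p * q ∣ * j < fromℕℚ (suc n)) where
      T i : ℚ
      T = ∣ p ∣ + ∣ q ∣ + ∣ p * q ∣ * j
      i = + 1 / suc n
      0≤i : 0ℚ ≤ i
      0≤i = <⇒≤ (0<1/suc n)
      0≤∣pq∣j : 0ℚ ≤ ∣ p * q ∣ * j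
      0≤∣pq∣j = 0≤* {∣ p * q ∣} {j} (0≤∣p∣ (p * q)) (<⇒≤ 0<j)
      rest : 0ℚ < 1ℚ - T * i
      rest = diff-< {T * i} {1ℚ} (subst (T * i <_) (suc*1/suc n)
        (*-monoʳ-< {i} {T} {fromℕℚ (suc n)} (0<1/suc n) T<N))

      first : 0ℚ < 1ℚ - p * i
      first = subst (0ℚ <_) (eq p (∣ p ∣) (∣ q ∣) (∣ p * q ∣ * j) i)
        (0<+≤ {1ℚ - T * i} {(∣ p ∣ - p + ∣ q ∣ + ∣ p * q ∣ * j) * i} rest
          (0≤* {∣ p ∣ - p + ∣ q ∣ + ∣ p * q ∣ * j} {i}
            (0≤+ {∣ p ∣ - p + ∣ q ∣} {∣ p * q ∣ * j}
              (0≤+ {∣ p ∣ - p} {∣ q ∣} (diff-≤ (∣-∣-upper p)) (0≤∣p∣ q)) 0≤∣pq∣j) 0≤i))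
        where
        eq : ∀ p P Q R i → 1ℚ - (P + Q + R) * i + (P - p + Q + R) * i ≡ 1ℚ - p * i
        eq = solve 5 (λ p P Q R i → con 1ℚ :- (P :+ Q :+ R) :* i :+ (P :- p :+ Q :+ R) :* i
                        := con 1ℚ :- p :* i) refl

      second : 0ℚ < 1ℚ + q * i
      second = subst (0ℚ <_) (eq q (∣ p ∣) (∣ q ∣) (∣ p * q ∣ * j) i)
        (0<+≤ {1ℚ - T * i} {(q - - ∣ q ∣ + ∣ p ∣ + ∣ p * q ∣ * j) * i} rest
          (0≤* {q - - ∣ q ∣ + ∣ p ∣ + ∣ p * q ∣ * j} {i}
            (0≤+ {q - - ∣ q ∣ + ∣ p ∣} {∣ p * q ∣ * j}
              (0≤+ {q - - ∣ q ∣} {∣ p ∣} (diff-≤ (∣-∣-lower q)) (0≤∣p∣ p)) 0≤∣pq∣j) 0≤i))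
        where
        eq : ∀ q P Q R i → 1ℚ - (P + Q + R) * i + (q - - Q + P + R) * i ≡ 1ℚ + q * i
        eq = solve 5 (λ q P Q R i → con 1ℚ :- (P :+ Q :+ R) :* i :+ (q :- :- Q :+ P :+ R) :* i
                        := con 1ℚ :+ q :* i) refl

      third : 1ℚ < (1ℚ - p * i) * (1ℚ + q * i)
      third = <-by {(1ℚ - p * i) * (1ℚ + q * i)} {1ℚ}
        (((q - p) * (1ℚ - T * i) + ((q - p) * (∣ p ∣ + ∣ q ∣) + (∣ p * q ∣ - p * q)) * i) * i)
        (0<* {(q - p) * (1ℚ - T * i) + ((q - p) * (∣ p ∣ + ∣ q ∣) + (∣ p * q ∣ - p * q)) * i} {i}
          (0<+≤ {(q - p) * (1ℚ - T * i)} {((q - p) * (∣ p ∣ + ∣ q ∣) + (∣ p * q ∣ - p * q)) * i}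
            (0<* {q - p} {1ℚ - T * i} (diff-< p<q) rest)
            (0≤* {(q - p) * (∣ p ∣ + ∣ q ∣) + (∣ p * q ∣ - p * q)} {i}
              (0≤+ {(q - p) * (∣ p ∣ + ∣ q ∣)} {∣ p * q ∣ - p * q}
                (0≤* {q - p} {∣ p ∣ + ∣ q ∣} (<⇒≤ (diff-< p<q)) (0≤+ {∣ p ∣} {∣ q ∣} (0≤∣p∣ p) (0≤∣p∣ q)))
                (diff-≤ (∣-∣-upper (p * q)))) 0≤i))
          (0<1/suc n))
        (eq p q (∣ p ∣) (∣ q ∣) (∣ p * q ∣) i j gj≡1)
        where
        regroup : ∀ p q P Q R i j → (1ℚ - p * i) * (1ℚ + q * i) ≡
          1ℚ + ((q - p) * (1ℚ - (P + Q + R * j) * i) + ((q - p) * (P + Q) + (R * ((q - p) * j) - p * q)) * i) * i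
        regroup = solve 7 (λ p q P Q R i j → (con 1ℚ :- p :* i) :* (con 1ℚ :+ q :* i) :=
          con 1ℚ :+ ((q :- p) :* (con 1ℚ :- (P :+ Q :+ R :* j) :* i) :+
            ((q :- p) :* (P :+ Q) :+ (R :* ((q :- p) :* j) :- p :* q)) :* i) :* i) refl
        eq : ∀ p q P Q R i j → (q - p) * j ≡ 1ℚ → (1ℚ - p * i) * (1ℚ + q * i) ≡
          1ℚ + ((q - p) * (1ℚ - (P + Q + R * j) * i) + ((q - p) * (P + Q) + (R - p * q)) * i) * i
        eq p q P Q R i j e = trans (regroup p q P Q R i j)
          (cong (λ t → 1ℚ + ((q - p) * (1ℚ - (P + Q + R * j) * i) + ((q - p) * (P + Q) + (t - p * q)) * i) * i)
            (trans (cong (R *_) e) (*-identityʳ R)))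

    go : (∃[ j ] 0ℚ < j × (q - p) * j ≡ 1ℚ) → ∃[ n ]
      0ℚ < 1ℚ - p * (+ 1 / suc n) × 0ℚ < 1ℚ + q * (+ 1 / suc n) ×
      1ℚ < (1ℚ - p * (+ 1 / suc n)) * (1ℚ + q * (+ 1 / suc n))
    go (j , 0<j , e) = go′ (archimedean (∣ p ∣ + ∣ q ∣ + ∣ p * q ∣ * j))
      where
      go′ : (∃[ n ] ∣ p ∣ + ∣ q ∣ + ∣ p * q ∣ * j < fromℕℚ (suc n)) → ∃[ n ]
        0ℚ < 1ℚ - p * (+ 1 / suc n) × 0ℚ < 1ℚ + q * (+ 1 / suc n) ×
        1ℚ < (1ℚ - p * (+ 1 / suc n)) * (1ℚ + q * (+ 1 / suc n))
      go′ (n , T<N) = n , first j 0<j e n T<N , second j 0<j e n T<N , third j 0<j e n T<N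

  separate : ∀ {P Q} n → 0ℚ < P → 0ℚ < Q → 1ℚ < P * Q →
    ∃[ a ] a < Q ^ suc n × 1ℚ ≤ a * P ^ suc n
  separate {P} {Q} n 0<P 0<Q 1<PQ = go (inv (^->0 (suc n) 0<P))
    where
    go : (∃[ a ] 0ℚ < a × P ^ suc n * a ≡ 1ℚ) → ∃[ a ] a < Q ^ suc n × 1ℚ ≤ a * P ^ suc n
    go (a , 0<a , e) = a , a<Q′ , ≤-reflexive {1ℚ} {a * P′} (sym (trans (*-comm a P′) e))
      where
      P′ Q′ : ℚ
      P′ = P ^ suc n
      Q′ = Q ^ suc n
      1<P′Q′ : 1ℚ < P′ * Q′
      1<P′Q′ = subst (1ℚ <_) (^-distrib-* P Q (suc n))
        (subst (_< (P * Q) ^ suc n) (1^ (suc n)) (^-mono-< {1ℚ} {P * Q} n 0≤1 1<PQ))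
      regroup : ∀ a P Q → a * (P * Q) ≡ P * a * Q
      regroup = solve 3 (λ a P Q → a :* (P :* Q) := P :* a :* Q) refl
      eq : ∀ a P Q → P * a ≡ 1ℚ → a * (P * Q) ≡ Q
      eq a P Q e = trans (regroup a P Q) (trans (cong (_* Q) e) (*-identityˡ Q))
      a<Q′ : a < Q′
      a<Q′ = subst (a <_) (eq a P′ Q′ e)
        (subst (_< a * (P′ * Q′)) (*-identityʳ a)
          (*-monoˡ-< {a} {1ℚ} {P′ * Q′} 0<a 1<P′Q′))

  log-lower : ∀ {a i} → a * i ≡ 1ℚ → 0ℚ < a → 0ℚ < i →
    0ℚ < 1ℚ - (- i) * 1ℚ × 1ℚ ≤ a * (1ℚ - (- i) * 1ℚ) ^ 1
  log-lower {a} {i} e 0<a 0<i =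
      subst (0ℚ <_) (eq₁ i) (0<+≤ {1ℚ} {i} 0<1 (<⇒≤ 0<i))
    , ≤-by {a * (1ℚ - (- i) * 1ℚ) ^ 1} {1ℚ} a (<⇒≤ 0<a) (trans (eq₂ a i) (cong (_+ a) e))
    where
    eq₁ : ∀ i → 1ℚ + i ≡ 1ℚ - (- i) * 1ℚ
    eq₁ = solve 1 (λ i → con 1ℚ :+ i := con 1ℚ :- (:- i) :* con 1ℚ) refl
    eq₂ : ∀ a i → a * ((1ℚ - (- i) * 1ℚ) * 1ℚ) ≡ a * i + a
    eq₂ = solve 2 (λ a i → a :* ((con 1ℚ :- (:- i) :* con 1ℚ) :* con 1ℚ) := a :* i :+ a) refl

  log-upper : ∀ {b} → 0ℚ < b → 0ℚ < 1ℚ + b * 1ℚ × b ≤ (1ℚ + b * 1ℚ) ^ 1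
  log-upper {b} 0<b =
      0<+≤ {1ℚ} {b * 1ℚ} 0<1 (<⇒≤ (0<* {b} {1ℚ} 0<b 0<1))
    , ≤-by {(1ℚ + b * 1ℚ) ^ 1} {b} 1ℚ 0≤1 (eq b)
    where
    eq : ∀ b → (1ℚ + b * 1ℚ) * 1ℚ ≡ b + 1ℚ
    eq = solve 1 (λ b → (con 1ℚ :+ b :* con 1ℚ) :* con 1ℚ := b :+ con 1ℚ) refl

-- The cut of the unique y with e^y = x: (1 + q/n)^n (n > -q) increases to e^q
-- and (1 - q/n)^(-n) (n > q) decreases to e^q as n grows, so that e^q < x iff
-- (1 - q/n)^(-n) < x for some n > q, and x < e^q iff x < (1 + q/n)^n for some
-- n > -q.  Below, n is written suc n.

log : ℝ⁺ → ℝ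
log x = fromPreCut precut
  where
  open Log-Lemmas
  open Positive-Lemmas x

  L′ U′ : ℚ → Set
  L′ q = ∃[ n ] ∃[ a ] L (↑ x) a ×
    0ℚ < 1ℚ - q * (+ 1 / suc n) × 1ℚ ≤ a * (1ℚ - q * (+ 1 / suc n)) ^ suc n
  U′ q = ∃[ n ] ∃[ b ] U (↑ x) b ×
    0ℚ < 1ℚ + q * (+ 1 / suc n) × b ≤ (1ℚ + q * (+ 1 / suc n)) ^ suc n

  abstract

    L′-inhabited : ∃[ q ] L′ q
    L′-inhabited = go positive-L
      where
      go : (∃[ a ] 0ℚ < a × L (↑ x) a) → ∃[ q ] L′ q
      go (a , 0<a , La) = go′ (inv 0<a)
        where
        go′ : (∃[ i ] 0ℚ < i × a * i ≡ 1ℚ) → ∃[ q ] L′ q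
        go′ (i , 0<i , e) = - i , 0 , a , La , log-lower e 0<a 0<i

    U′-inhabited : ∃[ q ] U′ q
    U′-inhabited = go (ℝ.U-inhabited (↑ x))
      where
      go : (∃[ b ] U (↑ x) b) → ∃[ q ] U′ q
      go (b , Ub) = b , 0 , b , Ub , log-upper (0<U Ub)

    L≤U : ∀ {p q} → L′ p → U′ q → p ≤ q
    L≤U {p} {q} (n , a , La , 0<P , 1≤aP) (m , b , Ub , 0<Q , b≤Q) =
      log-consistent p q m n (L<U (↑ x) La Ub) 0<P 1≤aP 0<Q b≤Q

    loc : ∀ {p q} → p < q → L′ p ⊎ U′ q
    loc {p} {q} p<q = go (fine-step p<q)
      where
      go : (∃[ n ] 0ℚ < 1ℚ - p * (+ 1 / suc n) × 0ℚ < 1ℚ + q * (+ 1 / suc n) ×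
             1ℚ < (1ℚ - p * (+ 1 / suc n)) * (1ℚ + q * (+ 1 / suc n))) → L′ p ⊎ U′ q
      go (n , 0<P , 0<Q , 1<PQ) = go′ (separate n 0<P 0<Q 1<PQ)
        where
        go′ : (∃[ a ] a < (1ℚ + q * (+ 1 / suc n)) ^ suc n ×
                1ℚ ≤ a * (1ℚ - p * (+ 1 / suc n)) ^ suc n) → L′ p ⊎ U′ q
        go′ (a , a<Q , 1≤aP) =
          [ (λ La → inj₁ (n , a , La , 0<P , 1≤aP))
          , (λ UQ → inj₂ (n , (1ℚ + q * (+ 1 / suc n)) ^ suc n , UQ , 0<Q , ≤-refl))
          ]′ (ℝ.located (↑ x) a<Q)

  precut : PreCut
  precut = record
    { L′           = L′
    ; U′           = U′
    ; L′-inhabited = L′-inhabited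
    ; U′-inhabited = U′-inhabited
    ; L′≤U′        = L≤U
    ; located′     = loc
    }

∏⁺ : ∀ {n} → Vector ℝ⁺ n → ℝ⁺
∏⁺ = foldr _*⁺_ 1⁺

∏ : ∀ {n} → Vector ℕ n → ℕ
∏ = foldr ℕ._*_ 1

minimum : ∀ {n} .{{_ : ℕ.NonZero n}} → Vector ℝ⁺ n → ℝ⁺
minimum {suc n} x = foldr _⊓⁺_ (head x) (tail x)

-- A relation rather than a function, since constructively a real number need
-- not have a ceiling that can be computed.

infix 4 ⌈_⌉≡_

⌈_⌉≡_ : ℝ → ℤ → Set
⌈ x ⌉≡ m = fromℤ (m ℤ.- + 1) <ʳ x × x ≤ʳ fromℤ m

record FinSet (A : Set) : Set where
  field
    elements : List A
    unique   : Unique elements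

open FinSet

infix 4 _∈ˢ_ _≤#_

_∈ˢ_ : {A : Set} → A → FinSet A → Set
a ∈ˢ S = a ∈ elements S

card : {A : Set} → FinSet A → ℕ
card S = length (elements S)

-- x ≤ #{a : P a}, stated without deciding P (here P involves an inequality
-- between reals): P holds on some finite set with at least x elements.

_≤#_ : {A : Set} → ℝ → (A → Set) → Set
x ≤# P = Σ[ S ∈ FinSet _ ] (∀ {a} → a ∈ˢ S → P a) × x ≤ʳ fromℕ (card S)

lcmᵛ : ∀ {n} → Vec ℤ n → ℤ
lcmᵛ = foldr′ ℤ.lcm (+ 1)

instance
  nonTrivial⇒pred-nonZero : ∀ {n} .{{_ : NonTrivial n}} → ℕ.NonZero (n ℕ.∸ 1)
  nonTrivial⇒pred-nonZero {suc (suc n)} = _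

{-# OPTIONS --safe #-}

-- Put D = δ^(-1/(k-1)), so that M is comparable to D and M^(k-1) ≤ 1/δ, and let
-- N be a power of two comparable to M.  The moduli are M of the N consecutive
-- integers following Q.  For each modulus d, A_i receives the same number (a
-- constant times X_i/Q) of multiples of d in [X_i, 2X_i] that share no value
-- with the multiples of the other moduli.  Thus A_i splits into M blocks of
-- equal size, and the tuples whose entries all come from blocks of one modulus d
-- have density exactly M^(1-k) ≥ δ; for them d^(k-1) lcm ≤ ∏ a_i ≤ 2^k ∏ X_i,
-- whence lcm ≤ L because d ≥ Q.
--
-- No primes are needed: a collision d m = d′ m′ forces d′ to divide gcd(d, d′) m,
-- where gcd(d, d′) is a divisor of d below N.  The number of m excluded in this
-- way is governed by the number of divisors of d below N, which averages
-- O(log N) over the window; discarding the worst half of the window leaves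
-- moduli for which M log(2M) ≤ Q/K keeps at least half of the multiples.

module Submission where

open import Defs

-- Only the number of divisors matters because two effects cancel. Fix a divisor e of d. A multiple
-- d′ of e in the window divides e m for at most a proportion e/Q of the m, and at most 2N/e
-- integers of the window are multiples of e. So each e excludes a proportion of at most 2N/Q,
-- whatever its size: moduli with a large common divisor collide often, but they are rare.
--
-- An m is discarded as soon as it clashes with any integer of the window, chosen as a modulus or
-- not. Each block can therefore be thinned without knowing the others.
--
-- A second obstacle is constructive: a real has no computable floor, and inequalities between reals
-- cannot be decided. Q and each X_i are enclosed strictly between naturals n and n + 2, and from
-- there on the argument compares only naturals and rationals. This is why several constants are
-- larger than a classical proof would need. Roots are likewise never computed: every inequality
-- with exponent 1/(k-1) is raised to the power k-1 first.

module Counting where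

  open import Data.Nat.Base
  open import Data.Nat.Properties
  open import Data.Nat.Divisibility
  open import Data.Nat.DivMod
  open import Data.Nat.GCD
  open import Data.Nat.ListAction using (sum)
  open import Data.Nat.Tactic.RingSolver using (solve-∀)
  open import Data.Bool.Base using (if_then_else_)
  open import Data.List.Base using (List; []; _∷_; applyUpTo; filter; length; map)
  open import Data.Empty using (⊥-elim)
  open import Function.Base using (_∘_)
  open import Relation.Unary using (Decidable)
  open import Relation.Nullary using (¬_; Dec; yes; no; does)
  open import Relation.Binary.Definitions using (tri<; tri≈; tri>)
  open import Relation.Binary.PropositionalEquality

  -- Finite sums, dyadic harmonic sums and Markov's inequality.

  ∑ : ℕ → (ℕ → ℕ) → ℕ
  ∑ n f = sum (applyUpTo f n)

  ∑-mono : ∀ n {f g} → (∀ i → i < n → f i ≤ g i) → ∑ n f ≤ ∑ n g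
  ∑-mono zero    f≤g = z≤n
  ∑-mono (suc n) f≤g = +-mono-≤ (f≤g 0 z<s) (∑-mono n (λ i i<n → f≤g (suc i) (s<s i<n)))

  ∑-cong : ∀ n {f g} → (∀ i → f i ≡ g i) → ∑ n f ≡ ∑ n g
  ∑-cong zero    f≡g = refl
  ∑-cong (suc n) f≡g = cong₂ _+_ (f≡g 0) (∑-cong n (f≡g ∘ suc))

  ∑-const : ∀ n c → ∑ n (λ _ → c) ≡ n * c
  ∑-const zero    c = refl
  ∑-const (suc n) c = cong (c +_) (∑-const n c)

  ∑-+ : ∀ n f g → ∑ n (λ i → f i + g i) ≡ ∑ n f + ∑ n g
  ∑-+ zero    f g = refl
  ∑-+ (suc n) f g = trans (cong (f 0 + g 0 +_) (∑-+ n (f ∘ suc) (g ∘ suc)))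
    (interchange (f 0) (g 0) (∑ n (f ∘ suc)) (∑ n (g ∘ suc)))
    where
    interchange : ∀ a b c d → a + b + (c + d) ≡ a + c + (b + d)
    interchange = solve-∀

  ∑-*ˡ : ∀ n c f → c * ∑ n f ≡ ∑ n (λ i → c * f i)
  ∑-*ˡ zero    c f = *-zeroʳ c
  ∑-*ˡ (suc n) c f = trans (*-distribˡ-+ c (f 0) _) (cong (c * f 0 +_) (∑-*ˡ n c (f ∘ suc)))

  ∑-*ʳ : ∀ n c f → ∑ n f * c ≡ ∑ n (λ i → f i * c)
  ∑-*ʳ n c f = trans (*-comm (∑ n f) c)
    (trans (∑-*ˡ n c f) (∑-cong n (λ i → *-comm c (f i))))

  ∑-swap : ∀ m n (f : ℕ → ℕ → ℕ) → ∑ m (λ i → ∑ n (f i)) ≡ ∑ n (λ j → ∑ m (λ i → f i j))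
  ∑-swap zero    n f = sym (trans (∑-const n 0) (*-zeroʳ n))
  ∑-swap (suc m) n f = trans (cong (∑ n (f 0) +_) (∑-swap m n (f ∘ suc)))
    (sym (∑-+ n (f 0) (λ j → ∑ m (λ i → f (suc i) j))))

  ∑-split : ∀ m n f → ∑ (m + n) f ≡ ∑ m f + ∑ n (λ i → f (m + i))
  ∑-split zero    n f = refl
  ∑-split (suc m) n f = trans (cong (f 0 +_) (∑-split m n (f ∘ suc))) (sym (+-assoc (f 0) _ _))

  term≤∑ : ∀ n f {i} → i < n → f i ≤ ∑ n f
  term≤∑ (suc n) f {zero}  _         = m≤m+n (f 0) _
  term≤∑ (suc n) f {suc i} (s<s i<n) = ≤-trans (term≤∑ n (f ∘ suc) i<n) (m≤n+m _ (f 0))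

  -- Σ_{e<2^h} B/e ≤ h B, one dyadic block [2^i, 2^(i+1)) at a time.
  dyadic-∑ : ∀ h B (c : ℕ → ℕ) → c 0 ≡ 0 → (∀ e → e < 2 ^ h → e * c e ≤ B) → ∑ (2 ^ h) c ≤ h * B
  dyadic-∑ zero    B c c0 bound = ≤-reflexive (trans (+-identityʳ (c 0)) c0)
  dyadic-∑ (suc h) B c c0 bound = begin
    ∑ (2 ^ suc h) c                              ≡⟨ cong (λ n → ∑ (H + n) c) (+-identityʳ H) ⟩
    ∑ (H + H) c                                  ≡⟨ ∑-split H H c ⟩
    ∑ H c + ∑ H (λ i → c (H + i))                ≤⟨ +-mono-≤ (dyadic-∑ h B c c0 lower) upper ⟩
    h * B + B                                    ≡⟨ +-comm (h * B) B ⟩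
    suc h * B                                    ∎
    where
    open ≤-Reasoning
    H = 2 ^ h
    instance
      H≢0 : NonZero H
      H≢0 = m^n≢0 2 h
    lower : ∀ e → e < H → e * c e ≤ B
    lower e e<H = bound e (≤-trans e<H (m≤m+n H _))
    upper : ∑ H (λ i → c (H + i)) ≤ B
    upper = *-cancelˡ-≤ H (begin
      H * ∑ H (λ i → c (H + i))         ≡⟨ ∑-*ˡ H H (λ i → c (H + i)) ⟩
      ∑ H (λ i → H * c (H + i))         ≤⟨ ∑-mono H (λ i i<H → ≤-trans (*-monoˡ-≤ (c (H + i)) (m≤m+n H i))
                                             (bound (H + i) (+-monoʳ-< H (subst (i <_) (sym (+-identityʳ H)) i<H)))) ⟩
      ∑ H (λ _ → B)                     ≡⟨ ∑-const H B ⟩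
      H * B                             ∎)

  -- Every x failing P contributes at least `suc t` to the sum. With t = 4 h this selects the
  -- moduli; with t = 0 it bounds the number of cofactors that have a clash by the total number of
  -- clashes.
  markov : ∀ {A : Set} {P : A → Set} (P? : Decidable P) (f : A → ℕ) t → (∀ x → ¬ P x → t < f x) →
    ∀ xs → suc t * length xs ≤ suc t * length (filter P? xs) + sum (map f xs)
  markov P? f t t<f [] = ≤-trans (≤-reflexive (*-zeroʳ (suc t))) z≤n
  markov P? f t t<f (x ∷ xs) with markov P? f t t<f xs | P? x
  ... | rec | yes _ = begin
    suc t * suc (length xs)                    ≡⟨ *-suc (suc t) (length xs) ⟩
    suc t + suc t * length xs                  ≤⟨ +-monoʳ-≤ (suc t) rec ⟩
    suc t + (suc t * g + s)                    ≡⟨ +-assoc (suc t) (suc t * g) s ⟨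
    suc t + suc t * g + s                      ≡⟨ cong (_+ s) (*-suc (suc t) g) ⟨
    suc t * suc g + s                          ≤⟨ +-monoʳ-≤ (suc t * suc g) (m≤n+m s (f x)) ⟩
    suc t * suc g + (f x + s)                  ∎
    where
    open ≤-Reasoning
    g = length (filter P? xs)
    s = sum (map f xs)
  ... | rec | no ¬Px = begin
    suc t * suc (length xs)                    ≡⟨ *-suc (suc t) (length xs) ⟩
    suc t + suc t * length xs                  ≤⟨ +-mono-≤ (t<f x ¬Px) rec ⟩
    f x + (suc t * g + s)                      ≡⟨ swap (f x) (suc t * g) s ⟩
    suc t * g + (f x + s)                      ∎
    where
    open ≤-Reasoning
    g = length (filter P? xs)
    s = sum (map f xs)
    swap : ∀ a b c → a + (b + c) ≡ b + (a + c)
    swap = solve-∀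

  -- Counting multiples in intervals.

  ⟦_∣_⟧ : ℕ → ℕ → ℕ
  ⟦ m ∣ n ⟧ = if does (m ∣? n) then 1 else 0

  ⟦∣⟧-yes : ∀ {m n} → m ∣ n → ⟦ m ∣ n ⟧ ≡ 1
  ⟦∣⟧-yes {m} {n} m∣n with m ∣? n
  ... | yes _ = refl
  ... | no m∤n = ⊥-elim (m∤n m∣n)

  ⟦∣⟧-no : ∀ {m n} → ¬ m ∣ n → ⟦ m ∣ n ⟧ ≡ 0
  ⟦∣⟧-no {m} {n} m∤n with m ∣? n
  ... | yes m∣n = ⊥-elim (m∤n m∣n)
  ... | no _ = refl

  ⟦∣⟧-mono : ∀ {m n m′ n′} → (m ∣ n → m′ ∣ n′) → ⟦ m ∣ n ⟧ ≤ ⟦ m′ ∣ n′ ⟧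
  ⟦∣⟧-mono {m} {n} imp with m ∣? n
  ... | yes m∣n = ≤-reflexive (sym (⟦∣⟧-yes (imp m∣n)))
  ... | no _ = z≤n

  -- Sums over divisors run over all e < N and so include e = 0; this removes that term.
  ⟦0∣⟧ : ∀ {n} → 0 < n → ⟦ 0 ∣ n ⟧ ≡ 0
  ⟦0∣⟧ {suc n} _ = ⟦∣⟧-no (λ 0∣n → 1+n≢0 {n} (0∣⇒≡0 0∣n))

  quotient-step : ∀ a e .{{_ : NonZero e}} → a / e + ⟦ e ∣ suc a ⟧ ≤ suc a / e
  quotient-step a e with e ∣? suc a
  ... | no _ = ≤-trans (≤-reflexive (+-identityʳ _)) (/-monoˡ-≤ e (n≤1+n a))
  ... | yes (divides k eq) = begin
    a / e + 1     ≡⟨ +-comm (a / e) 1 ⟩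
    suc (a / e)   ≤⟨ m<n*o⇒m/o<n (≤-reflexive eq) ⟩
    k             ≡⟨ m*n/n≡m k e ⟨
    k * e / e     ≡⟨ cong (_/ e) eq ⟨
    suc a / e     ∎
    where open ≤-Reasoning

  -- `quotient-step` telescopes: the quotient by e grows by at least one at each multiple of e.
  count-multiples : ∀ n a e .{{_ : NonZero e}} → a / e + ∑ n (λ j → ⟦ e ∣ suc a + j ⟧) ≤ (a + n) / e
  count-multiples zero    a e = ≤-reflexive (trans (+-identityʳ _) (cong (_/ e) (sym (+-identityʳ a))))
  count-multiples (suc n) a e = begin
    a / e + (⟦ e ∣ suc (a + 0) ⟧ + ∑ n (λ j → ⟦ e ∣ suc a + suc j ⟧))
      ≡⟨ +-assoc (a / e) _ _ ⟨
    a / e + ⟦ e ∣ suc (a + 0) ⟧ + ∑ n (λ j → ⟦ e ∣ suc a + suc j ⟧)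
      ≡⟨ cong₂ (λ x y → a / e + ⟦ e ∣ suc x ⟧ + y) (+-identityʳ a)
           (∑-cong n (λ j → cong ⟦ e ∣_⟧ (+-suc (suc a) j))) ⟩
    a / e + ⟦ e ∣ suc a ⟧ + ∑ n (λ j → ⟦ e ∣ suc (suc a) + j ⟧)
      ≤⟨ +-monoˡ-≤ _ (quotient-step a e) ⟩
    suc a / e + ∑ n (λ j → ⟦ e ∣ suc (suc a) + j ⟧)
      ≤⟨ count-multiples n (suc a) e ⟩
    (suc a + n) / e
      ≡⟨ cong (_/ e) (+-suc a n) ⟨
    (a + suc n) / e ∎
    where open ≤-Reasoning

  -- The window starts at `suc a`, so it holds at most ⌊(a+n)/e⌋ - ⌊a/e⌋ multiples. The summand e on
  -- the right pays for the remainder of a.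
  multiples-in-window : ∀ n q e .{{_ : NonZero e}} → 0 < q → e * ∑ n (λ j → ⟦ e ∣ q + j ⟧) ≤ n + e
  multiples-in-window n (suc a) e _ = +-cancelˡ-≤ (e * (a / e)) _ _ (begin
    e * (a / e) + e * c           ≡⟨ *-distribˡ-+ e (a / e) c ⟨
    e * (a / e + c)               ≤⟨ *-monoʳ-≤ e (count-multiples n a e) ⟩
    e * ((a + n) / e)             ≡⟨ *-comm e _ ⟩
    (a + n) / e * e               ≤⟨ m/n*n≤m (a + n) e ⟩
    a + n                         ≡⟨ cong (_+ n) (m≡m%n+[m/n]*n a e) ⟩
    a % e + a / e * e + n         ≤⟨ +-monoˡ-≤ n (+-monoˡ-≤ (a / e * e) (m%n≤n a e)) ⟩
    e + a / e * e + n             ≡⟨ rearrange e (a / e) n ⟩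
    e * (a / e) + (n + e)         ∎)
    where
    open ≤-Reasoning
    c = ∑ n (λ j → ⟦ e ∣ suc a + j ⟧)
    rearrange : ∀ e b n → e + b * e + n ≡ e * b + (n + e)
    rearrange = solve-∀

  multiples-up-to : ∀ n e .{{_ : NonZero e}} → e * ∑ n (λ j → ⟦ e ∣ suc j ⟧) ≤ n
  multiples-up-to n e = begin
    e * c             ≤⟨ *-monoʳ-≤ e (≤-trans (m≤n+m c (0 / e)) (count-multiples n 0 e)) ⟩
    e * (n / e)       ≡⟨ *-comm e (n / e) ⟩
    n / e * e         ≤⟨ m/n*n≤m n e ⟩
    n                 ∎
    where
    open ≤-Reasoning
    c = ∑ n (λ j → ⟦ e ∣ suc j ⟧)

  -- Divisors and collisions within a window of consecutive moduli.

  module Window (q h : ℕ) (0<q : 0 < q) where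

    N : ℕ
    N = 2 ^ h

    τ : ℕ → ℕ
    τ d = ∑ N (λ e → ⟦ e ∣ d ⟧)

    multiples≤2N : ∀ e → e < N → e * ∑ N (λ j → ⟦ e ∣ q + j ⟧) ≤ N + N
    multiples≤2N zero    _   = z≤n
    multiples≤2N (suc e) e<N = ≤-trans (multiples-in-window N q (suc e) 0<q) (+-monoʳ-≤ N (<⇒≤ e<N))

    -- After the exchange of sums, the term for e counts the multiples of e in the window, at most
    -- 2N/e of them, and the dyadic bound applies. Hence τ is at most 2 h on average.
    ∑τ : ∑ N (λ j → τ (q + j)) ≤ h * (N + N)
    ∑τ = ≤-trans (≤-reflexive (∑-swap N N (λ j e → ⟦ e ∣ q + j ⟧)))
      (dyadic-∑ h (N + N) (λ e → ∑ N (λ j → ⟦ e ∣ q + j ⟧)) zeroth multiples≤2N)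
      where
      zeroth : ∑ N (λ j → ⟦ 0 ∣ q + j ⟧) ≡ 0
      zeroth = trans (∑-cong N (λ j → ⟦0∣⟧ (≤-trans 0<q (m≤m+n q j)))) (trans (∑-const N 0) (*-zeroʳ N))

    -- If q + j = f e, then q + j ∣ e m forces f ∣ m, which leaves at most Y / f = Y e / (q + j) of
    -- the m up to Y. The indicator is kept on both sides so that the bound can be summed over the
    -- whole window.
    common-multiples : ∀ Y e j → e ≢ 0 →
      q * (⟦ e ∣ q + j ⟧ * ∑ Y (λ i → ⟦ q + j ∣ e * suc i ⟧)) ≤ ⟦ e ∣ q + j ⟧ * (Y * e)
    common-multiples Y e j e≢0 with e ∣? q + j
    ... | no _ = ≤-reflexive (*-zeroʳ q)
    ... | yes (divides f eq) = begin
      q * (1 * ∑ Y (λ i → ⟦ q + j ∣ e * suc i ⟧))   ≤⟨ *-mono-≤ (m≤m+n q j) (*-monoʳ-≤ 1 (∑-mono Y (λ i _ → ⟦∣⟧-mono (cancel i)))) ⟩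
      (q + j) * (1 * ∑ Y (λ i → ⟦ f ∣ suc i ⟧))     ≡⟨ cong (_* (1 * ∑ Y (λ i → ⟦ f ∣ suc i ⟧))) eq ⟩
      f * e * (1 * ∑ Y (λ i → ⟦ f ∣ suc i ⟧))       ≡⟨ rearrange f e _ ⟩
      e * (f * ∑ Y (λ i → ⟦ f ∣ suc i ⟧))           ≤⟨ *-monoʳ-≤ e (multiples-up-to Y f) ⟩
      e * Y                                         ≡⟨ rearrange′ e Y ⟩
      1 * (Y * e)                                   ∎
      where
      open ≤-Reasoning
      instance
        f≢0 : NonZero f
        f≢0 = ≢-nonZero (λ { refl → <-irrefl (sym eq) (≤-trans 0<q (m≤m+n q j)) })
        e-nonZero : NonZero e
        e-nonZero = ≢-nonZero e≢0
      cancel : ∀ i → q + j ∣ e * suc i → f ∣ suc i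
      cancel i d∣ = *-cancelˡ-∣ e (subst (_∣ e * suc i) (trans eq (*-comm f e)) d∣)
      rearrange : ∀ f e s → f * e * (1 * s) ≡ e * (f * s)
      rearrange = solve-∀
      rearrange′ : ∀ e y → e * y ≡ 1 * (y * e)
      rearrange′ = solve-∀

    abstract

      -- The window [q, q + N) serves as the set of moduli.  If d and d′ = q + j
      -- are two of them with d m = d′ m′, then d′ divides gcd(d, d′) m, so a
      -- collision of d m with a multiple of another modulus forces clash d m > 0.
      clash : ℕ → ℕ → ℕ
      clash d m = ∑ N (λ e → ⟦ e ∣ d ⟧ * ∑ N (λ j → ⟦ e ∣ q + j ⟧ * ⟦ q + j ∣ e * m ⟧))

      -- Summed over the window, `common-multiples` yields Y e for each multiple of e, and the
      -- number of these multiples cancels the factor e. Each divisor of d below N thus contributes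
      -- at most Y (N + N).
      ∑clash : ∀ d Y → 0 < d → q * ∑ Y (λ i → clash d (suc i)) ≤ τ d * (Y * (N + N))
      ∑clash d Y 0<d = begin
        q * ∑ Y (λ i → clash d (suc i))
          ≡⟨ cong (q *_) (∑-swap Y N (λ i e → ⟦ e ∣ d ⟧ * inner e (suc i))) ⟩
        q * ∑ N (λ e → ∑ Y (λ i → ⟦ e ∣ d ⟧ * inner e (suc i)))
          ≡⟨ ∑-*ˡ N q _ ⟩
        ∑ N (λ e → q * ∑ Y (λ i → ⟦ e ∣ d ⟧ * inner e (suc i)))
          ≤⟨ ∑-mono N per-divisor ⟩
        ∑ N (λ e → ⟦ e ∣ d ⟧ * (Y * (N + N)))
          ≡⟨ ∑-*ʳ N (Y * (N + N)) (λ e → ⟦ e ∣ d ⟧) ⟨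
        τ d * (Y * (N + N)) ∎
        where
        open ≤-Reasoning
        inner : ℕ → ℕ → ℕ
        inner e m = ∑ N (λ j → ⟦ e ∣ q + j ⟧ * ⟦ q + j ∣ e * m ⟧)
        inner-∑ : ∀ e → e < N → e ≢ 0 → q * ∑ Y (λ i → inner e (suc i)) ≤ Y * (N + N)
        inner-∑ e e<N e≢0 = begin
          q * ∑ Y (λ i → inner e (suc i))
            ≡⟨ cong (q *_) (trans (∑-swap Y N (λ i j → ⟦ e ∣ q + j ⟧ * ⟦ q + j ∣ e * suc i ⟧))
                 (∑-cong N (λ j → sym (∑-*ˡ Y ⟦ e ∣ q + j ⟧ (λ i → ⟦ q + j ∣ e * suc i ⟧))))) ⟩
          q * ∑ N (λ j → ⟦ e ∣ q + j ⟧ * ∑ Y (λ i → ⟦ q + j ∣ e * suc i ⟧))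
            ≡⟨ ∑-*ˡ N q _ ⟩
          ∑ N (λ j → q * (⟦ e ∣ q + j ⟧ * ∑ Y (λ i → ⟦ q + j ∣ e * suc i ⟧)))
            ≤⟨ ∑-mono N (λ j _ → common-multiples Y e j e≢0) ⟩
          ∑ N (λ j → ⟦ e ∣ q + j ⟧ * (Y * e))
            ≡⟨ ∑-*ʳ N (Y * e) (λ j → ⟦ e ∣ q + j ⟧) ⟨
          ∑ N (λ j → ⟦ e ∣ q + j ⟧) * (Y * e)
            ≡⟨ rearrange (∑ N (λ j → ⟦ e ∣ q + j ⟧)) Y e ⟩
          Y * (e * ∑ N (λ j → ⟦ e ∣ q + j ⟧))
            ≤⟨ *-monoʳ-≤ Y (multiples≤2N e e<N) ⟩
          Y * (N + N) ∎
          where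
          rearrange : ∀ s y e → s * (y * e) ≡ y * (e * s)
          rearrange = solve-∀
        per-divisor : ∀ e → e < N → q * ∑ Y (λ i → ⟦ e ∣ d ⟧ * inner e (suc i)) ≤ ⟦ e ∣ d ⟧ * (Y * (N + N))
        per-divisor e e<N = ≤-trans (≤-reflexive
            (trans (cong (q *_) (sym (∑-*ˡ Y ⟦ e ∣ d ⟧ (λ i → inner e (suc i)))))
                   (rearrange q ⟦ e ∣ d ⟧ (∑ Y (λ i → inner e (suc i))))))
            (by-cases (e ≟ 0))
          where
          rearrange : ∀ q a s → q * (a * s) ≡ a * (q * s)
          rearrange = solve-∀
          by-cases : Dec (e ≡ 0) → ⟦ e ∣ d ⟧ * (q * ∑ Y (λ i → inner e (suc i))) ≤ ⟦ e ∣ d ⟧ * (Y * (N + N))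
          by-cases (no e≢0) = *-monoʳ-≤ ⟦ e ∣ d ⟧ (inner-∑ e e<N e≢0)
          by-cases (yes refl) rewrite ⟦0∣⟧ 0<d = z≤n

      collision : ∀ {j j′ m m′} → j < N → j′ < N → j ≢ j′ →
        (q + j) * m ≡ (q + j′) * m′ → 0 < clash (q + j) m
      collision {j} {j′} {m} {m′} j<N j′<N j≢j′ eq = begin
        1                                                       ≡⟨ cong₂ _*_ (⟦∣⟧-yes g∣d) (cong₂ _*_ (⟦∣⟧-yes g∣d′) (⟦∣⟧-yes d′∣gm)) ⟨
        ⟦ g ∣ d ⟧ * (⟦ g ∣ d′ ⟧ * ⟦ d′ ∣ g * m ⟧)               ≤⟨ *-monoʳ-≤ ⟦ g ∣ d ⟧ (term≤∑ N (λ j → ⟦ g ∣ q + j ⟧ * ⟦ q + j ∣ g * m ⟧) j′<N) ⟩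
        ⟦ g ∣ d ⟧ * ∑ N (λ j → ⟦ g ∣ q + j ⟧ * ⟦ q + j ∣ g * m ⟧) ≤⟨ term≤∑ N (λ e → ⟦ e ∣ d ⟧ * ∑ N (λ j → ⟦ e ∣ q + j ⟧ * ⟦ q + j ∣ e * m ⟧)) g<N ⟩
        clash d m                                               ∎
        where
        open ≤-Reasoning
        d d′ g : ℕ
        d = q + j
        d′ = q + j′
        g = gcd d d′
        g∣d : g ∣ d
        g∣d = gcd[m,n]∣m d d′
        g∣d′ : g ∣ d′
        g∣d′ = gcd[m,n]∣n d d′
        -- d′ divides m d, which equals m′ d′, and also m d′; hence it divides their gcd, which is m
        -- g.
        d′∣gm : d′ ∣ g * m
        d′∣gm = subst (d′ ∣_) (trans (sym (c*gcd[m,n]≡gcd[cm,cn] m d d′)) (*-comm m g))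
          (gcd-greatest (subst (d′ ∣_) (trans (sym eq) (*-comm d m)) (m∣m*n m′)) (n∣m*n m))
        -- g divides the difference of the two offsets, which is positive and less than N.
        below : ∀ {i i′} → i < i′ → i′ < N → g ∣ q + i → g ∣ q + i′ → g < N
        below {i} {i′} i<i′ i′<N g∣i g∣i′ = ≤-<-trans (∣⇒≤ {{>-nonZero (m<n⇒0<n∸m i<i′)}} g∣diff) (≤-<-trans (m∸n≤m i′ i) i′<N)
          where
          g∣diff : g ∣ i′ ∸ i
          g∣diff = ∣m+n∣m⇒∣n (subst (g ∣_) (trans (cong (q +_) (sym (m+[n∸m]≡n (<⇒≤ i<i′)))) (sym (+-assoc q i _))) g∣i′) g∣i
        g<N : g < N
        g<N with <-cmp j j′
        ... | tri< j<j′ _ _ = below j<j′ j′<N g∣d g∣d′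
        ... | tri≈ _ j≡j′ _ = ⊥-elim (j≢j′ j≡j′)
        ... | tri> _ _ j′<j = below j′<j j<N g∣d′ g∣d

-- Choice of the moduli and of disjoint blocks of multiples.

module Moduli where

  open import Data.Nat.Base
  open import Data.Nat.Properties
  open import Data.Nat.Divisibility
  open import Data.Nat.DivMod
  open import Data.Nat.Tactic.RingSolver using (solve-∀)
  open import Data.List.Base using (List; applyUpTo; upTo; filter; length; map; take)
  open import Data.List.Properties
  open import Data.Nat.ListAction using (sum)
  open import Data.List.Membership.Propositional using (_∈_)
  open import Data.List.Membership.Propositional.Properties
  open import Data.List.Relation.Unary.Unique.Propositional using (Unique)
  import Data.List.Relation.Unary.Unique.Propositional.Properties as Unique
  open import Data.Product.Base using (∃; _×_; _,_)
  open import Data.Empty using (⊥-elim)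
  open import Function.Base using (id)
  open import Relation.Nullary using (yes; no)
  open import Relation.Binary.PropositionalEquality
  open Counting

  ∈-take⁻ : ∀ {A : Set} {x : A} n xs → x ∈ take n xs → x ∈ xs
  ∈-take⁻ n xs x∈ = subst (_ ∈_) (take++drop≡id n xs) (∈-++⁺ˡ x∈)

  -- All that later arguments know about the blocks. In use z < X_i < 2 + z, so the bounds 2 + z and
  -- 2 z place a block inside [X_i, 2 X_i]. `size` depends on z but not on the modulus, which makes
  -- the density exact.
  record Progressions (M q : ℕ) : Set where
    field
      moduli        : List ℕ
      moduli-unique : Unique moduli
      moduli-length : length moduli ≡ M
      moduli-≥      : ∀ {d} → d ∈ moduli → q ≤ d
      size          : ℕ → ℕ
      block         : ℕ → ℕ → List ℕ
      block-unique  : ∀ z {d} → d ∈ moduli → Unique (block z d)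
      block-∣       : ∀ z {d a} → a ∈ block z d → d ∣ a
      block-meet    : ∀ z {d d′ a} → d ∈ moduli → d′ ∈ moduli →
                      a ∈ block z d → a ∈ block z d′ → d ≡ d′
      block-bounds  : ∀ {z d a} → 32 * q ≤ z → d ∈ moduli → a ∈ block z d → 2 + z ≤ a × a ≤ 2 * z
      block-length  : ∀ {z d} → 32 * q ≤ z → d ∈ moduli → length (block z d) ≡ size z
      size-bound    : ∀ {z} → 32 * q ≤ z → z ≤ 12 * (q * size z)

  module _ (M h q : ℕ) (0<M : 0 < M) (0<h : 0 < h) (2M≤N : 2 * M ≤ 2 ^ h) (N≤4M : 2 ^ h ≤ 4 * M)
    (large : 384 * (M * h) ≤ q) where

    private
      0<q : 0 < q
      0<q = ≤-trans (*-mono-≤ (z<s {n = 383}) (*-mono-≤ 0<M 0<h)) large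

      open Window q h 0<q

      -- 96 = 2 · 4 · 6 · 2 is the factor met in `few-clashes`; 384 is four times that because N may
      -- be as large as 4 M.
      96Nh≤q : 96 * (N * h) ≤ q
      96Nh≤q = begin
        96 * (N * h)          ≤⟨ *-monoʳ-≤ 96 (*-monoˡ-≤ h N≤4M) ⟩
        96 * (4 * M * h)      ≡⟨ rearrange M h ⟩
        384 * (M * h)         ≤⟨ large ⟩
        q                     ∎
        where
        open ≤-Reasoning
        rearrange : ∀ m h → 96 * (4 * m * h) ≡ 384 * (m * h)
        rearrange = solve-∀

      -- Keeps every modulus below 5 q / 4, so that the blocks do not overshoot 2 z.
      4N≤q : 4 * N ≤ q
      4N≤q = begin
        4 * N                 ≡⟨ cong (4 *_) (*-identityʳ N) ⟨
        4 * (N * 1)           ≤⟨ *-mono-≤ (m≤m+n 4 92) (*-monoʳ-≤ N 0<h) ⟩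
        96 * (N * h)          ≤⟨ 96Nh≤q ⟩
        q                     ∎
        where open ≤-Reasoning

      offsets : List ℕ
      offsets = filter (λ j → τ (q + j) ≤? 4 * h) (upTo N)

      -- By `∑τ` the average of τ is at most 2 h, so at most half of the window has τ > 4 h, and 2 M
      -- ≤ N.
      M≤offsets : M ≤ length offsets
      -- The Markov bound is doubled: its error 4 h N is then cancelled against the second copy of
      -- (4 h + 1) N.
      M≤offsets = *-cancelˡ-≤ 2 (≤-trans 2M≤N (*-cancelˡ-≤ (suc (4 * h)) (+-cancelʳ-≤ (4 * h * N) _ _ (begin
        suc (4 * h) * N + 4 * h * N            ≤⟨ +-monoʳ-≤ (suc (4 * h) * N) (m≤n+m (4 * h * N) N) ⟩
        suc (4 * h) * N + suc (4 * h) * N      ≡⟨ rearrange₁ h N ⟩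
        2 * (suc (4 * h) * N)                  ≤⟨ *-monoʳ-≤ 2 bound ⟩
        2 * (suc (4 * h) * g + h * (N + N))    ≡⟨ rearrange₂ h N g ⟩
        suc (4 * h) * (2 * g) + 4 * h * N      ∎))))
        where
        open ≤-Reasoning
        g = length offsets
        bound : suc (4 * h) * N ≤ suc (4 * h) * g + h * (N + N)
        bound = begin
          suc (4 * h) * N                      ≡⟨ cong (suc (4 * h) *_) (length-upTo N) ⟨
          suc (4 * h) * length (upTo N)        ≤⟨ markov (λ j → τ (q + j) ≤? 4 * h) (λ j → τ (q + j)) (4 * h) (λ _ → ≰⇒>) (upTo N) ⟩
          suc (4 * h) * g + sum (map (λ j → τ (q + j)) (upTo N))
                                               ≡⟨ cong (λ s → suc (4 * h) * g + sum s) (map-applyUpTo id (λ j → τ (q + j)) N) ⟩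
          suc (4 * h) * g + ∑ N (λ j → τ (q + j)) ≤⟨ +-monoʳ-≤ (suc (4 * h) * g) ∑τ ⟩
          suc (4 * h) * g + h * (N + N)        ∎
        rearrange₁ : ∀ h n → suc (4 * h) * n + suc (4 * h) * n ≡ 2 * (suc (4 * h) * n)
        rearrange₁ = solve-∀
        rearrange₂ : ∀ h n g → 2 * (suc (4 * h) * g + h * (n + n)) ≡ suc (4 * h) * (2 * g) + 4 * h * n
        rearrange₂ = solve-∀

      moduli : List ℕ
      moduli = map (q +_) (take M offsets)

      Modulus : ℕ → Set
      Modulus d = ∃ λ j → j < N × τ (q + j) ≤ 4 * h × d ≡ q + j

      ∈-moduli⁻ : ∀ {d} → d ∈ moduli → Modulus d
      ∈-moduli⁻ d∈ =
        let j , j∈ , d≡ = ∈-map⁻ (q +_) d∈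
            j∈upTo , τ≤ = ∈-filter⁻ (λ j → τ (q + j) ≤? 4 * h) {xs = upTo N} (∈-take⁻ M offsets j∈)
        in j , ∈-upTo⁻ j∈upTo , τ≤ , d≡

      instance
        q≢0 : NonZero q
        q≢0 = >-nonZero 0<q
        4q≢0 : NonZero (4 * q)
        4q≢0 = m*n≢0 4 q

      width : ℕ → ℕ
      width z = z / (4 * q)

      -- With w = `width z`, the cofactors are the integers from 8 + 4 w to 7 + 5 w. In q (8 + 4 w)
      -- = 4 q (w + 1) + 4 q the first term exceeds z despite the rounding in w, and the second
      -- provides the margin 2. Above, w ≥ 8 bounds a cofactor by 6 w, and (5 q / 4) · 6 w ≤ 8 q w ≤
      -- 2 z.
      base : ℕ → ℕ
      base z = 7 + 4 * width z

      size : ℕ → ℕ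
      size z = ⌊ width z /2⌋

      cofactors : ℕ → ℕ → List ℕ
      cofactors z d = filter (λ m → clash d m ≟ 0) (applyUpTo (λ i → suc (base z + i)) (width z))

      block : ℕ → ℕ → List ℕ
      block z d = map (d *_) (take (size z) (cofactors z d))

      Element : ℕ → ℕ → ℕ → Set
      Element z d a = ∃ λ i → i < width z × clash d (suc (base z + i)) ≡ 0 × a ≡ d * suc (base z + i)

      ∈-block⁻ : ∀ z {d a} → a ∈ block z d → Element z d a
      ∈-block⁻ z {d} a∈ =
        let m , m∈ , a≡ = ∈-map⁻ (d *_) a∈
            m∈range , clash≡0 = ∈-filter⁻ (λ m → clash d m ≟ 0)
              {xs = applyUpTo (λ i → suc (base z + i)) (width z)} (∈-take⁻ (size z) (cofactors z d) m∈)
            i , i<w , m≡ = ∈-applyUpTo⁻ (λ i → suc (base z + i)) m∈range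
        in i , i<w , trans (cong (clash d) (sym m≡)) clash≡0 , trans a≡ (cong (d *_) m≡)

      width≥8 : ∀ {z} → 32 * q ≤ z → 8 ≤ width z
      width≥8 {z} 32q≤z = ≤-trans (≤-reflexive (sym (m*n/n≡m 8 (4 * q))))
        (/-monoˡ-≤ (4 * q) (≤-trans (≤-reflexive (rearrange q)) 32q≤z))
        where
        rearrange : ∀ q → 8 * (4 * q) ≡ 32 * q
        rearrange = solve-∀

      z<4q[1+w] : ∀ z → z < 4 * q * suc (width z)
      z<4q[1+w] z = begin-strict
        z                                         ≡⟨ m≡m%n+[m/n]*n z (4 * q) ⟩
        z % (4 * q) + width z * (4 * q)           <⟨ +-monoˡ-< (width z * (4 * q)) (m%n<n z (4 * q)) ⟩
        4 * q + width z * (4 * q)                 ≡⟨ *-comm (suc (width z)) (4 * q) ⟩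
        4 * q * suc (width z)                     ∎
        where open ≤-Reasoning

      -- 12 = 4 · 3: z < 4 q (w + 1), and w ≥ 8 gives w + 1 ≤ 3 ⌊w/2⌋.
      size-bound : ∀ {z} → 32 * q ≤ z → z ≤ 12 * (q * size z)
      size-bound {z} 32q≤z = begin
        z                             ≤⟨ <⇒≤ (z<4q[1+w] z) ⟩
        4 * q * suc (width z)         ≤⟨ *-monoʳ-≤ (4 * q) w+1≤ ⟩
        4 * q * (3 * size z)          ≡⟨ rearrange q (size z) ⟩
        12 * (q * size z)             ∎
        where
        open ≤-Reasoning
        ceil≤ : ∀ n → ⌈ n /2⌉ ≤ suc ⌊ n /2⌋
        ceil≤ n = ⌊n/2⌋-mono (n≤1+n (suc n))
        w+1≤ : suc (width z) ≤ 3 * size z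
        w+1≤ = begin
          suc (width z)                             ≡⟨ cong suc (⌊n/2⌋+⌈n/2⌉≡n (width z)) ⟨
          suc (size z + ⌈ width z /2⌉)              ≤⟨ s≤s (+-monoʳ-≤ (size z) (ceil≤ (width z))) ⟩
          suc (size z + suc (size z))               ≡⟨ rearrange₁ (size z) ⟩
          2 * size z + 2                            ≤⟨ +-monoʳ-≤ (2 * size z) (≤-trans (m≤m+n 2 2) (⌊n/2⌋-mono (width≥8 32q≤z))) ⟩
          2 * size z + size z                       ≡⟨ rearrange₂ (size z) ⟩
          3 * size z                                ∎
          where
          rearrange₁ : ∀ s → suc (s + suc s) ≡ 2 * s + 2
          rearrange₁ = solve-∀
          rearrange₂ : ∀ s → 2 * s + s ≡ 3 * s
          rearrange₂ = solve-∀
        rearrange : ∀ q s → 4 * q * (3 * s) ≡ 12 * (q * s)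
        rearrange = solve-∀

      element-bounds : ∀ {z d a} → 32 * q ≤ z → Modulus d → Element z d a → 2 + z ≤ a × a ≤ 2 * z
      element-bounds {z} 32q≤z (j , j<N , _ , refl) (i , i<w , _ , refl) = lower , upper
        where
        open ≤-Reasoning
        w = width z
        m = suc (base z + i)
        lower : 2 + z ≤ (q + j) * m
        lower = begin
          2 + z                            ≤⟨ +-mono-≤ (≤-trans (m≤m+n 2 2) (*-monoʳ-≤ 4 0<q)) (<⇒≤ (z<4q[1+w] z)) ⟩
          4 * q + 4 * q * suc w            ≡⟨ rearrange q w ⟩
          q * (8 + 4 * w)                  ≤⟨ *-mono-≤ (m≤m+n q j) (m≤m+n (8 + 4 * w) i) ⟩
          (q + j) * m                      ∎
          where
          rearrange : ∀ q w → 4 * q + 4 * q * suc w ≡ q * (8 + 4 * w)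
          rearrange = solve-∀
        m≤ : m ≤ 6 * w
        m≤ = begin
          8 + 4 * w + i                    ≤⟨ +-mono-≤ (+-monoˡ-≤ (4 * w) (width≥8 32q≤z)) (<⇒≤ i<w) ⟩
          w + 4 * w + w                    ≡⟨ rearrange w ⟩
          6 * w                            ∎
          where
          rearrange : ∀ w → w + 4 * w + w ≡ 6 * w
          rearrange = solve-∀
        upper : (q + j) * m ≤ 2 * z
        upper = *-cancelˡ-≤ 4 (begin
          4 * ((q + j) * m)                ≤⟨ *-monoʳ-≤ 4 (*-monoʳ-≤ (q + j) m≤) ⟩
          4 * ((q + j) * (6 * w))          ≡⟨ rearrange₁ q j w ⟩
          (4 * q + 4 * j) * (6 * w)        ≤⟨ *-monoˡ-≤ (6 * w) (+-monoʳ-≤ (4 * q) (≤-trans (*-monoʳ-≤ 4 (<⇒≤ j<N)) 4N≤q)) ⟩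
          (4 * q + q) * (6 * w)            ≡⟨ rearrange₂ q w ⟩
          30 * (q * w)                     ≤⟨ *-monoˡ-≤ (q * w) (m≤m+n 30 2) ⟩
          32 * (q * w)                     ≡⟨ rearrange₃ q w ⟩
          8 * (w * (4 * q))                ≤⟨ *-monoʳ-≤ 8 (m/n*n≤m z (4 * q)) ⟩
          8 * z                            ≡⟨ *-assoc 4 2 z ⟩
          4 * (2 * z)                      ∎)
          where
          rearrange₁ : ∀ q j w → 4 * ((q + j) * (6 * w)) ≡ (4 * q + 4 * j) * (6 * w)
          rearrange₁ = solve-∀
          rearrange₂ : ∀ q w → (4 * q + q) * (6 * w) ≡ 30 * (q * w)
          rearrange₂ = solve-∀
          rearrange₃ : ∀ q w → 32 * (q * w) ≡ 8 * (w * (4 * q))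
          rearrange₃ = solve-∀

      -- The cofactors are among the m ≤ Y with Y ≤ 6 w, so `∑clash` with τ ≤ 4 h bounds twice their
      -- clashes by 96 N h w / q, which is at most w.
      few-clashes : ∀ {z j} → 32 * q ≤ z → τ (q + j) ≤ 4 * h →
        2 * ∑ (width z) (λ i → clash (q + j) (suc (base z + i))) ≤ width z
      few-clashes {z} {j} 32q≤z τ≤ = *-cancelˡ-≤ q (begin
        q * (2 * ∑ w (λ i → clash d (suc (base z + i))))   ≤⟨ *-monoʳ-≤ q (*-monoʳ-≤ 2 tail≤) ⟩
        q * (2 * S)                                         ≡⟨ rearrange₁ q S ⟩
        2 * (q * S)                                         ≤⟨ *-monoʳ-≤ 2 (∑clash d Y (≤-trans 0<q (m≤m+n q j))) ⟩
        2 * (τ d * (Y * (N + N)))                           ≤⟨ *-monoʳ-≤ 2 (*-mono-≤ τ≤ (*-monoˡ-≤ (N + N) Y≤)) ⟩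
        2 * (4 * h * (6 * w * (N + N)))                     ≡⟨ rearrange₂ h w N ⟩
        96 * (N * h) * w                                    ≤⟨ *-monoˡ-≤ w 96Nh≤q ⟩
        q * w                                               ∎)
        where
        open ≤-Reasoning
        d = q + j
        w = width z
        Y = base z + w
        S = ∑ Y (λ i → clash d (suc i))
        tail≤ : ∑ w (λ i → clash d (suc (base z + i))) ≤ S
        tail≤ = ≤-trans (m≤n+m _ _) (≤-reflexive (sym (∑-split (base z) w (λ i → clash d (suc i)))))
        Y≤ : Y ≤ 6 * w
        Y≤ = begin
          7 + 4 * w + w              ≤⟨ +-monoˡ-≤ w (+-monoˡ-≤ (4 * w) (≤-trans (n≤1+n 7) (width≥8 32q≤z))) ⟩
          w + 4 * w + w              ≡⟨ rearrange w ⟩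
          6 * w                      ∎
          where
          rearrange : ∀ w → w + 4 * w + w ≡ 6 * w
          rearrange = solve-∀
        rearrange₁ : ∀ q s → q * (2 * s) ≡ 2 * (q * s)
        rearrange₁ = solve-∀
        rearrange₂ : ∀ h w n → 2 * (4 * h * (6 * w * (n + n))) ≡ 96 * (n * h) * w
        rearrange₂ = solve-∀

      -- Every discarded cofactor has at least one clash, and the clashes number at most w / 2.
      size≤cofactors : ∀ {z d} → 32 * q ≤ z → Modulus d → size z ≤ length (cofactors z d)
      size≤cofactors {z} 32q≤z (j , _ , τ≤ , refl) = begin
        ⌊ w /2⌋                    ≤⟨ ⌊n/2⌋-mono w≤g+g ⟩
        ⌊ g + g /2⌋                ≡⟨ n≡⌊n+n/2⌋ g ⟨
        g                          ∎
        where
        open ≤-Reasoning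
        w = width z
        g = length (cofactors z (q + j))
        S = ∑ w (λ i → clash (q + j) (suc (base z + i)))
        xs = applyUpTo (λ i → suc (base z + i)) w
        w≤ : w ≤ g + S
        w≤ = begin
          w                        ≡⟨ length-applyUpTo (λ i → suc (base z + i)) w ⟨
          length xs                ≡⟨ *-identityˡ (length xs) ⟨
          1 * length xs            ≤⟨ markov (λ m → clash (q + j) m ≟ 0) (clash (q + j)) 0 (λ _ → n≢0⇒n>0) xs ⟩
          1 * g + sum (map (clash (q + j)) xs)
                                   ≡⟨ cong₂ _+_ (*-identityˡ g) (cong sum (map-applyUpTo (λ i → suc (base z + i)) (clash (q + j)) w)) ⟩
          g + S                    ∎
        w≤g+g : w ≤ g + g
        w≤g+g = +-cancelʳ-≤ w w (g + g) (begin
          w + w                    ≤⟨ +-mono-≤ w≤ w≤ ⟩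
          g + S + (g + S)          ≡⟨ rearrange g S ⟩
          g + g + 2 * S            ≤⟨ +-monoʳ-≤ (g + g) (few-clashes {z} {j} 32q≤z τ≤) ⟩
          g + g + w                ∎)
          where
          rearrange : ∀ g s → g + s + (g + s) ≡ g + g + 2 * s
          rearrange = solve-∀

      element-modulus : ∀ {z d d′ a} → Modulus d → Modulus d′ → Element z d a → Element z d′ a → d ≡ d′
      element-modulus (j , j<N , _ , refl) (j′ , j′<N , _ , refl) (i , _ , clash≡0 , refl) (i′ , _ , _ , eq)
        with j ≟ j′
      ... | yes refl = refl
      ... | no j≢j′ = ⊥-elim (<⇒≢ (collision j<N j′<N j≢j′ eq) (sym clash≡0))

      block-unique : ∀ z {d} → Modulus d → Unique (block z d)
      block-unique z {d} (j , _ , _ , refl) =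
        Unique.map⁺ (*-cancelˡ-≡ _ _ (q + j) {{>-nonZero (≤-trans 0<q (m≤m+n q j))}})
        (Unique.take⁺ (size z) (Unique.filter⁺ (λ m → clash d m ≟ 0)
          (Unique.applyUpTo⁺₁ (λ i → suc (base z + i)) (width z)
            (λ i<j _ → <⇒≢ (s<s (+-monoʳ-< (base z) i<j))))))

    progressions : Progressions M q
    progressions = record
      { moduli        = moduli
      ; moduli-unique = Unique.map⁺ (+-cancelˡ-≡ q _ _) (Unique.take⁺ M
                          (Unique.filter⁺ (λ j → τ (q + j) ≤? 4 * h) (Unique.upTo⁺ N)))
      ; moduli-length = trans (length-map (q +_) (take M offsets))
                          (trans (length-take M offsets) (m≤n⇒m⊓n≡m M≤offsets))
      ; moduli-≥      = λ d∈ → let j , _ , _ , d≡ = ∈-moduli⁻ d∈ in ≤-trans (m≤m+n q j) (≤-reflexive (sym d≡))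
      ; size          = size
      ; block         = block
      ; block-unique  = λ z d∈ → block-unique z (∈-moduli⁻ d∈)
      ; block-∣       = λ z {d} a∈ → let i , _ , _ , a≡ = ∈-block⁻ z a∈ in
                          divides (suc (base z + i)) (trans a≡ (*-comm d (suc (base z + i))))
      ; block-meet    = λ z d∈ d′∈ a∈ a∈′ → element-modulus {z} (∈-moduli⁻ d∈) (∈-moduli⁻ d′∈) (∈-block⁻ z a∈) (∈-block⁻ z a∈′)
      ; block-bounds  = λ {z} 32q≤z d∈ a∈ → element-bounds {z} 32q≤z (∈-moduli⁻ d∈) (∈-block⁻ z a∈)
      ; block-length  = λ {z} {d} 32q≤z d∈ → trans (length-map (d *_) (take (size z) (cofactors z d)))
                          (trans (length-take (size z) (cofactors z d)) (m≤n⇒m⊓n≡m (size≤cofactors {z} 32q≤z (∈-moduli⁻ d∈))))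
      ; size-bound    = size-bound
      }

-- Duplicate-free unions and Cartesian products of lists.

module FiniteSets where

  open import Data.Nat.Base
  open import Data.Nat.Properties
  open import Data.List.Base using (List; []; _∷_; length; map; concatMap)
  open import Data.List.Properties using (length-++; length-map)
  open import Data.List.Membership.Propositional using (_∈_; find; lose)
  open import Data.List.Membership.Propositional.Properties
  open import Data.List.Relation.Unary.Any using (here; there)
  open import Data.List.Relation.Unary.All as All using ([])
  open import Data.List.Relation.Unary.AllPairs using ([]; _∷_)
  open import Data.List.Relation.Unary.Unique.Propositional using (Unique)
  import Data.List.Relation.Unary.Unique.Propositional.Properties as Unique
  open import Data.Vec.Base using (Vec; []; _∷_; lookup)
  open import Data.Vec.Properties using (∷-injectiveˡ; ∷-injectiveʳ)
  open import Data.Fin.Base using (Fin; zero; suc)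
  open import Data.Product.Base using (∃; _×_; _,_)
  open import Function.Base using (_∘_)
  open import Relation.Binary.PropositionalEquality

  module _ {A B : Set} (f : A → List B) where

    concatMap-length : ∀ xs n → (∀ {x} → x ∈ xs → length (f x) ≡ n) → length (concatMap f xs) ≡ length xs * n
    concatMap-length []       n len = refl
    concatMap-length (x ∷ xs) n len = trans (length-++ (f x))
      (cong₂ _+_ (len (here refl)) (concatMap-length xs n (len ∘ there)))

    concatMap-unique : ∀ {xs} → Unique xs → (∀ {x} → x ∈ xs → Unique (f x)) →
      (∀ {x x′ y} → x ∈ xs → x′ ∈ xs → y ∈ f x → y ∈ f x′ → x ≡ x′) → Unique (concatMap f xs)
    concatMap-unique []                     unique meet = []
    concatMap-unique {x ∷ xs} (x∉xs ∷ xs!) unique meet = Unique.++⁺ (unique (here refl))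
      (concatMap-unique xs! (unique ∘ there) (λ x∈ x′∈ → meet (there x∈) (there x′∈)))
      λ (y∈ , y∈rest) → let x′ , x′∈ , y∈′ = find (∈-concatMap⁻ f {xs = xs} y∈rest) in
        All.lookup x∉xs x′∈ (meet (here refl) (there x′∈) y∈ y∈′)

    ∈-concatMap : ∀ {xs x y} → x ∈ xs → y ∈ f x → y ∈ concatMap f xs
    ∈-concatMap x∈ y∈ = ∈-concatMap⁺ f (lose x∈ y∈)

    ∈-concatMap-find : ∀ {xs y} → y ∈ concatMap f xs → ∃ λ x → x ∈ xs × y ∈ f x
    ∈-concatMap-find {xs} y∈ = find (∈-concatMap⁻ f {xs = xs} y∈)

  module _ {A : Set} where

    tuples : ∀ {k} → (Fin k → List A) → List (Vec A k)
    tuples {zero}  f = [] ∷ []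
    tuples {suc k} f = concatMap (λ x → map (x ∷_) (tuples (f ∘ suc))) (f zero)

    tuples-unique : ∀ {k} (f : Fin k → List A) → (∀ i → Unique (f i)) → Unique (tuples f)
    tuples-unique {zero}  f unique = [] ∷ []
    tuples-unique {suc k} f unique = concatMap-unique (λ x → map (x ∷_) (tuples (f ∘ suc))) (unique zero)
      (λ _ → Unique.map⁺ ∷-injectiveʳ (tuples-unique (f ∘ suc) (unique ∘ suc)))
      (λ {x} {x′} _ _ v∈ v∈′ →
        let _ , _ , v≡ = ∈-map⁻ (x ∷_) v∈
            _ , _ , v≡′ = ∈-map⁻ (x′ ∷_) v∈′
        in ∷-injectiveˡ (trans (sym v≡) v≡′))

    tuples-length : ∀ {k} (f : Fin k → List A) → length (tuples f) ≡ ∏ (length ∘ f)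
    tuples-length {zero}  f = refl
    tuples-length {suc k} f = concatMap-length (λ x → map (x ∷_) (tuples (f ∘ suc))) (f zero) _
      (λ {x} _ → trans (length-map (x ∷_) (tuples (f ∘ suc))) (tuples-length (f ∘ suc)))

    ∈-tuples⁻ : ∀ {k} (f : Fin k → List A) {v} → v ∈ tuples f → ∀ i → lookup v i ∈ f i
    ∈-tuples⁻ {suc k} f v∈ i with ∈-concatMap-find (λ x → map (x ∷_) (tuples (f ∘ suc))) {xs = f zero} v∈
    ... | x , x∈ , v∈map with ∈-map⁻ (x ∷_) v∈map
    ∈-tuples⁻ {suc k} f v∈ zero    | x , x∈ , _ | xs , xs∈ , refl = x∈
    ∈-tuples⁻ {suc k} f v∈ (suc i) | x , x∈ , _ | xs , xs∈ , refl = ∈-tuples⁻ (f ∘ suc) xs∈ i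

-- Extracting rational inequalities from Dedekind cuts.

module RationalBounds where

  open import Data.Nat.Base as ℕ using (ℕ; zero; suc)
  import Data.Nat.Properties as ℕ
  open import Data.Rational.Base hiding (_≥_; _>_)
  open import Data.Rational.Properties
  open import Algebra.Bundles using (CommutativeRing)
  open import Algebra.Definitions.RawSemiring +-*-rawSemiring using (_^_)
  open import Algebra.Properties.Semiring.Exp (CommutativeRing.semiring +-*-commutativeRing) using (^-assocʳ)
  open import Data.Fin.Base using (Fin; zero; suc)
  open import Data.Vec.Functional using (Vector)
  open import Data.Product.Base using (∃-syntax; _×_; _,_)
  open import Data.Sum.Base using (inj₁; inj₂; [_,_]′)
  open import Data.Empty using (⊥; ⊥-elim)
  open import Function.Base using (_∘_)
  open import Relation.Binary.PropositionalEquality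
  open ℚ-Lemmas hiding (p; q; r; a; b; c; d)
  open Cut-Lemmas

  <⇒≱ : ∀ {p q} → p < q → q ≤ p → ⊥
  <⇒≱ p<q q≤p = <-irrefl refl (<-≤-trans p<q q≤p)

  ι : ℕ → ℚ
  ι = fromℕℚ

  ι-+ : ∀ m n → ι (m ℕ.+ n) ≡ ι m + ι n
  ι-+ zero    n = sym (+-identityˡ (ι n))
  ι-+ (suc m) n = begin
    ι (suc (m ℕ.+ n))       ≡⟨ fromℕℚ-suc (m ℕ.+ n) ⟩
    1ℚ + ι (m ℕ.+ n)        ≡⟨ cong (1ℚ +_) (ι-+ m n) ⟩
    1ℚ + (ι m + ι n)        ≡⟨ +-assoc 1ℚ (ι m) (ι n) ⟨
    1ℚ + ι m + ι n          ≡⟨ cong (_+ ι n) (fromℕℚ-suc m) ⟨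
    ι (suc m) + ι n         ∎
    where open ≡-Reasoning

  ι-* : ∀ m n → ι (m ℕ.* n) ≡ ι m * ι n
  ι-* zero    n = sym (*-zeroˡ (ι n))
  ι-* (suc m) n = begin
    ι (n ℕ.+ m ℕ.* n)       ≡⟨ ι-+ n (m ℕ.* n) ⟩
    ι n + ι (m ℕ.* n)       ≡⟨ cong (ι n +_) (ι-* m n) ⟩
    ι n + ι m * ι n         ≡⟨ cong (_+ ι m * ι n) (*-identityˡ (ι n)) ⟨
    1ℚ * ι n + ι m * ι n    ≡⟨ *-distribʳ-+ (ι n) 1ℚ (ι m) ⟨
    (1ℚ + ι m) * ι n        ≡⟨ cong (_* ι n) (fromℕℚ-suc m) ⟨
    ι (suc m) * ι n         ∎
    where open ≡-Reasoning

  ι-^ : ∀ m n → ι (m ℕ.^ n) ≡ ι m ^ n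
  ι-^ m zero    = refl
  ι-^ m (suc n) = trans (ι-* m (m ℕ.^ n)) (cong (ι m *_) (ι-^ m n))

  ι-mono : ∀ {m n} → m ℕ.≤ n → ι m ≤ ι n
  ι-mono {m} {n} m≤n = ≤-by (ι (n ℕ.∸ m)) (0≤fromℕℚ (n ℕ.∸ m))
    (trans (cong ι (sym (ℕ.m+[n∸m]≡n m≤n))) (ι-+ m (n ℕ.∸ m)))

  ι-mono-< : ∀ {m n} → m ℕ.< n → ι m < ι n
  ι-mono-< {m} {n} m<n = <-≤-trans (<-by 1ℚ 0<1 (trans (fromℕℚ-suc m) (+-comm 1ℚ (ι m)))) (ι-mono m<n)

  ι-cancel-≤ : ∀ {m n} → ι m ≤ ι n → m ℕ.≤ n
  ι-cancel-≤ ιm≤ιn = ℕ.≮⇒≥ (λ n<m → <⇒≱ (ι-mono-< n<m) ιm≤ιn)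

  0≤ι : ∀ n → 0ℚ ≤ ι n
  0≤ι = 0≤fromℕℚ

  ^-cancel-≤ : ∀ {p q} n → 0ℚ ≤ q → p ^ suc n ≤ q ^ suc n → p ≤ q
  ^-cancel-≤ {p} {q} n 0≤q p^≤q^ = [ (λ p≤q → p≤q) , (λ q<p → ⊥-elim (<⇒≱ (^-mono-< n 0≤q q<p) p^≤q^)) ]′ (≤-or-> p q)

  ^-swap : ∀ p m n → (p ^ m) ^ n ≡ (p ^ n) ^ m
  ^-swap p m n = trans (^-assocʳ p m n) (trans (cong (p ^_) (ℕ.*-comm m n)) (sym (^-assocʳ p n m)))

  *-cancelʳ : ∀ {p q r} → 0ℚ < r → p * r ≤ q * r → p ≤ q
  *-cancelʳ {r = r} 0<r = *-cancelʳ-≤-pos r {{positive 0<r}}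

  -- Non-strict comparisons with a rational, which unlike L and U are closed
  -- conditions and hence need no room to spare under products.
  infix 4 _⊑_ _⊒_

  _⊑_ : ℚ → ℝ → Set
  a ⊑ x = ∀ u → U x u → a ≤ u

  _⊒_ : ℝ → ℚ → Set
  x ⊒ b = ∀ l → L x l → l ≤ b

  L⇒⊑ : ∀ x {a} → L x a → a ⊑ x
  L⇒⊑ x La u Uu = <⇒≤ (L<U x La Uu)

  U⇒⊒ : ∀ x {b} → U x b → x ⊒ b
  U⇒⊒ x Ub l Ll = <⇒≤ (L<U x Ll Ub)

  -- Opening the lower cut of x twice gives q < q′ < q″. Locating y between q and q′ yields either
  -- the goal or an upper bound q′ of y, and the latter contradicts the hypothesis at q″.
  ≤ʳ-intro : ∀ x y → (∀ {l u} → L x l → U y u → l ≤ u) → x ≤ʳ y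
  ≤ʳ-intro x y l≤u q Lq with ℝ.L-open x Lq
  ... | q′ , q<q′ , Lq′ with ℝ.L-open x Lq′
  ... | q″ , q′<q″ , Lq″ with ℝ.located y q<q′
  ... | inj₁ Lyq = Lyq
  ... | inj₂ Uyq′ = ⊥-elim (<⇒≱ q′<q″ (l≤u Lq″ Uyq′))

  -- The order is defined by lower cuts alone. An upper bound is carried along it by locating x
  -- between u and v, hence the gap.
  ≤ʳ⇒U : ∀ x y → x ≤ʳ y → ∀ {u v} → u < v → U y u → U x v
  ≤ʳ⇒U x y x≤y u<v Uyu with ℝ.located x u<v
  ... | inj₁ Lxu = ⊥-elim (ℝ.disjoint y (x≤y _ Lxu) Uyu)
  ... | inj₂ Uxv = Uxv

  ⊑-≤ʳ : ∀ x y {a} → a ⊑ x → x ≤ʳ y → a ⊑ y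
  ⊑-≤ʳ x y a⊑x x≤y u Uyu with ℝ.U-open y Uyu
  ... | v , v<u , Uyv = a⊑x u (≤ʳ⇒U x y x≤y v<u Uyv)

  ⊑⇒≤ʳ : ∀ x {a} → a ⊑ x → fromℚ a ≤ʳ x
  ⊑⇒≤ʳ x a⊑x = ≤ʳ-intro (fromℚ _) x (λ l<a Uu → ≤-trans (<⇒≤ l<a) (a⊑x _ Uu))

  ⊒⇒≤ʳ : ∀ x {b} → x ⊒ b → x ≤ʳ fromℚ b
  ⊒⇒≤ʳ x x⊒b = ≤ʳ-intro x (fromℚ _) (λ Ll b<u → ≤-trans (x⊒b _ Ll) (<⇒≤ b<u))

  ⊑-fromℚ : ∀ a → a ⊑ fromℚ a
  ⊑-fromℚ a u = <⇒≤

  ⊑-fromℕ : ∀ n → ι n ⊑ fromℕ n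
  ⊑-fromℕ n u = <⇒≤

  ⊒-fromℚ : ∀ b → fromℚ b ⊒ b
  ⊒-fromℚ b l = <⇒≤

  ⊒-fromℕ : ∀ n → fromℕ n ⊒ ι n
  ⊒-fromℕ n l = <⇒≤

  common-L : ∀ x {a b} → L x a → L x b → ∃[ s ] L x s × a ≤ s × b ≤ s
  common-L x {a} {b} La Lb with ≤-total a b
  ... | inj₁ a≤b = b , Lb , a≤b , ≤-refl
  ... | inj₂ b≤a = a , La , ≤-refl , b≤a

  *-U⁻ : ∀ x y {q} → U (x *ʳ y) q → ∃[ b ] ∃[ d ] U x b × U y d × b * d < q
  *-U⁻ x y (r , r<q , box La Ub Lc Ud , _ , (_ , bd≤r)) = _ , _ , Ub , Ud , ≤-<-trans bd≤r r<q

  -- The lower corners of the box may be nonpositive. Raising them to positive members of the lower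
  -- cuts stays inside the box, where every product is at least the least corner product.
  *-L⁻ : ∀ (x y : ℝ⁺) {q} → L (↑ x *ʳ ↑ y) q →
    ∃[ a ] ∃[ c ] 0ℚ < a × L (↑ x) a × 0ℚ < c × L (↑ y) c × q < a * c
  *-L⁻ x y (r , q<r , box {a} {b} {c} {d} La Ub Lc Ud , (ac , ad) , (bc , bd)) =
    let a₀ , 0<a₀ , La₀ = Positive-Lemmas.positive-L x
        c₀ , 0<c₀ , Lc₀ = Positive-Lemmas.positive-L y
        s , Ls , a≤s , a₀≤s = common-L (↑ x) La La₀
        t , Lt , c≤t , c₀≤t = common-L (↑ y) Lc Lc₀
    in s , t , <-≤-trans 0<a₀ a₀≤s , Ls , <-≤-trans 0<c₀ c₀≤t , Lt ,
       <-≤-trans q<r (between-lower {a} {b} {c} {d} {r} {s} {t} a≤s (<⇒≤ (L<U (↑ x) Ls Ub)) c≤t (<⇒≤ (L<U (↑ y) Lt Ud)) ac ad bc bd)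

  *-⊑ : ∀ x y {a c} → 0ℚ ≤ a → 0ℚ ≤ c → a ⊑ x → c ⊑ y → a * c ⊑ x *ʳ y
  *-⊑ x y 0≤a 0≤c a⊑x c⊑y u U* with *-U⁻ x y U*
  ... | b , d , Ub , Ud , bd<u = ≤-trans
    (*-mono 0≤a (≤-trans 0≤c (c⊑y d Ud)) (a⊑x b Ub) (c⊑y d Ud)) (<⇒≤ bd<u)

  *-⊒ : ∀ (x y : ℝ⁺) {b d} → ↑ x ⊒ b → ↑ y ⊒ d → ↑ (x *⁺ y) ⊒ b * d
  *-⊒ x y x⊒b y⊒d l L* with *-L⁻ x y L*
  ... | a , c , 0<a , La , 0<c , Lc , l<ac = ≤-trans (<⇒≤ l<ac)
    (*-mono (<⇒≤ 0<a) (≤-trans (<⇒≤ 0<c) (y⊒d c Lc)) (x⊒b a La) (y⊒d c Lc))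

  ∏-⊑ : ∀ {n} (X : Vector ℝ⁺ n) (z : Vector ℕ n) → (∀ i → ι (z i) ⊑ ↑ X i) → ι (∏ z) ⊑ ↑ ∏⁺ X
  ∏-⊑ {zero}  X z z⊑X = ⊑-fromℕ 1
  ∏-⊑ {suc n} X z z⊑X = subst (_⊑ ↑ ∏⁺ X) (sym (ι-* (z zero) (∏ (z ∘ suc))))
    (*-⊑ (↑ X zero) (↑ ∏⁺ (X ∘ suc)) (0≤ι (z zero)) (0≤ι (∏ (z ∘ suc)))
      (z⊑X zero) (∏-⊑ (X ∘ suc) (z ∘ suc) (z⊑X ∘ suc)))

  ∏-⊒ : ∀ {n} (X : Vector ℝ⁺ n) (z : Vector ℕ n) → (∀ i → ↑ X i ⊒ ι (z i)) → ↑ ∏⁺ X ⊒ ι (∏ z)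
  ∏-⊒ {zero}  X z X⊒z = ⊒-fromℚ (ι 1)
  ∏-⊒ {suc n} X z X⊒z = subst (↑ ∏⁺ X ⊒_) (sym (ι-* (z zero) (∏ (z ∘ suc))))
    (*-⊒ (X zero) (∏⁺ (X ∘ suc)) (X⊒z zero) (∏-⊒ (X ∘ suc) (z ∘ suc) (X⊒z ∘ suc)))

  ^ℕ-⊑ : ∀ x n {a} → 0ℚ ≤ a → a ⊑ ↑ x → a ^ n ⊑ ↑ (x ^ℕ n)
  ^ℕ-⊑ x zero    0≤a a⊑x = ⊑-fromℚ 1ℚ
  ^ℕ-⊑ x (suc n) 0≤a a⊑x = *-⊑ (↑ x) (↑ (x ^ℕ n)) 0≤a (^-≥0 n 0≤a) a⊑x (^ℕ-⊑ x n 0≤a a⊑x)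

  ^ℕ-⊒ : ∀ x n {b} → ↑ x ⊒ b → ↑ (x ^ℕ n) ⊒ b ^ n
  ^ℕ-⊒ x zero    x⊒b = ⊒-fromℚ 1ℚ
  ^ℕ-⊒ x (suc n) x⊒b = *-⊒ x (x ^ℕ n) x⊒b (^ℕ-⊒ x n x⊒b)

  ⁻¹-L⁻ : ∀ x {q} → L (↑ (x ⁻¹)) q → ∃[ u ] U (↑ x) u × q * u ≤ 1ℚ
  ⁻¹-L⁻ x (r , q<r , u , Uu , ru≤1) = u , Uu ,
    ≤-trans (*-monoʳ (<⇒≤ (Positive-Lemmas.0<U x Uu)) (<⇒≤ q<r)) ru≤1

  ⁻¹-U⁻ : ∀ x {q} → U (↑ (x ⁻¹)) q → ∃[ l ] 0ℚ < l × L (↑ x) l × 1ℚ ≤ q * l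
  ⁻¹-U⁻ x (r , r<q , l , 0<l , Ll , 1≤rl) = l , 0<l , Ll ,
    ≤-trans 1≤rl (*-monoʳ (<⇒≤ 0<l) (<⇒≤ r<q))

  root-L⁻ : ∀ n x {q} → 0ℚ < q → L (↑ (root (suc n) x)) q → L (↑ x) (q ^ suc n)
  root-L⁻ n x 0<q (r , q<r , inj₁ r<0) = ⊥-elim (<-asym (<-trans 0<q q<r) r<0)
  root-L⁻ n x 0<q (r , q<r , inj₂ (_ , Lr)) = L-closed-≤ (↑ x) (<⇒≤ (^-mono-< n (<⇒≤ 0<q) q<r)) Lr

  root-U⁻ : ∀ n x {q} → U (↑ (root (suc n) x)) q → 0ℚ < q × U (↑ x) (q ^ suc n)
  root-U⁻ n x (r , r<q , 0≤r , Ur) = ≤-<-trans 0≤r r<q ,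
    U-closed-≤ (↑ x) (<⇒≤ (^-mono-< n 0≤r r<q)) Ur

  -- A constructive substitute for the floor. Locatedness at 1 + n < 2 + n either lets the search
  -- advance or certifies the upper bound; deciding between them needs this gap, so x is enclosed
  -- with width 2, not 1.
  nat-approx : ∀ x fuel n → L (↑ x) (ι n) → U (↑ x) (ι (fuel ℕ.+ n)) →
    ∃[ m ] L (↑ x) (ι m) × U (↑ x) (ι (2 ℕ.+ m))
  nat-approx x zero       n Ln Un = ⊥-elim (ℝ.disjoint (↑ x) Ln Un)
  nat-approx x (suc fuel) n Ln Un =
    [ (λ L1+n → nat-approx x fuel (suc n) L1+n (subst (U (↑ x) ∘ ι) (sym (ℕ.+-suc fuel n)) Un))
    , (λ U2+n → n , Ln , U2+n)
    ]′ (ℝ.located (↑ x) {ι (1 ℕ.+ n)} {ι (2 ℕ.+ n)} (ι-mono-< (ℕ.n<1+n (suc n))))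

  abstract

    natural-part : ∀ x → ∃[ n ] L (↑ x) (ι n) × U (↑ x) (ι (2 ℕ.+ n))
    natural-part x with ℝ.U-inhabited (↑ x)
    ... | u , Uu with archimedean u
    ... | n , u<n = nat-approx x (suc n) 0 (ℝ⁺.0<↑ x)
      (subst (U (↑ x) ∘ ι) (sym (ℕ.+-identityʳ (suc n))) (U-closed-≤ (↑ x) (<⇒≤ u<n) Uu))

-- Logarithms, reciprocals and minima: the hypotheses on Q as inequalities of naturals.

module Constants where

  open import Data.Nat.Base as ℕ using (ℕ; zero; suc)
  import Data.Nat.Properties as ℕ
  open import Data.Integer.Base as ℤ using (ℤ)
  open import Data.Rational.Base hiding (_≥_; _>_)
  open import Data.Rational.Properties
  open import Data.Rational.Solver using (module +-*-Solver)
  open +-*-Solver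
  open import Algebra.Bundles using (CommutativeRing)
  open import Algebra.Definitions.RawSemiring +-*-rawSemiring using (_^_)
  open import Algebra.Properties.CommutativeSemiring.Exp
    (CommutativeRing.commutativeSemiring +-*-commutativeRing) using (^-distrib-*)
  open import Data.Fin.Base using (Fin; zero; suc)
  open import Data.Vec.Functional using (Vector; foldr)
  open import Data.Product.Base using (_×_; _,_; proj₁; proj₂)
  open import Function.Base using (_∘_)
  open import Relation.Nullary.Decidable using (from-yes)
  open import Relation.Binary.PropositionalEquality
  open ℚ-Lemmas hiding (p; q; r; a; b; c; d)
  open Cut-Lemmas
  open RationalBounds

  ^1-L⁻ : ∀ x {q} → L (↑ (x ^ℕ 1)) q → L (↑ x) q
  ^1-L⁻ x L* with *-L⁻ x 1⁺ L*
  ... | a , c , 0<a , La , _ , c<1 , q<ac = L-closed-≤ (↑ x)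
    (<⇒≤ (<-≤-trans q<ac (≤-trans (*-monoˡ (<⇒≤ 0<a) (<⇒≤ c<1)) (≤-reflexive (*-identityʳ a))))) La

  ^1-U⁻ : ∀ x {q} → U (↑ (x ^ℕ 1)) q → U (↑ x) q
  ^1-U⁻ x U* with *-U⁻ (↑ x) (↑ 1⁺) U*
  ... | b , d , Ub , 1<d , bd<q = U-closed-≤ (↑ x)
    (≤-trans (≤-reflexive (sym (*-identityʳ b)))
      (≤-trans (*-monoˡ (<⇒≤ (Positive-Lemmas.0<U x Ub)) (<⇒≤ 1<d)) (<⇒≤ bd<q))) Ub

  2M-⊑ : ∀ M .{{_ : ℕ.NonZero M}} → ι (2 ℕ.* M) ⊑ ↑ (fromℕ⁺ 2 *⁺ fromℕ⁺ M)
  2M-⊑ M u Uu = ≤-trans (≤-reflexive (ι-* 2 M))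
    (*-⊑ (fromℕ 2) (fromℕ M) {ι 2} {ι M} (0≤ι 2) (0≤ι M) (⊑-fromℕ 2) (⊑-fromℕ M) u Uu)

  reciprocal-L : ∀ n .{{_ : ℕ.NonZero n}} {a} → 0ℚ < a → L (↑ (fromℕ⁺ n ⁻¹)) a → a * ι n ≤ 1ℚ
  reciprocal-L n 0<a La with ⁻¹-L⁻ (fromℕ⁺ n) La
  ... | u , n<u , au≤1 = ≤-trans (*-monoˡ (<⇒≤ 0<a) (<⇒≤ n<u)) au≤1

  reciprocal-U : ∀ n .{{_ : ℕ.NonZero n}} {b} → U (↑ (fromℕ⁺ n ⁻¹)) b → 1ℚ ≤ b * ι n
  reciprocal-U n Ub with ⁻¹-U⁻ (fromℕ⁺ n) Ub
  ... | l , 0<l , l<n , 1≤bl = ≤-trans 1≤bl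
    (*-monoˡ (<⇒≤ (Positive-Lemmas.0<U (fromℕ⁺ n ⁻¹) Ub)) (<⇒≤ l<n))

  -- (1 - 1/4)^(-1) < 2 bounds e^(1/4) by 2.
  log-lower : ∀ x n → ι (2 ℕ.^ suc n) ⊑ ↑ x → ι (suc n) * (½ * ½) ⊑ log x
  log-lower x n 2^n⊑x u (r , r<u , m , b , Ub , 0<Q , b≤Q) = ≤-trans
    (Log-Lemmas.log-consistent {4/3 ^ suc n} {b} p r m n a<b
      (subst (λ t → 0ℚ < 1ℚ - t) (sym p/n) (from-yes (0ℚ <? 1ℚ - ½ * ½)))
      (≤-reflexive (sym (trans (cong (λ t → 4/3 ^ suc n * (1ℚ - t) ^ suc n) p/n)
        (trans (sym (^-distrib-* 4/3 (1ℚ - ½ * ½) (suc n))) (1^ (suc n)))))) 0<Q b≤Q)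
    (<⇒≤ r<u)
    where
    4/3 p : ℚ
    4/3 = ℤ.+ 4 / 3
    p = ι (suc n) * (½ * ½)
    p/n : p * (ℤ.+ 1 / suc n) ≡ ½ * ½
    p/n = trans (swap (ι (suc n)) (½ * ½) (ℤ.+ 1 / suc n))
      (trans (cong (_* (½ * ½)) (suc*1/suc n)) (*-identityˡ (½ * ½)))
      where
      swap : ∀ a b c → a * b * c ≡ a * c * b
      swap = solve 3 (λ a b c → a :* b :* c := a :* c :* b) refl
    a<b : 4/3 ^ suc n < b
    a<b = <-≤-trans (^-mono-< n (from-yes (0ℚ ≤? 4/3)) (from-yes (4/3 <? ι 2)))
      (≤-trans (≤-reflexive (sym (ι-^ 2 (suc n)))) (2^n⊑x b Ub))

  *-*-⊑ : ∀ x y z w {a b c} → 0ℚ ≤ a → 0ℚ ≤ b → 0ℚ ≤ c → a ⊑ x → b ⊑ y → c ⊑ z →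
    x *ʳ y *ʳ z ≤ʳ w → a * b * c ⊑ w
  *-*-⊑ x y z w {a} {b} {c} 0≤a 0≤b 0≤c a⊑x b⊑y c⊑z xyz≤w = ⊑-≤ʳ (x *ʳ y *ʳ z) w
    (*-⊑ (x *ʳ y) z (0≤* 0≤a 0≤b) 0≤c (*-⊑ x y 0≤a 0≤b a⊑x b⊑y) c⊑z) xyz≤w

  -- The factor 4 comes from the lower bound (n + 1)/4 for the logarithm of 2^(n+1).
  size-condition : ∀ x y z w {K M n q} → ι K ⊑ x → ι M ⊑ y → ι (2 ℕ.^ suc n) ⊑ ↑ z →
    x *ʳ y *ʳ log z ≤ʳ w → U w (ι q) → K ℕ.* (M ℕ.* suc n) ℕ.≤ 4 ℕ.* q
  size-condition x y z w {K} {M} {n} {q} K⊑x M⊑y 2^n⊑z xylog≤w Uq = ι-cancel-≤ (begin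
    ι (K ℕ.* (M ℕ.* suc n))                           ≡⟨ trans (ι-* K (M ℕ.* suc n)) (cong (ι K *_) (ι-* M (suc n))) ⟩
    ι K * (ι M * ι (suc n))                           ≡⟨ rearrange (ι K) (ι M) (ι (suc n)) ⟩
    ι 4 * (ι K * ι M * (ι (suc n) * (½ * ½)))         ≤⟨ *-monoˡ (0≤ι 4) product≤q ⟩
    ι 4 * ι q                                         ≡⟨ ι-* 4 q ⟨
    ι (4 ℕ.* q)                                       ∎)
    where
    open ≤-Reasoning
    rearrange : ∀ k m n → k * (m * n) ≡ ι 4 * (k * m * (n * (½ * ½)))
    rearrange = solve 3 (λ k m n → k :* (m :* n) := con (ι 4) :* (k :* m :* (n :* (con ½ :* con ½)))) refl
    product≤q : ι K * ι M * (ι (suc n) * (½ * ½)) ≤ ι q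
    product≤q = *-*-⊑ x y (log z) w {ι K} {ι M} {ι (suc n) * (½ * ½)}
      (0≤ι K) (0≤ι M) (0≤* {ι (suc n)} {½ * ½} (0≤ι (suc n)) (from-yes (0ℚ ≤? ½ * ½)))
      K⊑x M⊑y (log-lower z n 2^n⊑z) xylog≤w (ι q) Uq

  ⊓-L⁻ : ∀ {n} x (X : Vector ℝ⁺ n) {b} → L (↑ foldr _⊓⁺_ x X) b → L (↑ x) b × (∀ i → L (↑ X i) b)
  ⊓-L⁻ {zero}  x X Lb = Lb , λ ()
  ⊓-L⁻ {suc n} x X (LX₀ , Lb) =
    let Lx , LX = ⊓-L⁻ x (X ∘ suc) Lb
    in Lx , λ { zero → LX₀ ; (suc i) → LX i }

  minimum-L⁻ : ∀ {n} (X : Vector ℝ⁺ (suc n)) {b} → L (↑ minimum X) b → ∀ i → L (↑ X i) b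
  minimum-L⁻ X Lb zero    = proj₁ (⊓-L⁻ (X zero) (X ∘ suc) Lb)
  minimum-L⁻ X Lb (suc i) = proj₂ (⊓-L⁻ (X zero) (X ∘ suc) Lb) i

  range-condition : ∀ (κ μ : ℝ⁺) Q {c q z} → (∀ {a} → 0ℚ < a → L (↑ κ) a → a * ι c ≤ 1ℚ) → ↑ μ ⊒ ι z →
    Q ≤ʳ ↑ (κ *⁺ μ) → L Q (ι q) → c ℕ.* q ℕ.≤ z
  range-condition κ μ Q {c} {q} {z} κ≤1/c μ⊒z Q≤κμ Lq =
    let a , b , 0<a , La , 0<b , Lb , q<ab = *-L⁻ κ μ (Q≤κμ (ι q) Lq)
    in bound a b (<⇒≤ 0<b) (<⇒≤ q<ab) (κ≤1/c 0<a La) (μ⊒z b Lb)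
    where
    open ≤-Reasoning
    rearrange : ∀ c a b → c * (a * b) ≡ a * c * b
    rearrange = solve 3 (λ c a b → c :* (a :* b) := a :* c :* b) refl
    bound : ∀ a b → 0ℚ ≤ b → ι q ≤ a * b → a * ι c ≤ 1ℚ → b ≤ ι z → c ℕ.* q ℕ.≤ z
    bound a b 0≤b q≤ab ac≤1 b≤z = ι-cancel-≤ (begin
      ι (c ℕ.* q)         ≡⟨ ι-* c q ⟩
      ι c * ι q           ≤⟨ *-monoˡ {ι c} {ι q} {a * b} (0≤ι c) q≤ab ⟩
      ι c * (a * b)       ≡⟨ rearrange (ι c) a b ⟩
      a * ι c * b         ≤⟨ *-monoʳ {b} {a * ι c} {1ℚ} 0≤b ac≤1 ⟩
      1ℚ * b              ≡⟨ *-identityˡ b ⟩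
      b                   ≤⟨ b≤z ⟩
      ι z                 ∎)

-- Fractional powers as polynomial inequalities.

module Powers where

  open import Data.Nat.Base as ℕ using (ℕ; zero; suc)
  import Data.Nat.Properties as ℕ
  open import Data.Integer.Base as ℤ using (ℤ)
  open import Data.Rational.Base hiding (_≥_; _>_)
  open import Data.Rational.Properties
  open import Data.Rational.Solver using (module +-*-Solver)
  open +-*-Solver
  open import Algebra.Bundles using (CommutativeRing)
  open import Algebra.Definitions.RawSemiring +-*-rawSemiring using (_^_)
  open import Algebra.Properties.CommutativeSemiring.Exp
    (CommutativeRing.commutativeSemiring +-*-commutativeRing) using (^-distrib-*)
  open import Data.Product.Base using (∃-syntax; _×_; _,_)
  open import Relation.Binary.PropositionalEquality
  open ℚ-Lemmas hiding (p; q; r; a; b; c; d)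
  open Cut-Lemmas
  open RationalBounds
  open Constants

  module _ (m : ℕ) where

    private
      n k : ℕ
      n = suc m
      k = suc n

    -- This and the following lemmas read a cut of a fractional power as an inequality between n-th
    -- powers of rationals, with n = k - 1. The witnesses u and l are rational bounds for the real
    -- under the root.
    inverse-root-L : ∀ δ {e} → 0ℚ < e → L (↑ (δ ^[ ℤ.- ℤ.+ 1 / n ])) e → ∃[ u ] U (↑ δ) u × e ^ n * u ≤ 1ℚ
    inverse-root-L δ 0<e Le = let u , Uu , e^nu≤1 = ⁻¹-L⁻ (δ ^ℕ 1) (root-L⁻ m ((δ ^ℕ 1) ⁻¹) 0<e Le) in
      u , ^1-U⁻ δ Uu , e^nu≤1

    inverse-root-U : ∀ δ {d} → U (↑ (δ ^[ ℤ.- ℤ.+ 1 / n ])) d →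
      0ℚ < d × ∃[ l ] 0ℚ < l × L (↑ δ) l × 1ℚ ≤ d ^ n * l
    inverse-root-U δ Ud =
      let 0<d , Ud^n = root-U⁻ m ((δ ^ℕ 1) ⁻¹) Ud
          l , 0<l , Ll , 1≤d^nl = ⁻¹-U⁻ (δ ^ℕ 1) Ud^n
      in 0<d , l , 0<l , ^1-L⁻ δ Ll , 1≤d^nl

    quotient-root-L : ∀ P Λ {p d} → ↑ P ⊒ p → 0ℚ < d → L (↑ ((P /⁺ Λ) ^[ ℤ.+ 1 / n ])) d →
      ∃[ u ] U (↑ Λ) u × d ^ n * u ≤ p
    quotient-root-L P Λ {p} {d} P⊒p 0<d Ld =
      let s , w , 0<s , Ls , 0<w , Lw , d^n<sw = *-L⁻ P (Λ ⁻¹) (^1-L⁻ (P /⁺ Λ) (root-L⁻ m ((P /⁺ Λ) ^ℕ 1) 0<d Ld))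
          u , Uu , wu≤1 = ⁻¹-L⁻ Λ Lw
      in u , Uu , bound s w u (<⇒≤ 0<s) (<⇒≤ (Positive-Lemmas.0<U Λ Uu)) (P⊒p s Ls) (<⇒≤ d^n<sw) wu≤1
      where
      bound : ∀ s w u → 0ℚ ≤ s → 0ℚ ≤ u → s ≤ p → d ^ n ≤ s * w → w * u ≤ 1ℚ → d ^ n * u ≤ p
      bound s w u 0≤s 0≤u s≤p d^n≤sw wu≤1 = begin
        d ^ n * u         ≤⟨ *-monoʳ 0≤u d^n≤sw ⟩
        s * w * u         ≡⟨ *-assoc s w u ⟩
        s * (w * u)       ≤⟨ *-monoˡ 0≤s wu≤1 ⟩
        s * 1ℚ            ≡⟨ *-identityʳ s ⟩
        s                 ≤⟨ s≤p ⟩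
        p                 ∎
        where open ≤-Reasoning

    quotient-root-U : ∀ P Λ {p d} → p ⊑ ↑ P → U (↑ ((P /⁺ Λ) ^[ ℤ.+ 1 / n ])) d →
      0ℚ < d × ∃[ l ] 0ℚ < l × L (↑ Λ) l × p ≤ d ^ n * l
    quotient-root-U P Λ {p} {d} p⊑P Ud =
      let 0<d , Ud^n = root-U⁻ m ((P /⁺ Λ) ^ℕ 1) Ud
          s , v , Us , Uv , sv<d^n = *-U⁻ (↑ P) (↑ (Λ ⁻¹)) (^1-U⁻ (P /⁺ Λ) Ud^n)
          l , 0<l , Ll , 1≤vl = ⁻¹-U⁻ Λ Uv
      in 0<d , l , 0<l , Ll , bound s v l (<⇒≤ (Positive-Lemmas.0<U P Us)) (<⇒≤ 0<l) (p⊑P s Us) (<⇒≤ sv<d^n) 1≤vl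
      where
      bound : ∀ s v l → 0ℚ ≤ s → 0ℚ ≤ l → p ≤ s → s * v ≤ d ^ n → 1ℚ ≤ v * l → p ≤ d ^ n * l
      bound s v l 0≤s 0≤l p≤s sv≤d^n 1≤vl = begin
        p                 ≤⟨ p≤s ⟩
        s                 ≡⟨ *-identityʳ s ⟨
        s * 1ℚ            ≤⟨ *-monoˡ 0≤s 1≤vl ⟩
        s * (v * l)       ≡⟨ *-assoc s v l ⟨
        s * v * l         ≤⟨ *-monoʳ 0≤l sv≤d^n ⟩
        d ^ n * l         ∎
        where open ≤-Reasoning

    power-root-L : ∀ Λ {f u} → U (↑ Λ) u → 0ℚ < f → L (↑ (Λ ^[ ℤ.+ k / n ])) f → f ^ n ≤ u ^ k
    power-root-L Λ {f} Uu 0<f Lf = ^ℕ-⊒ Λ k (U⇒⊒ (↑ Λ) Uu) (f ^ n) (root-L⁻ m (Λ ^ℕ k) 0<f Lf)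

    root-inverse-L : ∀ P {p g} → p ⊑ ↑ P → 0ℚ < g → L (↑ ((P ^[ ℤ.+ 1 / n ]) ⁻¹)) g → g ^ n * p ≤ 1ℚ
    root-inverse-L P {p} {g} p⊑P 0<g Lg =
      let v , Uv , gv≤1 = ⁻¹-L⁻ (P ^[ ℤ.+ 1 / n ]) Lg
          0<v , Uv^n = root-U⁻ m (P ^ℕ 1) Uv
      in bound v (<⇒≤ 0<v) (p⊑P (v ^ n) (^1-U⁻ P Uv^n)) gv≤1
      where
      bound : ∀ v → 0ℚ ≤ v → p ≤ v ^ n → g * v ≤ 1ℚ → g ^ n * p ≤ 1ℚ
      bound v 0≤v p≤v^n gv≤1 = begin
        g ^ n * p         ≤⟨ *-monoˡ (^-≥0 n (<⇒≤ 0<g)) p≤v^n ⟩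
        g ^ n * v ^ n     ≡⟨ ^-distrib-* g v n ⟨
        (g * v) ^ n       ≤⟨ ^-≤1 n (0≤* (<⇒≤ 0<g) 0≤v) gv≤1 ⟩
        1ℚ                ∎
        where open ≤-Reasoning

    -- b is an upper estimate of δ^(-1/n) and e a lower one of δ^(-k/n). Multiplying e^n by (b^n
    -- l)^k, which is at least 1, and using e^n l^k ≤ 1 gives e^n ≤ (b^k)^n.
    inverse-power-root-L : ∀ δ {e l b} → 0ℚ < l → L (↑ δ) l → 0ℚ ≤ b → 1ℚ ≤ b ^ n * l →
      0ℚ < e → L (↑ (δ ^[ ℤ.- ℤ.+ k / n ])) e → e ≤ b ^ k
    inverse-power-root-L δ {e} {l} {b} 0<l Ll 0≤b 1≤b^nl 0<e Le =
      let u , Uu , e^nu≤1 = ⁻¹-L⁻ (δ ^ℕ k) (root-L⁻ m ((δ ^ℕ k) ⁻¹) 0<e Le)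
      in bound u (^ℕ-⊑ δ k (<⇒≤ 0<l) (L⇒⊑ (↑ δ) Ll) u Uu) e^nu≤1
      where
      0≤e^n : 0ℚ ≤ e ^ n
      0≤e^n = ^-≥0 n (<⇒≤ 0<e)
      rearrange : ∀ e b l → e * (b * l) ≡ b * (e * l)
      rearrange = solve 3 (λ e b l → e :* (b :* l) := b :* (e :* l)) refl
      bound : ∀ u → l ^ k ≤ u → e ^ n * u ≤ 1ℚ → e ≤ b ^ k
      bound u l^k≤u e^nu≤1 = ^-cancel-≤ m (^-≥0 k 0≤b) (begin
        e ^ n                           ≡⟨ *-identityʳ (e ^ n) ⟨
        e ^ n * 1ℚ                      ≡⟨ cong (e ^ n *_) (1^ k) ⟨
        e ^ n * 1ℚ ^ k                  ≤⟨ *-monoˡ 0≤e^n (^-mono-≤ k 0≤1 1≤b^nl) ⟩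
        e ^ n * (b ^ n * l) ^ k         ≡⟨ cong (e ^ n *_) (^-distrib-* (b ^ n) l k) ⟩
        e ^ n * ((b ^ n) ^ k * l ^ k)   ≡⟨ rearrange (e ^ n) ((b ^ n) ^ k) (l ^ k) ⟩
        (b ^ n) ^ k * (e ^ n * l ^ k)   ≤⟨ *-monoˡ (^-≥0 k (^-≥0 n 0≤b)) (≤-trans (*-monoˡ 0≤e^n l^k≤u) e^nu≤1) ⟩
        (b ^ n) ^ k * 1ℚ                ≡⟨ *-identityʳ ((b ^ n) ^ k) ⟩
        (b ^ n) ^ k                     ≡⟨ ^-swap b n k ⟩
        (b ^ k) ^ n                     ∎)
        where open ≤-Reasoning

    -- Here C Y plays the part of Q. The predicate `A` will be the lower cut of `Λ`, and in
    -- `scale-lower` the upper cut.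
    scale-upper : ∀ (C Y : ℝ⁺) {A : ℚ → Set} {c p q} → 0ℚ ≤ c → 0ℚ ≤ q → c ⊑ ↑ C →
      (∀ {d} → U (↑ Y) d → 0ℚ < d × ∃[ l ] 0ℚ < l × A l × p ≤ d ^ n * l) →
      U (↑ (C *⁺ Y)) q → ∃[ l ] A l × c ^ n * p ≤ q ^ n * l
    scale-upper C Y {A} {c} {p} {q} 0≤c 0≤q c⊑C Y-U Uq =
      let b , d , Ub , Ud , bd<q = *-U⁻ (↑ C) (↑ Y) Uq
          0<d , l , 0<l , Al , p≤d^nl = Y-U Ud
      in l , Al , bound b d l (c⊑C b Ub) (<⇒≤ 0<d) (<⇒≤ 0<l) (<⇒≤ bd<q) p≤d^nl
      where
      bound : ∀ b d l → c ≤ b → 0ℚ ≤ d → 0ℚ ≤ l → b * d ≤ q → p ≤ d ^ n * l → c ^ n * p ≤ q ^ n * l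
      bound b d l c≤b 0≤d 0≤l bd≤q p≤d^nl = begin
        c ^ n * p               ≤⟨ *-monoˡ (^-≥0 n 0≤c) p≤d^nl ⟩
        c ^ n * (d ^ n * l)     ≡⟨ *-assoc (c ^ n) (d ^ n) l ⟨
        c ^ n * d ^ n * l       ≡⟨ cong (_* l) (^-distrib-* c d n) ⟨
        (c * d) ^ n * l         ≤⟨ *-monoʳ 0≤l (^-mono-≤ n (0≤* 0≤c 0≤d) (≤-trans (*-monoʳ 0≤d c≤b) bd≤q)) ⟩
        q ^ n * l               ∎
        where open ≤-Reasoning

    scale-lower : ∀ (C Y : ℝ⁺) {A : ℚ → Set} {c p q} → 0ℚ ≤ c → 0ℚ ≤ q → ↑ C ⊒ c →
      (∀ {u} → A u → 0ℚ < u) →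
      (∀ {d} → 0ℚ < d → L (↑ Y) d → ∃[ u ] A u × d ^ n * u ≤ p) →
      L (↑ (C *⁺ Y)) q → ∃[ u ] A u × q ^ n * u ≤ c ^ n * p
    scale-lower C Y {A} {c} {p} {q} 0≤c 0≤q C⊒c A>0 Y-L Lq =
      let b , d , 0<b , Lb , 0<d , Ld , q<bd = *-L⁻ C Y Lq
          u , Au , d^nu≤p = Y-L 0<d Ld
      in u , Au , bound b d u (C⊒c b Lb) (<⇒≤ 0<d) (<⇒≤ (A>0 Au)) (<⇒≤ q<bd) d^nu≤p
      where
      bound : ∀ b d u → b ≤ c → 0ℚ ≤ d → 0ℚ ≤ u → q ≤ b * d → d ^ n * u ≤ p → q ^ n * u ≤ c ^ n * p
      bound b d u b≤c 0≤d 0≤u q≤bd d^nu≤p = begin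
        q ^ n * u                 ≤⟨ *-monoʳ 0≤u (^-mono-≤ n 0≤q (≤-trans q≤bd (*-monoʳ 0≤d b≤c))) ⟩
        (c * d) ^ n * u           ≡⟨ cong (_* u) (^-distrib-* c d n) ⟩
        c ^ n * d ^ n * u         ≡⟨ *-assoc (c ^ n) (d ^ n) u ⟩
        c ^ n * (d ^ n * u)       ≤⟨ *-monoˡ (^-≥0 n 0≤c) d^nu≤p ⟩
        c ^ n * p                 ∎
        where open ≤-Reasoning

    -- The reason for c = 1/2: if M ≥ 2, then M ≤ 2 (M - 1) < 2 c D ≤ D, and D^n = 1/δ. For M = 1
    -- the bound is δ ≤ 1.
    ceiling-upper : ∀ (c D δ : ℝ⁺) → (∀ {a} → 0ℚ < a → L (↑ c) a → a * ι 2 ≤ 1ℚ) →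
      (∀ {e} → 0ℚ < e → L (↑ D) e → ∃[ u ] U (↑ δ) u × e ^ n * u ≤ 1ℚ) →
      ↑ δ ≤ʳ 1ʳ → ∀ M .{{_ : ℕ.NonZero M}} → fromℤ (ℤ.+ M ℤ.- ℤ.+ 1) <ʳ ↑ (c *⁺ D) →
      ∀ {a} → 0ℚ < a → L (↑ δ) a → a * ι M ^ n ≤ 1ℚ
    ceiling-upper c D δ c≤½ D-L δ≤1 1 _ {a} 0<a La = ≤-trans
      (≤-reflexive (trans (cong (a *_) (1^ n)) (*-identityʳ a))) (<⇒≤ (δ≤1 a La))
    ceiling-upper c D δ c≤½ D-L δ≤1 (suc (suc M)) (x , M<x , Lx) {a} 0<a La =
      let b , e , 0<b , Lb , 0<e , Le , x<be = *-L⁻ c D Lx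
          u , Uu , e^nu≤1 = D-L 0<e Le
      in bound b e u (<⇒≤ 0<e) (<⇒≤ (<-trans M<x x<be)) (c≤½ 0<b Lb) (<⇒≤ (L<U (↑ δ) La Uu)) e^nu≤1
      where
      open ≤-Reasoning
      rearrange : ∀ b e → ι 2 * (b * e) ≡ b * ι 2 * e
      rearrange = solve 2 (λ b e → con (ι 2) :* (b :* e) := b :* con (ι 2) :* e) refl
      bound : ∀ b e u → 0ℚ ≤ e → ι (suc M) ≤ b * e → b * ι 2 ≤ 1ℚ → a ≤ u → e ^ n * u ≤ 1ℚ →
        a * ι (2 ℕ.+ M) ^ n ≤ 1ℚ
      bound b e u 0≤e 1+M≤be 2b≤1 a≤u e^nu≤1 = begin
        a * ι (2 ℕ.+ M) ^ n       ≤⟨ *-mono {a} {e ^ n} {u} {ι (2 ℕ.+ M) ^ n} (<⇒≤ 0<a) (^-≥0 n 0≤e) a≤u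
                                       (^-mono-≤ n (0≤ι (2 ℕ.+ M)) M≤e) ⟩
        u * e ^ n                 ≡⟨ *-comm u (e ^ n) ⟩
        e ^ n * u                 ≤⟨ e^nu≤1 ⟩
        1ℚ                        ∎
        where
        M≤e : ι (2 ℕ.+ M) ≤ e
        M≤e = begin
          ι (2 ℕ.+ M)             ≤⟨ ι-mono (ℕ.s≤s (ℕ.≤-trans (ℕ.s≤s (ℕ.m≤m+n M (M ℕ.+ 0))) (ℕ.≤-reflexive (sym (ℕ.+-suc M (M ℕ.+ 0)))))) ⟩
          ι (2 ℕ.* suc M)         ≡⟨ ι-* 2 (suc M) ⟩
          ι 2 * ι (suc M)         ≤⟨ *-monoˡ {ι 2} {ι (suc M)} {b * e} (0≤ι 2) 1+M≤be ⟩
          ι 2 * (b * e)           ≡⟨ rearrange b e ⟩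
          b * ι 2 * e             ≤⟨ *-monoʳ {e} {b * ι 2} {1ℚ} 0≤e 2b≤1 ⟩
          1ℚ * e                  ≡⟨ *-identityˡ e ⟩
          e                       ∎

    -- Passing from c D ≤ M to a strict rational bound costs 2, so c D < M + 2 ≤ 3 M, and c ≥ 1/2
    -- turns this into D ≤ 6 M.
    ceiling-lower : ∀ (c D : ℝ⁺) {A : ℚ → Set} → (∀ {b} → U (↑ c) b → 1ℚ ≤ b * ι 2) →
      (∀ {d} → U (↑ D) d → 0ℚ < d × ∃[ l ] 0ℚ < l × A l × 1ℚ ≤ d ^ n * l) →
      ∀ M → 0 ℕ.< M → ↑ (c *⁺ D) ≤ʳ fromℕ M → ∃[ l ] 0ℚ < l × A l × 1ℚ ≤ ι (6 ℕ.* M) ^ n * l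
    ceiling-lower c D {A} c≥½ D-U M 0<M cD≤M =
      let b , d , Ub , Ud , bd<M+2 = *-U⁻ (↑ c) (↑ D)
            (≤ʳ⇒U (↑ (c *⁺ D)) (fromℕ M) cD≤M {ι (1 ℕ.+ M)} {ι (2 ℕ.+ M)} (ι-mono-< (ℕ.n<1+n (1 ℕ.+ M))) (ι-mono-< (ℕ.n<1+n M)))
          0<d , l , 0<l , Al , 1≤d^nl = D-U Ud
      in l , 0<l , Al , ≤-trans 1≤d^nl (*-monoʳ {l} {d ^ n} {ι (6 ℕ.* M) ^ n} (<⇒≤ 0<l)
           (^-mono-≤ n (<⇒≤ 0<d) (d≤6M b d (<⇒≤ 0<d) (c≥½ Ub) (<⇒≤ bd<M+2))))
      where
      open ≤-Reasoning
      rearrange : ∀ b d → b * ι 2 * d ≡ ι 2 * (b * d)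
      rearrange = solve 2 (λ b d → b :* con (ι 2) :* d := con (ι 2) :* (b :* d)) refl
      2+M≤3M : 2 ℕ.+ M ℕ.≤ 3 ℕ.* M
      2+M≤3M = ℕ.≤-trans (ℕ.≤-reflexive (ℕ.+-comm 2 M)) (ℕ.+-monoʳ-≤ M (ℕ.*-monoʳ-≤ 2 0<M))
      d≤6M : ∀ b d → 0ℚ ≤ d → 1ℚ ≤ b * ι 2 → b * d ≤ ι (2 ℕ.+ M) → d ≤ ι (6 ℕ.* M)
      d≤6M b d 0≤d 1≤2b bd≤M+2 = begin
        d                       ≡⟨ *-identityˡ d ⟨
        1ℚ * d                  ≤⟨ *-monoʳ {d} {1ℚ} {b * ι 2} 0≤d 1≤2b ⟩
        b * ι 2 * d             ≡⟨ rearrange b d ⟩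
        ι 2 * (b * d)           ≤⟨ *-monoˡ {ι 2} {b * d} {ι (2 ℕ.+ M)} (0≤ι 2) bd≤M+2 ⟩
        ι 2 * ι (2 ℕ.+ M)       ≡⟨ ι-* 2 (2 ℕ.+ M) ⟨
        ι (2 ℕ.* (2 ℕ.+ M))     ≤⟨ ι-mono (ℕ.*-monoʳ-≤ 2 2+M≤3M) ⟩
        ι (2 ℕ.* (3 ℕ.* M))     ≡⟨ cong ι (ℕ.*-assoc 2 3 M) ⟨
        ι (6 ℕ.* M)             ∎

    -- Here f g stands for L^(k/(k-1)) / P^(1/(k-1)), p for P and u for L.
    ratio-bound : ∀ {p q u c f g} → 0ℚ ≤ p → 0ℚ ≤ q → 0ℚ ≤ u → 0ℚ ≤ c → 0ℚ ≤ f → 0ℚ ≤ g →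
      q ^ n * u ≤ c ^ n * p → f ^ n ≤ u ^ k → g ^ n * p ≤ 1ℚ → f * g * q ^ k ≤ c ^ k * p
    ratio-bound {p} {q} {u} {c} {f} {g} 0≤p 0≤q 0≤u 0≤c 0≤f 0≤g q^nu≤ f^n≤u^k g^np≤1 =
      ^-cancel-≤ m (0≤* (^-≥0 k 0≤c) 0≤p) (begin
      (f * g * q ^ k) ^ n                     ≡⟨ expand ⟩
      f ^ n * g ^ n * (q ^ n) ^ k             ≤⟨ *-monoʳ (^-≥0 k (^-≥0 n 0≤q)) (*-monoʳ 0≤g^n f^n≤u^k) ⟩
      u ^ k * g ^ n * (q ^ n) ^ k             ≡⟨ rearrange₁ (u ^ k) (g ^ n) ((q ^ n) ^ k) ⟩
      g ^ n * ((q ^ n) ^ k * u ^ k)           ≡⟨ cong (g ^ n *_) (^-distrib-* (q ^ n) u k) ⟨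
      g ^ n * (q ^ n * u) ^ k                 ≤⟨ *-monoˡ 0≤g^n (^-mono-≤ k (0≤* (^-≥0 n 0≤q) 0≤u) q^nu≤) ⟩
      g ^ n * (c ^ n * p) ^ k                 ≡⟨ cong (g ^ n *_) (^-distrib-* (c ^ n) p k) ⟩
      g ^ n * ((c ^ n) ^ k * (p * p ^ n))     ≡⟨ rearrange₂ (g ^ n) ((c ^ n) ^ k) p (p ^ n) ⟩
      g ^ n * p * ((c ^ n) ^ k * p ^ n)       ≤⟨ *-monoʳ (0≤* (^-≥0 k (^-≥0 n 0≤c)) (^-≥0 n 0≤p)) g^np≤1 ⟩
      1ℚ * ((c ^ n) ^ k * p ^ n)              ≡⟨ *-identityˡ ((c ^ n) ^ k * p ^ n) ⟩
      (c ^ n) ^ k * p ^ n                     ≡⟨ cong (_* p ^ n) (^-swap c n k) ⟩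
      (c ^ k) ^ n * p ^ n                     ≡⟨ ^-distrib-* (c ^ k) p n ⟨
      (c ^ k * p) ^ n                         ∎)
      where
      open ≤-Reasoning
      0≤g^n : 0ℚ ≤ g ^ n
      0≤g^n = ^-≥0 n 0≤g
      expand : (f * g * q ^ k) ^ n ≡ f ^ n * g ^ n * (q ^ n) ^ k
      expand = trans (^-distrib-* (f * g) (q ^ k) n) (cong₂ _*_ (^-distrib-* f g n) (^-swap q k n))
      rearrange₁ : ∀ u g q → u * g * q ≡ g * (q * u)
      rearrange₁ = solve 3 (λ u g q → u :* g :* q := g :* (q :* u)) refl
      rearrange₂ : ∀ g c p s → g * (c * (p * s)) ≡ g * p * (c * s)
      rearrange₂ = solve 4 (λ g c p s → g :* (c :* (p :* s)) := g :* p :* (c :* s)) refl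

-- The sets A_i, the tuples with a common modulus, and their lcm.

module Selections where

  open import Data.Nat.Base
  open import Data.Nat.Properties
  open import Data.Nat.Divisibility
  open import Data.Nat.LCM using (lcm-least)
  open import Data.Nat.Tactic.RingSolver using (solve-∀)
  open import Data.Integer.Base as ℤ using (ℤ; ∣_∣)
  import Data.Integer.Properties as ℤ
  open import Data.Fin.Base using (Fin; zero; suc)
  open import Data.List.Base using (List; length; map; concatMap)
  open import Data.List.Properties using (length-map)
  open import Data.List.Membership.Propositional using (_∈_)
  open import Data.List.Membership.Propositional.Properties using (∈-map⁻)
  open import Data.List.Relation.Unary.Unique.Propositional using (Unique)
  import Data.List.Relation.Unary.Unique.Propositional.Properties as Unique
  open import Data.Vec.Base using (Vec; []; _∷_; lookup)
  open import Data.Vec.Functional using (Vector)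
  open import Data.Product.Base using (∃; _×_; _,_; proj₁; proj₂)
  open import Data.Empty using (⊥-elim)
  open import Function.Base using (_∘_)
  open import Relation.Nullary using (yes; no)
  open import Relation.Binary.PropositionalEquality
  open Moduli
  open FiniteSets

  ∏-mono : ∀ {n} (x y : Vector ℕ n) → (∀ i → x i ≤ y i) → ∏ x ≤ ∏ y
  ∏-mono {zero}  x y x≤y = ≤-refl
  ∏-mono {suc n} x y x≤y = *-mono-≤ (x≤y zero) (∏-mono (x ∘ suc) (y ∘ suc) (x≤y ∘ suc))

  ∏-cong : ∀ {n} {x y : Vector ℕ n} → (∀ i → x i ≡ y i) → ∏ x ≡ ∏ y
  ∏-cong {zero}  x≡y = refl
  ∏-cong {suc n} x≡y = cong₂ _*_ (x≡y zero) (∏-cong (x≡y ∘ suc))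

  ∏-scale : ∀ {n} c (x : Vector ℕ n) → ∏ (λ i → c * x i) ≡ c ^ n * ∏ x
  ∏-scale {zero}  c x = refl
  ∏-scale {suc n} c x = trans (cong (c * x zero *_) (∏-scale c (x ∘ suc)))
    (rearrange c (x zero) (c ^ n) (∏ (x ∘ suc)))
    where
    rearrange : ∀ a b c d → a * b * (c * d) ≡ a * c * (b * d)
    rearrange = solve-∀

  ∏-positive : ∀ {n} (x : Vector ℕ n) → (∀ i → 0 < x i) → 0 < ∏ x
  ∏-positive {zero}  x 0<x = z<s
  ∏-positive {suc n} x 0<x = *-mono-≤ (0<x zero) (∏-positive (x ∘ suc) (0<x ∘ suc))

  lcmᵛ-nonNeg : ∀ {k} (a : Vec ℤ k) → lcmᵛ a ≡ ℤ.+ ∣ lcmᵛ a ∣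
  lcmᵛ-nonNeg []      = refl
  lcmᵛ-nonNeg (x ∷ a) = refl

  -- Writing the entries as c_i d, the witness m is the product of the c_i; each c_i d divides d m,
  -- hence so does the lcm.
  lcmᵛ-divides : ∀ {k} d (a : Vec ℤ k) → (∀ i → d ∣ ∣ lookup a i ∣) →
    ∃ λ m → ∏ (λ i → ∣ lookup a i ∣) ≡ d ^ k * m × ∣ lcmᵛ a ∣ ∣ d * m
  lcmᵛ-divides d []      d∣a = 1 , refl , 1∣ (d * 1)
  lcmᵛ-divides {suc k} d (x ∷ a) d∣a with lcmᵛ-divides d a (d∣a ∘ suc) | d∣a zero
  ... | m , ∏≡ , lcm∣ | divides c x≡ = c * m
    , trans (cong₂ _*_ x≡ ∏≡) (rearrange c d (d ^ k) m)
    , lcm-least (divides m (trans (rearrange₁ d c m) (cong (m *_) (sym x≡))))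
        (∣-trans lcm∣ (divides c (rearrange₂ d c m)))
    where
    rearrange : ∀ c d e m → c * d * (e * m) ≡ d * e * (c * m)
    rearrange = solve-∀
    rearrange₁ : ∀ d c m → d * (c * m) ≡ m * (c * d)
    rearrange₁ = solve-∀
    rearrange₂ : ∀ d c m → d * (c * m) ≡ c * (d * m)
    rearrange₂ = solve-∀

  lcmᵛ-bound : ∀ {n} d (a : Vec ℤ (suc n)) → (∀ i → d ∣ ∣ lookup a i ∣) → (∀ i → 0 < ∣ lookup a i ∣) →
    ∣ lcmᵛ a ∣ * d ^ n ≤ ∏ (λ i → ∣ lookup a i ∣)
  lcmᵛ-bound {n} d a d∣a 0<a with lcmᵛ-divides d a d∣a
  ... | m , ∏≡ , lcm∣ = begin
    ∣ lcmᵛ a ∣ * d ^ n              ≤⟨ *-monoˡ-≤ (d ^ n) (∣⇒≤ {{≢-nonZero d*m≢0}} lcm∣) ⟩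
    d * m * d ^ n                   ≡⟨ rearrange d m (d ^ n) ⟩
    d ^ suc n * m                   ≡⟨ ∏≡ ⟨
    ∏ (λ i → ∣ lookup a i ∣)        ∎
    where
    open ≤-Reasoning
    rearrange : ∀ d m e → d * m * e ≡ d * e * m
    rearrange = solve-∀
    d*m≢0 : d * m ≢ 0
    d*m≢0 dm≡0 = <⇒≢ (∏-positive (λ i → ∣ lookup a i ∣) 0<a)
      (sym (trans ∏≡ (trans (sym (rearrange d m (d ^ n))) (cong (_* d ^ n) dm≡0))))

  ^-distribʳ-* : ∀ k a b → (a * b) ^ k ≡ a ^ k * b ^ k
  ^-distribʳ-* zero    a b = refl
  ^-distribʳ-* (suc k) a b = trans (cong (a * b *_) (^-distribʳ-* k a b)) (rearrange a b (a ^ k) (b ^ k))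
    where
    rearrange : ∀ a b c d → a * b * (c * d) ≡ a * c * (b * d)
    rearrange = solve-∀

  binary-scale : ∀ m → 0 < m → ∃ λ n → 2 ^ n ≤ m × m < 2 ^ suc n
  binary-scale (suc zero)      _ = 0 , ≤-refl , ≤-refl
  binary-scale (suc m@(suc _)) _ with binary-scale m z<s
  ... | n , 2^n≤m , m<2^1+n with suc m <? 2 ^ suc n
  ... | yes 1+m<2^1+n = n , m≤n⇒m≤1+n 2^n≤m , 1+m<2^1+n
  ... | no 1+m≮2^1+n = suc n , ≮⇒≥ 1+m≮2^1+n ,
    ≤-<-trans m<2^1+n (m<m+n (2 ^ suc n) (≤-trans (m^n>0 2 (suc n)) (m≤m+n _ 0)))

  -- The window length will be 2^(2+n), between 2 m and 4 m, while 2^(1+n) ≤ 2 m, with positive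
  -- exponent, feeds the lower bound for log (2 m).
  binary-scale-2* : ∀ m → 0 < m → ∃ λ n → 2 ^ suc n ≤ 2 * m × 2 * m ≤ 2 ^ (2 + n) × 2 ^ (2 + n) ≤ 4 * m
  binary-scale-2* m 0<m with binary-scale (2 * m) (≤-trans 0<m (m≤m+n m _))
  ... | zero  , _ , 2m<2 = ⊥-elim (<⇒≱ 2m<2 (*-monoʳ-≤ 2 0<m))
  ... | suc n , 2^n≤2m , 2m<2^1+n = n , 2^n≤2m , <⇒≤ 2m<2^1+n ,
    ≤-trans (*-monoʳ-≤ 2 2^n≤2m) (≤-reflexive (sym (*-assoc 2 2 m)))

  module Selection {M q} (P : Progressions M q) {n} (z : Fin (suc n) → ℕ) (32q≤z : ∀ i → 32 * q ≤ z i) where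

    open Progressions P

    progression : Fin (suc n) → ℕ → List ℤ
    progression i d = map (ℤ.+_) (block (z i) d)

    ∈-progression : ∀ {i d a} → a ∈ progression i d → ∃ λ b → b ∈ block (z i) d × a ≡ ℤ.+ b
    ∈-progression = ∈-map⁻ (ℤ.+_)

    progression-length : ∀ i {d} → d ∈ moduli → length (progression i d) ≡ size (z i)
    progression-length i {d} d∈ = trans (length-map (ℤ.+_) (block (z i) d)) (block-length (32q≤z i) d∈)

    progression-unique : ∀ i {d} → d ∈ moduli → Unique (progression i d)
    progression-unique i d∈ = Unique.map⁺ ℤ.+-injective (block-unique (z i) d∈)

    progression-meet : ∀ i {d d′ a} → d ∈ moduli → d′ ∈ moduli → a ∈ progression i d → a ∈ progression i d′ → d ≡ d′
    progression-meet i {d} {d′} d∈ d′∈ a∈ a∈′ =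
      let b , b∈ , a≡ = ∈-progression a∈
          b′ , b′∈ , a≡′ = ∈-progression a∈′
      in block-meet (z i) d∈ d′∈ b∈ (subst (_∈ block (z i) d′) (ℤ.+-injective (trans (sym a≡′) a≡)) b′∈)

    A : Fin (suc n) → FinSet ℤ
    A i = record
      { elements = concatMap (progression i) moduli
      ; unique   = concatMap-unique (progression i) moduli-unique (progression-unique i) (progression-meet i)
      }

    card-A : ∀ i → card (A i) ≡ M * size (z i)
    card-A i = trans (concatMap-length (progression i) moduli (size (z i)) (progression-length i))
      (cong (_* size (z i)) moduli-length)

    ∈-A : ∀ i {a} → a ∈ˢ A i → ∃ λ b → a ≡ ℤ.+ b × 2 + z i ≤ b × b ≤ 2 * z i
    ∈-A i a∈ =
      let d , d∈ , a∈d = ∈-concatMap-find (progression i) {xs = moduli} a∈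
          b , b∈ , a≡ = ∈-progression a∈d
          lower , upper = block-bounds (32q≤z i) d∈ b∈
      in b , a≡ , lower , upper

    sameModulus : ℕ → List (Vec ℤ (suc n))
    sameModulus d = tuples (λ i → progression i d)

    S : FinSet (Vec ℤ (suc n))
    S = record
      { elements = concatMap sameModulus moduli
      ; unique   = concatMap-unique sameModulus moduli-unique
          (λ {d} d∈ → tuples-unique (λ i → progression i d) (λ i → progression-unique i d∈))
          -- The first entry alone already determines the modulus of a tuple.
          (λ {d} {d′} d∈ d′∈ v∈ v∈′ → progression-meet zero d∈ d′∈
            (∈-tuples⁻ (λ i → progression i d) v∈ zero) (∈-tuples⁻ (λ i → progression i d′) v∈′ zero))
      }

    card-S : card S ≡ M * ∏ (λ i → size (z i))
    card-S = trans (concatMap-length sameModulus moduli _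
        (λ {d} d∈ → trans (tuples-length (λ i → progression i d)) (∏-cong (λ i → progression-length i d∈))))
      (cong (_* ∏ (λ i → size (z i))) moduli-length)

    S⊆A : ∀ {v} → v ∈ˢ S → ∀ i → lookup v i ∈ˢ A i
    S⊆A v∈ i =
      let d , d∈ , v∈d = ∈-concatMap-find sameModulus {xs = moduli} v∈
      in ∈-concatMap (progression i) d∈ (∈-tuples⁻ (λ i → progression i d) v∈d i)

    S-lcm : ∀ {v} → v ∈ˢ S → ∣ lcmᵛ v ∣ * q ^ n ≤ 2 ^ suc n * ∏ z
    S-lcm {v} v∈ = begin
      ∣ lcmᵛ v ∣ * q ^ n              ≤⟨ *-monoʳ-≤ ∣ lcmᵛ v ∣ (^-monoˡ-≤ n (moduli-≥ d∈)) ⟩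
      ∣ lcmᵛ v ∣ * d ^ n              ≤⟨ lcmᵛ-bound d v (proj₁ ∘ entries) (proj₁ ∘ proj₂ ∘ entries) ⟩
      ∏ (λ i → ∣ lookup v i ∣)        ≤⟨ ∏-mono (λ i → ∣ lookup v i ∣) (λ i → 2 * z i) (proj₂ ∘ proj₂ ∘ entries) ⟩
      ∏ (λ i → 2 * z i)               ≡⟨ ∏-scale 2 z ⟩
      2 ^ suc n * ∏ z                 ∎
      where
      open ≤-Reasoning
      found = ∈-concatMap-find sameModulus {xs = moduli} v∈
      d = proj₁ found
      d∈ = proj₁ (proj₂ found)
      entries : ∀ i → d ∣ ∣ lookup v i ∣ × 0 < ∣ lookup v i ∣ × ∣ lookup v i ∣ ≤ 2 * z i
      entries i =
        let b , b∈ , a≡ = ∈-progression (∈-tuples⁻ (λ i → progression i d) (proj₂ (proj₂ found)) i)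
            lower , upper = block-bounds (32q≤z i) d∈ b∈
            ∣a∣≡b = cong ∣_∣ a≡
        in subst (d ∣_) (sym ∣a∣≡b) (block-∣ (z i) b∈)
         , subst (0 <_) (sym ∣a∣≡b) (≤-trans z<s lower)
         , subst (_≤ 2 * z i) (sym ∣a∣≡b) upper

    abstract

      -- Opaque, so that estimates treat the product of cardinalities as a plain natural and never
      -- unfold the lists behind it.
      W : ℕ
      W = ∏ (λ i → card (A i))

      ∏-card-A : ∏ (λ i → card (A i)) ≡ W
      ∏-card-A = refl

    W≡ : W ≡ M ^ suc n * ∏ (λ i → size (z i))
    W≡ = trans (sym ∏-card-A) (trans (∏-cong card-A) (∏-scale M (λ i → size (z i))))

    W≡M^n*S : W ≡ M ^ n * card S
    W≡M^n*S = trans W≡ (trans (rearrange M (M ^ n) (∏ (λ i → size (z i)))) (cong (M ^ n *_) (sym card-S)))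
      where
      rearrange : ∀ m p s → m * p * s ≡ p * (m * s)
      rearrange = solve-∀

    W>0 : 0 < M → 0 < q → 0 < W
    W>0 0<M 0<q = subst (0 <_) (sym (trans (sym ∏-card-A) (∏-cong card-A))) (∏-positive (λ i → M * size (z i)) (λ i → *-mono-≤ 0<M (size>0 i)))
      where
      size>0 : ∀ i → 0 < size (z i)
      size>0 i = n≢0⇒n>0 (λ size≡0 → <⇒≱ (≤-trans 0<q (≤-trans (m≤m+n q _) (32q≤z i)))
        (subst (z i ≤_) (trans (cong (λ s → 12 * (q * s)) size≡0) (cong (12 *_) (*-zeroʳ q))) (size-bound (32q≤z i))))

    -- By `size-bound`, ∏ z is at most (12 q)^k times the product of the sizes. In use a = 6 and b =
    -- 32, so that (a M)^k bounds δ^(-k/(k-1)), and b^k ∏ z bounds q^k times the other factor of the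
    -- target.
    W-bound : ∀ a b → (a * M) ^ suc n * (b ^ suc n * ∏ z) ≤ W * ((a * (b * 12)) ^ suc n * q ^ suc n)
    W-bound a b = begin
      (a * M) ^ k * (b ^ k * ∏ z)                       ≤⟨ *-monoʳ-≤ ((a * M) ^ k) (*-monoʳ-≤ (b ^ k) ∏z≤) ⟩
      (a * M) ^ k * (b ^ k * (12 ^ k * (q ^ k * s)))    ≡⟨ cong (_* (b ^ k * (12 ^ k * (q ^ k * s)))) (^-distribʳ-* k a M) ⟩
      a ^ k * M ^ k * (b ^ k * (12 ^ k * (q ^ k * s)))  ≡⟨ rearrange (a ^ k) (M ^ k) (b ^ k) (12 ^ k) (q ^ k) s ⟩
      M ^ k * s * (a ^ k * (b ^ k * 12 ^ k) * q ^ k)    ≡⟨ cong₂ (λ x y → x * (y * q ^ k)) (sym W≡)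
                                                             (sym (trans (^-distribʳ-* k a (b * 12)) (cong (a ^ k *_) (^-distribʳ-* k b 12)))) ⟩
      W * ((a * (b * 12)) ^ k * q ^ k)                  ∎
      where
      open ≤-Reasoning
      k = suc n
      s = ∏ (λ i → size (z i))
      ∏z≤ : ∏ z ≤ 12 ^ k * (q ^ k * s)
      ∏z≤ = begin
        ∏ z                                 ≤⟨ ∏-mono z (λ i → 12 * (q * size (z i))) (λ i → size-bound (32q≤z i)) ⟩
        ∏ (λ i → 12 * (q * size (z i)))     ≡⟨ ∏-scale 12 (λ i → q * size (z i)) ⟩
        12 ^ k * ∏ (λ i → q * size (z i))   ≡⟨ cong (12 ^ k *_) (∏-scale q (λ i → size (z i))) ⟩
        12 ^ k * (q ^ k * s)                ∎
      rearrange : ∀ a m b c q s → a * m * (b * (c * (q * s))) ≡ m * s * (a * (b * c) * q)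
      rearrange = solve-∀

-- Numerical estimates for the density, the lcm and the cardinalities.

module Estimates where

  open import Data.Nat.Base as ℕ using (ℕ; zero; suc)
  import Data.Nat.Properties as ℕ
  open import Data.Nat.Tactic.RingSolver using (solve-∀)
  open import Data.Integer.Base as ℤ using (ℤ; ∣_∣)
  open import Data.Rational.Base hiding (_≥_; _>_; ∣_∣)
  open import Data.Rational.Properties
  open import Data.Rational.Solver using (module +-*-Solver)
  open +-*-Solver using (solve; _:*_; _:=_)
  open import Algebra.Bundles using (CommutativeRing)
  open import Algebra.Definitions.RawSemiring +-*-rawSemiring using (_^_)
  open import Algebra.Properties.CommutativeSemiring.Exp
    (CommutativeRing.commutativeSemiring +-*-commutativeRing) using (^-distrib-*)
  open import Data.Vec.Functional using (Vector)
  open import Data.Product.Base using (∃-syntax; _×_; _,_)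
  open import Relation.Binary.PropositionalEquality
  open ℚ-Lemmas hiding (p; q; r; a; b; c; d)
  open Cut-Lemmas using (L<U)
  open Moduli
  open Selections
  open RationalBounds

  -- This is 2^k ≤ 4^(k-1), the reason for C = 4: the factor 4^(k-1) gained from q ≥ Q absorbs the
  -- 2^k lost by letting a_i reach 2 X_i.
  2^[2+m]≤4^[1+m] : ∀ m → 2 ℕ.^ (2 ℕ.+ m) ℕ.≤ 4 ℕ.^ suc m
  2^[2+m]≤4^[1+m] zero    = ℕ.≤-refl
  2^[2+m]≤4^[1+m] (suc m) = ℕ.*-mono-≤ (ℕ.m≤m+n 2 2) (2^[2+m]≤4^[1+m] m)

  *⁺-*⁺-L⁻ : ∀ (θ E F G : ℝ⁺) {t} → L (↑ (θ *⁺ E *⁺ (F *⁺ G))) t →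
    ∃[ a ] ∃[ e ] ∃[ f ] ∃[ g ] 0ℚ < a × L (↑ θ) a × 0ℚ < e × L (↑ E) e ×
      0ℚ < f × L (↑ F) f × 0ℚ < g × L (↑ G) g × t ≤ a * e * (f * g)
  *⁺-*⁺-L⁻ θ E F G Lt =
    let x , y , 0<x , Lx , 0<y , Ly , t<xy = *-L⁻ (θ *⁺ E) (F *⁺ G) Lt
        a , e , 0<a , La , 0<e , Le , x<ae = *-L⁻ θ E Lx
        f , g , 0<f , Lf , 0<g , Lg , y<fg = *-L⁻ F G Ly
    in a , e , f , g , 0<a , La , 0<e , Le , 0<f , Lf , 0<g , Lg ,
       ≤-trans (<⇒≤ t<xy) (*-mono {x} {f * g} {a * e} {y} (<⇒≤ 0<x) (0≤* (<⇒≤ 0<f) (<⇒≤ 0<g)) (<⇒≤ x<ae) (<⇒≤ y<fg))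

  *ʳ-fromℕ-≤ : ∀ (x : ℝ⁺) w s → 0 ℕ.< w → (∀ {a} → 0ℚ < a → L (↑ x) a → a * ι w ≤ ι s) →
    ↑ x *ʳ fromℕ w ≤ʳ fromℕ s
  *ʳ-fromℕ-≤ x w s 0<w bound = ⊒⇒≤ʳ (↑ x *ʳ fromℕ w) {ι s} (λ t Lt →
    let a , v , 0<a , La , _ , v<w , t<av = *-L⁻ x (fromℕ⁺ w {{ℕ.>-nonZero 0<w}}) Lt
    in ≤-trans (<⇒≤ t<av) (≤-trans (*-monoˡ {a} {v} {ι w} (<⇒≤ 0<a) (<⇒≤ v<w)) (bound 0<a La)))

  large-modulus : ∀ M n q → 3072 ℕ.* (M ℕ.* suc n) ℕ.≤ 4 ℕ.* q → 384 ℕ.* (M ℕ.* (2 ℕ.+ n)) ℕ.≤ q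
  large-modulus M n q bound = ℕ.*-cancelˡ-≤ 4 (begin
    4 ℕ.* (384 ℕ.* (M ℕ.* (2 ℕ.+ n)))         ≤⟨ ℕ.*-monoʳ-≤ 4 (ℕ.*-monoʳ-≤ 384 (ℕ.*-monoʳ-≤ M 2+n≤)) ⟩
    4 ℕ.* (384 ℕ.* (M ℕ.* (2 ℕ.* suc n)))     ≡⟨ rearrange M (suc n) ⟩
    3072 ℕ.* (M ℕ.* suc n)                    ≤⟨ bound ⟩
    4 ℕ.* q                                   ∎)
    where
    open ℕ.≤-Reasoning
    rearrange : ∀ m n → 4 ℕ.* (384 ℕ.* (m ℕ.* (2 ℕ.* n))) ≡ 3072 ℕ.* (m ℕ.* n)
    rearrange = solve-∀
    twice : ∀ n → 2 ℕ.+ (n ℕ.+ n) ≡ 2 ℕ.* suc n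
    twice = solve-∀
    2+n≤ : 2 ℕ.+ n ℕ.≤ 2 ℕ.* suc n
    2+n≤ = ℕ.≤-trans (ℕ.+-monoʳ-≤ 2 (ℕ.m≤m+n n n)) (ℕ.≤-reflexive (twice n))

  q₀-large : ∀ M h q₀ → 0 ℕ.< M → 0 ℕ.< h → 384 ℕ.* (M ℕ.* h) ℕ.≤ 2 ℕ.+ q₀ → 382 ℕ.≤ q₀
  q₀-large M h q₀ 0<M 0<h large = ℕ.+-cancelˡ-≤ 2 382 q₀
    (ℕ.≤-trans (ℕ.*-monoʳ-≤ 384 (ℕ.*-mono-≤ 0<M 0<h)) large)

  -- The reason for κ = 1/50: replacing Q by 2 + q₀ and X_i by z costs 66 in all, which the surplus
  -- (50 - 32) q₀ covers.
  z-large : ∀ q₀ z → 382 ℕ.≤ q₀ → 50 ℕ.* q₀ ℕ.≤ 2 ℕ.+ z → 32 ℕ.* (2 ℕ.+ q₀) ℕ.≤ z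
  z-large q₀ z 382≤q₀ bound = ℕ.+-cancelˡ-≤ 2 _ _ (begin
    2 ℕ.+ 32 ℕ.* (2 ℕ.+ q₀)         ≡⟨ rearrange₁ q₀ ⟩
    66 ℕ.+ 32 ℕ.* q₀                ≤⟨ ℕ.+-monoˡ-≤ (32 ℕ.* q₀) (ℕ.≤-trans (ℕ.m≤m+n 66 316) (ℕ.≤-trans 382≤q₀ (ℕ.m≤m+n q₀ _))) ⟩
    18 ℕ.* q₀ ℕ.+ 32 ℕ.* q₀         ≡⟨ rearrange₂ q₀ ⟩
    50 ℕ.* q₀                       ≤⟨ bound ⟩
    2 ℕ.+ z                         ∎)
    where
    open ℕ.≤-Reasoning
    rearrange₁ : ∀ q → 2 ℕ.+ 32 ℕ.* (2 ℕ.+ q) ≡ 66 ℕ.+ 32 ℕ.* q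
    rearrange₁ = solve-∀
    rearrange₂ : ∀ q → 18 ℕ.* q ℕ.+ 32 ℕ.* q ≡ 50 ℕ.* q
    rearrange₂ = solve-∀

  module Construction (m M q₀ : ℕ) (P : Progressions M (2 ℕ.+ q₀)) (X : Vector ℝ⁺ (2 ℕ.+ m))
    (z : Vector ℕ (2 ℕ.+ m)) (X-L : ∀ i → L (↑ X i) (ι (z i))) (X-U : ∀ i → U (↑ X i) (ι (2 ℕ.+ z i)))
    (0<M : 0 ℕ.< M) (382≤q₀ : 382 ℕ.≤ q₀) (32q≤z : ∀ i → 32 ℕ.* (2 ℕ.+ q₀) ℕ.≤ z i)
    where

    n k q : ℕ
    n = suc m
    k = suc n
    q = 2 ℕ.+ q₀

    open Selection P {n} z 32q≤z public

    ∏X-⊑ : ι (∏ z) ⊑ ↑ ∏⁺ X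
    ∏X-⊑ = ∏-⊑ X z (λ i → L⇒⊑ (↑ X i) (X-L i))

    ∏X-⊒ : ↑ ∏⁺ X ⊒ ι (∏ (λ i → 2 ℕ.+ z i))
    ∏X-⊒ = ∏-⊒ X (λ i → 2 ℕ.+ z i) (λ i → U⇒⊒ (↑ X i) (X-U i))

    interval : ∀ (B : ℝ⁺) → ι 2 ⊑ ↑ B → ∀ i a → a ∈ˢ A i → ↑ X i ≤ʳ fromℤ a × fromℤ a ≤ʳ ↑ (B *⁺ X i)
    interval B 2⊑B i a a∈ =
      let b , a≡ , 2+z≤b , b≤2z = ∈-A i a∈
      in subst (λ a → ↑ X i ≤ʳ fromℤ a × fromℤ a ≤ʳ ↑ (B *⁺ X i)) (sym a≡) (lower b 2+z≤b , upper b b≤2z)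
      where
      lower : ∀ b → 2 ℕ.+ z i ℕ.≤ b → ↑ X i ≤ʳ fromℕ b
      lower b 2+z≤b = ⊒⇒≤ʳ (↑ X i) {ι b} (λ l Ll → ≤-trans (<⇒≤ (L<U (↑ X i) Ll (X-U i))) (ι-mono 2+z≤b))
      upper : ∀ b → b ℕ.≤ 2 ℕ.* z i → fromℕ b ≤ʳ ↑ (B *⁺ X i)
      upper b b≤2z = ⊑⇒≤ʳ (↑ (B *⁺ X i)) {ι b} (λ u Uu → ≤-trans (≤-trans (ι-mono b≤2z) (≤-reflexive (ι-* 2 (z i))))
        (*-⊑ (↑ B) (↑ X i) {ι 2} {ι (z i)} (0≤ι 2) (0≤ι (z i)) 2⊑B (L⇒⊑ (↑ X i) (X-L i)) u Uu))

    lcm-bound : ∀ (Λ : ℝ⁺) {l} → L (↑ Λ) l → ι 4 ^ n * ι (∏ z) ≤ ι q ^ n * l →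
      ∀ {v} → v ∈ˢ S → fromℤ (lcmᵛ v) ≤ʳ ↑ Λ
    lcm-bound Λ {l} Ll bound {v} v∈ = subst (λ a → fromℤ a ≤ʳ ↑ Λ) (sym (lcmᵛ-nonNeg v))
      (⊑⇒≤ʳ (↑ Λ) {ι ∣ lcmᵛ v ∣} (λ u Uu → ≤-trans lcm≤l (<⇒≤ (L<U (↑ Λ) Ll Uu))))
      where
      open ≤-Reasoning
      lcm≤l : ι ∣ lcmᵛ v ∣ ≤ l
      lcm≤l = *-cancelʳ {ι ∣ lcmᵛ v ∣} {l} {ι (q ℕ.^ n)} (ι-mono-< (ℕ.m^n>0 q n)) (begin
        ι ∣ lcmᵛ v ∣ * ι (q ℕ.^ n)        ≡⟨ ι-* ∣ lcmᵛ v ∣ (q ℕ.^ n) ⟨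
        ι (∣ lcmᵛ v ∣ ℕ.* q ℕ.^ n)        ≤⟨ ι-mono (ℕ.≤-trans (S-lcm v∈) (ℕ.*-monoˡ-≤ (∏ z) (2^[2+m]≤4^[1+m] m))) ⟩
        ι (4 ℕ.^ n ℕ.* ∏ z)               ≡⟨ trans (ι-* (4 ℕ.^ n) (∏ z)) (cong (_* ι (∏ z)) (ι-^ 4 n)) ⟩
        ι 4 ^ n * ι (∏ z)                 ≤⟨ bound ⟩
        ι q ^ n * l                       ≡⟨ trans (*-comm (ι q ^ n) l) (cong (l *_) (sym (ι-^ q n))) ⟩
        l * ι (q ℕ.^ n)                   ∎)

    density : ∀ (δ : ℝ⁺) → (∀ {a} → 0ℚ < a → L (↑ δ) a → a * ι M ^ n ≤ 1ℚ) →
      ↑ δ *ʳ fromℕ W ≤ʳ fromℕ (card S)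
    density δ δ≤ = *ʳ-fromℕ-≤ δ W (card S) (W>0 0<M ℕ.z<s) (λ {a} 0<a La → begin
      a * ι W      ≡⟨ cong (a *_) (trans (cong ι W≡M^n*S) (trans (ι-* (M ℕ.^ n) (card S)) (cong (_* ι (card S)) (ι-^ M n)))) ⟩
      a * (ι M ^ n * ι (card S))        ≡⟨ *-assoc a (ι M ^ n) (ι (card S)) ⟨
      a * ι M ^ n * ι (card S)          ≤⟨ *-monoʳ {ι (card S)} {a * ι M ^ n} {1ℚ} (0≤ι (card S)) (δ≤ 0<a La) ⟩
      1ℚ * ι (card S)                   ≡⟨ *-identityˡ (ι (card S)) ⟩
      ι (card S)                        ∎)
      where open ≤-Reasoning

    -- 32 = 2 · 4 · 4: one factor from q ≤ 2 q₀, one from C = 4, and one from ∏ (2 + z_i) ≤ 2^k ∏ z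
    -- ≤ 4^n ∏ z.
    upper-product : ∀ {u} → 0ℚ ≤ u → ι q₀ ^ n * u ≤ ι 4 ^ n * ι (∏ (λ i → 2 ℕ.+ z i)) → ι q ^ n * u ≤ ι 32 ^ n * ι (∏ z)
    upper-product {u} 0≤u bound = begin
      ι q ^ n * u                                       ≤⟨ *-monoʳ {u} {ι q ^ n} {(ι 2 * ι q₀) ^ n} 0≤u (^-mono-≤ {ι q} {ι 2 * ι q₀} n (0≤ι q)
                                                             (≤-trans (ι-mono q≤2q₀) (≤-reflexive (ι-* 2 q₀)))) ⟩
      (ι 2 * ι q₀) ^ n * u                              ≡⟨ cong (_* u) (^-distrib-* (ι 2) (ι q₀) n) ⟩
      ι 2 ^ n * ι q₀ ^ n * u                            ≡⟨ *-assoc (ι 2 ^ n) (ι q₀ ^ n) u ⟩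
      ι 2 ^ n * (ι q₀ ^ n * u)                          ≤⟨ *-monoˡ {ι 2 ^ n} (^-≥0 n (0≤ι 2)) bound ⟩
      ι 2 ^ n * (ι 4 ^ n * ι (∏ (λ i → 2 ℕ.+ z i)))     ≤⟨ *-monoˡ {ι 2 ^ n} (^-≥0 n (0≤ι 2)) (*-monoˡ {ι 4 ^ n} (^-≥0 n (0≤ι 4)) (ι-mono ∏≤)) ⟩
      ι 2 ^ n * (ι 4 ^ n * ι (4 ℕ.^ n ℕ.* ∏ z))         ≡⟨ cong (λ x → ι 2 ^ n * (ι 4 ^ n * x)) (trans (ι-* (4 ℕ.^ n) (∏ z)) (cong (_* ι (∏ z)) (ι-^ 4 n))) ⟩
      ι 2 ^ n * (ι 4 ^ n * (ι 4 ^ n * ι (∏ z)))         ≡⟨ rearrange (ι 2 ^ n) (ι 4 ^ n) (ι (∏ z)) ⟩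
      ι 2 ^ n * (ι 4 ^ n * ι 4 ^ n) * ι (∏ z)           ≡⟨ cong (_* ι (∏ z)) (trans (cong (ι 2 ^ n *_) (sym (^-distrib-* (ι 4) (ι 4) n))) (sym (^-distrib-* (ι 2) (ι 4 * ι 4) n))) ⟩
      ι 32 ^ n * ι (∏ z)                                ∎
      where
      open ≤-Reasoning
      rearrange : ∀ a b c → a * (b * (b * c)) ≡ a * (b * b) * c
      rearrange = solve 3 (λ a b c → a :* (b :* (b :* c)) := a :* (b :* b) :* c) refl
      q≤2q₀ : q ℕ.≤ 2 ℕ.* q₀
      q≤2q₀ = ℕ.≤-trans (ℕ.+-monoˡ-≤ q₀ (ℕ.≤-trans (ℕ.m≤m+n 2 380) 382≤q₀)) (ℕ.≤-reflexive (cong (q₀ ℕ.+_) (sym (ℕ.+-identityʳ q₀))))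
      2≤z : ∀ i → 2 ℕ.≤ z i
      2≤z i = ℕ.≤-trans (ℕ.m≤m+n 2 q₀) (ℕ.≤-trans (ℕ.m≤m+n q _) (32q≤z i))
      ∏≤ : ∏ (λ i → 2 ℕ.+ z i) ℕ.≤ 4 ℕ.^ n ℕ.* ∏ z
      ∏≤ = ℕ.≤-trans (∏-mono (λ i → 2 ℕ.+ z i) (λ i → 2 ℕ.* z i)
             (λ i → ℕ.≤-trans (ℕ.+-monoˡ-≤ (z i) (2≤z i)) (ℕ.≤-reflexive (cong (z i ℕ.+_) (sym (ℕ.+-identityʳ (z i)))))))
        (ℕ.≤-trans (ℕ.≤-reflexive (∏-scale 2 z)) (ℕ.*-monoˡ-≤ (∏ z) (2^[2+m]≤4^[1+m] m)))

    -- a, e and r are lower estimates of θ, δ^(-k/(k-1)) and L^(k/(k-1)) / (∏ X_i)^(1/(k-1)).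
    -- Multiplication by Θ q^k clears the denominators and leaves `W-bound`.
    total : ∀ {a e r} → 0ℚ ≤ a → 0ℚ ≤ r → a * ι ((6 ℕ.* (32 ℕ.* 12)) ℕ.^ k) ≤ 1ℚ → e ≤ ι (6 ℕ.* M) ^ k →
      r * ι q ^ k ≤ ι 32 ^ k * ι (∏ z) → a * e * r ≤ ι W
    total {a} {e} {r} 0≤a 0≤r aΘ≤1 e≤ rq^k≤ = *-cancelʳ {a * e * r} {ι W} {ι (Θ ℕ.* q ℕ.^ k)} (ι-mono-< (ℕ.*-mono-≤ (ℕ.m^n>0 (6 ℕ.* (32 ℕ.* 12)) k) (ℕ.m^n>0 q k))) (begin
      a * e * r * ι (Θ ℕ.* q ℕ.^ k)                     ≡⟨ cong (a * e * r *_) (trans (ι-* Θ (q ℕ.^ k)) (cong (ι Θ *_) (ι-^ q k))) ⟩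
      a * e * r * (ι Θ * ι q ^ k)                       ≡⟨ rearrange a e r (ι Θ) (ι q ^ k) ⟩
      a * ι Θ * e * (r * ι q ^ k)                       ≤⟨ *-monoʳ {r * ι q ^ k} {a * ι Θ * e} {1ℚ * E} (0≤* {r} {ι q ^ k} 0≤r (^-≥0 k (0≤ι q)))
                                                             (≤-trans (*-monoˡ {a * ι Θ} {e} {E} (0≤* {a} {ι Θ} 0≤a (0≤ι Θ)) e≤)
                                                               (*-monoʳ {E} {a * ι Θ} {1ℚ} (^-≥0 k (0≤ι (6 ℕ.* M))) aΘ≤1)) ⟩
      1ℚ * E * (r * ι q ^ k)                            ≡⟨ cong (_* (r * ι q ^ k)) (*-identityˡ E) ⟩
      E * (r * ι q ^ k)                                 ≤⟨ *-monoˡ {E} (^-≥0 k (0≤ι (6 ℕ.* M))) rq^k≤ ⟩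
      E * (ι 32 ^ k * ι (∏ z))                          ≡⟨ cong₂ _*_ (sym (ι-^ (6 ℕ.* M) k)) (trans (cong (_* ι (∏ z)) (sym (ι-^ 32 k))) (sym (ι-* (32 ℕ.^ k) (∏ z)))) ⟩
      ι ((6 ℕ.* M) ℕ.^ k) * ι (32 ℕ.^ k ℕ.* ∏ z)        ≡⟨ ι-* ((6 ℕ.* M) ℕ.^ k) (32 ℕ.^ k ℕ.* ∏ z) ⟨
      ι ((6 ℕ.* M) ℕ.^ k ℕ.* (32 ℕ.^ k ℕ.* ∏ z))        ≤⟨ ι-mono (W-bound 6 32) ⟩
      ι (W ℕ.* (Θ ℕ.* q ℕ.^ k))                         ≡⟨ ι-* W (Θ ℕ.* q ℕ.^ k) ⟩
      ι W * ι (Θ ℕ.* q ℕ.^ k)                           ∎)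
      where
      open ≤-Reasoning
      Θ : ℕ
      Θ = (6 ℕ.* (32 ℕ.* 12)) ℕ.^ k
      E : ℚ
      E = ι (6 ℕ.* M) ^ k
      rearrange : ∀ a e r t s → a * e * r * (t * s) ≡ a * t * e * (r * s)
      rearrange = solve 5 (λ a e r t s → a :* e :* r :* (t :* s) := a :* t :* e :* (r :* s)) refl

open import Data.Nat.Base using (ℕ; NonZero; NonTrivial; nonTrivial⇒nonZero; _∸_)
open import Data.Integer.Base using (ℤ; +_; -_)
open import Data.Fin.Base using (Fin)
open import Data.Vec.Base using (Vec; lookup)
open import Data.Product.Base using (Σ-syntax; _×_)

-- The theorem for reals given only by their rational bounds.

module Assembly where

  open import Data.Nat.Base as ℕ using (suc)
  import Data.Nat.Properties as ℕ
  open import Data.Rational.Base hiding (_≥_; _>_; ∣_∣; -_; NonZero)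
  open import Data.Rational.Properties
  open import Algebra.Definitions.RawSemiring +-*-rawSemiring using (_^_)
  open import Data.Vec.Functional using (Vector)
  open import Data.Product.Base using (∃-syntax; _,_; proj₁; proj₂)
  open import Relation.Binary.PropositionalEquality
  open ℚ-Lemmas hiding (p; q; r; a; b; c; d)
  open Moduli
  open Selections
  open RationalBounds
  open Constants
  open Powers
  open Estimates

  Conclusion : ∀ k (B δ Λ : ℝ⁺) (X : Vector ℝ⁺ k) → ℝ → Set
  Conclusion k B δ Λ X τ = Σ[ A ∈ (Fin k → FinSet ℤ) ]
    ((i : Fin k) (a : ℤ) → a ∈ˢ A i → ↑ X i ≤ʳ fromℤ a × fromℤ a ≤ʳ ↑ (B *⁺ X i))
    × (↑ δ *ʳ fromℕ (∏ (λ i → card (A i)))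
        ≤# (λ (a : Vec ℤ k) → ((i : Fin k) → lookup a i ∈ˢ A i) × fromℤ (lcmᵛ a) ≤ʳ ↑ Λ))
    × (τ ≤ʳ fromℕ (∏ (λ i → card (A i))))

  -- The product of cardinalities enters as `w`, so that bounds proved for the opaque `W` are
  -- transferred by matching on one equation.
  conclude : ∀ {k} (B δ Λ : ℝ⁺) (X : Vector ℝ⁺ k) τ (A : Fin k → FinSet ℤ) (S : FinSet (Vec ℤ k)) w →
    ∏ (λ i → card (A i)) ≡ w →
    (∀ i a → a ∈ˢ A i → ↑ X i ≤ʳ fromℤ a × fromℤ a ≤ʳ ↑ (B *⁺ X i)) →
    (∀ {v} → v ∈ˢ S → ∀ i → lookup v i ∈ˢ A i) → (∀ {v} → v ∈ˢ S → fromℤ (lcmᵛ v) ≤ʳ ↑ Λ) →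
    ↑ δ *ʳ fromℕ w ≤ʳ fromℕ (card S) → τ ≤ʳ fromℕ w → Conclusion k B δ Λ X τ
  conclude B δ Λ X τ A S w refl interval S⊆A S-lcm density total =
    A , interval , (S , (λ v∈ → S⊆A v∈ , S-lcm v∈) , density) , total

  -- Every real is a variable, known through the bounds its cuts provide: D is δ^(-1/n), Y is (∏ X_i
  -- / L)^(1/n), E is δ^(-k/n), F is L^(k/n), G is (∏ X_i)^(-1/n), μ is the minimum of the X_i, and
  -- y is 2 M.
  construct : ∀ m {c D C Y κ μ K y δ Λ θ E F G B : ℝ⁺} {X : Vector ℝ⁺ (2 ℕ.+ m)} {M} →
    let n = suc m; k = suc n in
    0 ℕ.< M → ⌈ ↑ (c *⁺ D) ⌉≡ + M →
    ↑ K *ʳ fromℕ M *ʳ log y ≤ʳ ↑ (C *⁺ Y) → ↑ (C *⁺ Y) ≤ʳ ↑ (κ *⁺ μ) → ↑ δ ≤ʳ 1ʳ →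
    (∀ {a} → 0ℚ < a → L (↑ c) a → a * ι 2 ≤ 1ℚ) → (∀ {b} → U (↑ c) b → 1ℚ ≤ b * ι 2) →
    ι 4 ⊑ ↑ C → ↑ C ⊒ ι 4 → ι 3072 ⊑ ↑ K → (∀ {a} → 0ℚ < a → L (↑ κ) a → a * ι 50 ≤ 1ℚ) →
    (∀ {a} → 0ℚ < a → L (↑ θ) a → a * ι ((6 ℕ.* (32 ℕ.* 12)) ℕ.^ k) ≤ 1ℚ) →
    ι 2 ⊑ ↑ B → ι (2 ℕ.* M) ⊑ ↑ y → (∀ {b} → L (↑ μ) b → ∀ i → L (↑ X i) b) →
    (∀ {e} → 0ℚ < e → L (↑ D) e → ∃[ u ] U (↑ δ) u × e ^ n * u ≤ 1ℚ) →
    (∀ {d} → U (↑ D) d → 0ℚ < d × ∃[ l ] 0ℚ < l × L (↑ δ) l × 1ℚ ≤ d ^ n * l) →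
    (∀ {p d} → ↑ ∏⁺ X ⊒ p → 0ℚ < d → L (↑ Y) d → ∃[ u ] U (↑ Λ) u × d ^ n * u ≤ p) →
    (∀ {p d} → p ⊑ ↑ ∏⁺ X → U (↑ Y) d → 0ℚ < d × ∃[ l ] 0ℚ < l × L (↑ Λ) l × p ≤ d ^ n * l) →
    (∀ {e l b} → 0ℚ < l → L (↑ δ) l → 0ℚ ≤ b → 1ℚ ≤ b ^ n * l → 0ℚ < e → L (↑ E) e → e ≤ b ^ k) →
    (∀ {f u} → U (↑ Λ) u → 0ℚ < f → L (↑ F) f → f ^ n ≤ u ^ k) →
    (∀ {p g} → p ⊑ ↑ ∏⁺ X → 0ℚ < g → L (↑ G) g → g ^ n * p ≤ 1ℚ) →
    Conclusion k B δ Λ X (↑ (θ *⁺ E *⁺ (F *⁺ G)))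
  construct m {c} {D} {C} {Y} {κ} {μ} {K} {y} {δ} {Λ} {θ} {E} {F} {G} {B} {X} {M}
    0<M (M-1<cD , cD≤M) low high δ≤1
    c≤½ c≥½ 4⊑C C⊒4 K⊑ κ≤ θ≤ 2⊑B 2M⊑y μ-L D-L D-U Y-L Y-U E-L F-L G-L =
    from-approximations (natural-part (C *⁺ Y)) (λ i → natural-part (X i)) (binary-scale-2* M 0<M)
    where
    from-approximations :
      (∃[ q₀ ] L (↑ (C *⁺ Y)) (ι q₀) × U (↑ (C *⁺ Y)) (ι (2 ℕ.+ q₀))) →
      (∀ i → ∃[ z ] L (↑ X i) (ι z) × U (↑ X i) (ι (2 ℕ.+ z))) →
      (∃[ t ] 2 ℕ.^ suc t ℕ.≤ 2 ℕ.* M × 2 ℕ.* M ℕ.≤ 2 ℕ.^ (2 ℕ.+ t) × 2 ℕ.^ (2 ℕ.+ t) ℕ.≤ 4 ℕ.* M) →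
      Conclusion (2 ℕ.+ m) B δ Λ X (↑ (θ *⁺ E *⁺ (F *⁺ G)))
    from-approximations (q₀ , Q-L , Q-U) Z (t , 2^t≤2M , 2M≤N , N≤4M) =
      conclude B δ Λ X (↑ (θ *⁺ E *⁺ (F *⁺ G))) A S W ∏-card-A (interval B 2⊑B) S⊆A members
        (density δ δ-upper) (⊒⇒≤ʳ (↑ (θ *⁺ E *⁺ (F *⁺ G))) {ι W} total-lower)
      where
      -- q exceeds Q, as the sieve condition and the lcm bound require; q₀ lies below Q, as required
      -- for comparing with the X_i and for bounding the cardinalities from below.
      q : ℕ
      q = 2 ℕ.+ q₀
      large : 384 ℕ.* (M ℕ.* (2 ℕ.+ t)) ℕ.≤ q
      large = large-modulus M t q (size-condition (↑ K) (fromℕ M) y (↑ (C *⁺ Y)) {3072} {M} {t} {q} K⊑ (⊑-fromℕ M)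
        (λ u Uu → ≤-trans (ι-mono 2^t≤2M) (2M⊑y u Uu)) low Q-U)
      382≤q₀ : 382 ℕ.≤ q₀
      382≤q₀ = q₀-large M (2 ℕ.+ t) q₀ 0<M ℕ.z<s large
      z : Vector ℕ (2 ℕ.+ m)
      z i = proj₁ (Z i)
      X-L : ∀ i → L (↑ X i) (ι (z i))
      X-L i = proj₁ (proj₂ (Z i))
      X-U : ∀ i → U (↑ X i) (ι (2 ℕ.+ z i))
      X-U i = proj₂ (proj₂ (Z i))
      32q≤z : ∀ i → 32 ℕ.* q ℕ.≤ z i
      32q≤z i = z-large q₀ (z i) 382≤q₀ (range-condition κ μ (↑ (C *⁺ Y)) {50} {q₀} {2 ℕ.+ z i} κ≤
        (λ l Ll → U⇒⊒ (↑ X i) (X-U i) l (μ-L Ll i)) high Q-L)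
      open Construction m M q₀ (progressions M (2 ℕ.+ t) q 0<M ℕ.z<s 2M≤N N≤4M large) X z X-L X-U 0<M 382≤q₀ 32q≤z
        hiding (q)
      δ-upper : ∀ {a} → 0ℚ < a → L (↑ δ) a → a * ι M ^ suc m ≤ 1ℚ
      δ-upper = ceiling-upper m c D δ c≤½ D-L δ≤1 M {{ℕ.>-nonZero 0<M}} M-1<cD
      members : ∀ {v} → v ∈ˢ S → fromℤ (lcmᵛ v) ≤ʳ ↑ Λ
      members v∈ =
        let l , Ll , bound = scale-upper m C Y {L (↑ Λ)} {ι 4} {ι (∏ z)} {ι q} (0≤ι 4) (0≤ι q) 4⊑C (Y-U ∏X-⊑) Q-U
        in lcm-bound Λ {l} Ll bound v∈
      total-lower : ↑ (θ *⁺ E *⁺ (F *⁺ G)) ⊒ ι W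
      total-lower s Ls =
        let a , e , f , g , 0<a , La , 0<e , Le , 0<f , Lf , 0<g , Lg , s≤ = *⁺-*⁺-L⁻ θ E F G Ls
            u , Uu , q₀^nu≤ = scale-lower m C Y {U (↑ Λ)} {ι 4} {ι (∏ (λ i → 2 ℕ.+ z i))} {ι q₀} (0≤ι 4) (0≤ι q₀) C⊒4
              (Positive-Lemmas.0<U Λ) (Y-L ∏X-⊒) Q-L
            l , 0<l , Ll , 1≤ = ceiling-lower m c D {L (↑ δ)} c≥½ D-U M 0<M cD≤M
            0≤u = <⇒≤ (Positive-Lemmas.0<U Λ Uu)
            0≤fg = 0≤* {f} {g} (<⇒≤ 0<f) (<⇒≤ 0<g)
        in ≤-trans s≤ (total {a} {e} {f * g} (<⇒≤ 0<a) 0≤fg (θ≤ 0<a La)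
             (E-L {e} {l} {ι (6 ℕ.* M)} 0<l Ll (0≤ι (6 ℕ.* M)) 1≤ 0<e Le)
             (ratio-bound m {ι (∏ z)} {ι q} {u} {ι 32} {f} {g} (0≤ι (∏ z)) (0≤ι q) 0≤u (0≤ι 32) (<⇒≤ 0<f) (<⇒≤ 0<g)
               (upper-product {u} 0≤u q₀^nu≤) (F-L {f} {u} Uu 0<f Lf) (G-L {ι (∏ z)} {g} ∏X-⊑ 0<g Lg)))

-- The explicit constants.

module Specialisation where

  open import Data.Nat.Base as ℕ using (suc)
  import Data.Nat.Properties as ℕ
  open import Data.Product.Base using (_,_)
  open RationalBounds
  open Selections
  open Constants
  open Powers
  open Assembly

  -- 6 from M ≥ D/6, 32 from the comparison of Q with (∏ X_i / L)^(1/(k-1)), and 12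
  -- from the size of a block.
  Θ : ℕ → ℕ
  Θ m = (6 ℕ.* (32 ℕ.* 12)) ℕ.^ (2 ℕ.+ m)

  Θ≢0 : ∀ m → NonZero (Θ m)
  Θ≢0 m = ℕ.m^n≢0 (6 ℕ.* (32 ℕ.* 12)) (2 ℕ.+ m)

  -- The number of clashes is at most half of the multiples once 384 M h ≤ Q, where
  -- 2^h ≤ 4M; the bound log (2M) ≥ (h - 1)/4 ≥ h/8 turns this into K = 8 · 384.
  c⁺ C⁺ K⁺ κ⁺ : ℝ⁺
  c⁺ = fromℕ⁺ 2 ⁻¹
  C⁺ = fromℕ⁺ 4
  K⁺ = fromℕ⁺ 3072
  κ⁺ = fromℕ⁺ 50 ⁻¹

  θ⁺ : (k : ℕ) .{{_ : NonTrivial k}} → ℝ⁺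
  θ⁺ (suc (suc m)) = fromℕ⁺ (Θ m) {{Θ≢0 m}} ⁻¹

  construction : (k : ℕ) .{{_ : NonTrivial k}} (δ : ℝ⁺) → ↑ δ ≤ʳ 1ʳ →
      (X : Fin k → ℝ⁺) → ((i : Fin k) → 1ʳ ≤ʳ ↑ X i) →
      (L : ℝ⁺) → 1ʳ ≤ʳ ↑ L →
      (M : ℕ) .{{_ : NonZero M}} → ⌈ ↑ (c⁺ *⁺ δ ^[ - + 1 / k ∸ 1 ]) ⌉≡ + M →
      let Q = C⁺ *⁺ (∏⁺ X /⁺ L) ^[ + 1 / k ∸ 1 ] in
      ↑ K⁺ *ʳ fromℕ M *ʳ log (fromℕ⁺ 2 *⁺ fromℕ⁺ M) ≤ʳ ↑ Q →
      ↑ Q ≤ʳ ↑ (κ⁺ *⁺ minimum {{nonTrivial⇒nonZero k}} X) →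
      Σ[ A ∈ (Fin k → FinSet ℤ) ]
      ((i : Fin k) (a : ℤ) → a ∈ˢ A i → ↑ X i ≤ʳ fromℤ a × fromℤ a ≤ʳ ↑ (fromℕ⁺ 2 *⁺ X i))
      × (↑ δ *ʳ fromℕ (∏ (λ i → card (A i)))
      ≤# (λ (a : Vec ℤ k) → ((i : Fin k) → lookup a i ∈ˢ A i) × fromℤ (lcmᵛ a) ≤ʳ ↑ L))
      × (↑ (θ⁺ k *⁺ δ ^[ - + k / k ∸ 1 ] *⁺ (L ^[ + k / k ∸ 1 ] /⁺ ∏⁺ X ^[ + 1 / k ∸ 1 ]))
      ≤ʳ fromℕ (∏ (λ i → card (A i))))
  construction (suc (suc m)) {{nt}} δ δ≤1 X 1≤X Λ 1≤Λ M {{M≢0}} ceiling low high =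
    construct m {c⁺} {_^[_/_] δ (- + 1) (suc (suc m) ∸ 1) {{nonTrivial⇒pred-nonZero {suc (suc m)} {{nt}}}}}
      {C⁺} {_^[_/_] (∏⁺ X /⁺ Λ) (+ 1) (suc (suc m) ∸ 1) {{nonTrivial⇒pred-nonZero {suc (suc m)} {{nt}}}}}
      {κ⁺} {minimum {{nonTrivial⇒nonZero (suc (suc m)) {{nt}}}} X} {K⁺} {_} {δ} {Λ} {θ⁺ (suc (suc m)) {{nt}}}
      {_^[_/_] δ (- + suc (suc m)) (suc (suc m) ∸ 1) {{nonTrivial⇒pred-nonZero {suc (suc m)} {{nt}}}}}
      {_^[_/_] Λ (+ suc (suc m)) (suc (suc m) ∸ 1) {{nonTrivial⇒pred-nonZero {suc (suc m)} {{nt}}}}}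
      {(_^[_/_] (∏⁺ X) (+ 1) (suc (suc m) ∸ 1) {{nonTrivial⇒pred-nonZero {suc (suc m)} {{nt}}}}) ⁻¹}
      {fromℕ⁺ 2 {{ℕ.nonZero}}} {X} {M}
      0<M ceiling low high δ≤1
      (reciprocal-L 2) (reciprocal-U 2) (⊑-fromℕ 4) (⊒-fromℕ 4) (⊑-fromℕ 3072) (reciprocal-L 50)
      (reciprocal-L (Θ m) {{Θ≢0 m}}) (⊑-fromℕ 2) (2M-⊑ M {{M≢0}}) (minimum-L⁻ X)
      (inverse-root-L m δ) (inverse-root-U m δ) (quotient-root-L m (∏⁺ X) Λ) (quotient-root-U m (∏⁺ X) Λ)
      (inverse-power-root-L m δ) (power-root-L m Λ) (root-inverse-L m (∏⁺ X))
    where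
    0<M : 0 ℕ.< M
    0<M = ℕ.>-nonZero⁻¹ M {{M≢0}}

open import Data.Product.Base using (_,_)
open Specialisation

proposition4p2 : (k : ℕ) .{{_ : NonTrivial k}} →
    Σ[ c ∈ ℝ⁺ ] Σ[ C ∈ ℝ⁺ ] Σ[ K ∈ ℝ⁺ ] Σ[ κ ∈ ℝ⁺ ] Σ[ θ ∈ ℝ⁺ ]
    ((δ : ℝ⁺) → ↑ δ ≤ʳ 1ʳ →
    (X : Fin k → ℝ⁺) → ((i : Fin k) → 1ʳ ≤ʳ ↑ X i) →
    (L : ℝ⁺) → 1ʳ ≤ʳ ↑ L →
    (M : ℕ) .{{_ : NonZero M}} → ⌈ ↑ (c *⁺ δ ^[ - + 1 / k ∸ 1 ]) ⌉≡ + M →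
    let Q = C *⁺ (∏⁺ X /⁺ L) ^[ + 1 / k ∸ 1 ] in
    ↑ K *ʳ fromℕ M *ʳ log (fromℕ⁺ 2 *⁺ fromℕ⁺ M) ≤ʳ ↑ Q →
    ↑ Q ≤ʳ ↑ (κ *⁺ minimum {{nonTrivial⇒nonZero k}} X) →
    Σ[ A ∈ (Fin k → FinSet ℤ) ]
    ((i : Fin k) (a : ℤ) → a ∈ˢ A i → ↑ X i ≤ʳ fromℤ a × fromℤ a ≤ʳ ↑ (fromℕ⁺ 2 *⁺ X i))
    × (↑ δ *ʳ fromℕ (∏ (λ i → card (A i)))
    ≤# (λ (a : Vec ℤ k) → ((i : Fin k) → lookup a i ∈ˢ A i) × fromℤ (lcmᵛ a) ≤ʳ ↑ L))
    × (↑ (θ *⁺ δ ^[ - + k / k ∸ 1 ] *⁺ (L ^[ + k / k ∸ 1 ] /⁺ ∏⁺ X ^[ + 1 / k ∸ 1 ]))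
    ≤ʳ fromℕ (∏ (λ i → card (A i)))))
proposition4p2 k {{nt}} = c⁺ , C⁺ , K⁺ , κ⁺ , θ⁺ k {{nt}} , construction k {{nt}}
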